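{- Let $n,k$ be positive integers, $\delta_0\in(0,1)$ and $c=10^{ -9}\delta_0$. Suppose $\mathcal{A}\subset\binom{[n]}{k}$ with $|\mathcal{A}|=\binom{x}{k}$ for a real number $x\ge k$, and $|\partial(\mathcal{A})|\le(1+\tfrac{c}{x})\binom{x}{k-1}$. Then there is $S\subset[n]$ with $|\mathcal{A}\triangle\binom{S}{k}|\le\delta_0\binom{|S|-1}{k-1}$. Furthermore, for this $S$, if $|\mathcal{A}\cap\binom{S}{k}|=\binom{|S|-1}{k}+E_1$ and $|\mathcal{A}\setminus\binom{S}{k}|=E_2$ where $0\le E_1,E_2\le\binom{|S|-1}{k-1}$, then $|\partial(\mathcal{A})|\ge|\partial(\mathcal{J}^{(k)}_{|S|,E_1,E_2})|$.
   Context: For real $x$ and integer $k\ge0$, $\binom{x}{k}=x(x-1)\cdots(x-k+1)/k!$. $\binom{S}{k}$ is the family of $k$-element subsets of $S$. For a family $\mathcal{C}$ of $k$-sets, its shadow is $\partial\mathcal{C}=\{B: |B|=k-1,\ B\subset A\text{ for some }A\in\mathcal{C}\}$. The colex order on $k$-element sets of positive integers is: $A<B$ iff $\max(A\triangle B)\in B$; $\mathcal{I}^{(k)}_m$ denotes its initial segment of length $m$. For an integer $s$ and integers $E_1,E_2\ge0$, $\mathcal{J}^{(k)}_{s,E_1,E_2}=\mathcal{I}^{(k)}_{\binom{s-1}{k}+E_1}\cup\big(\mathcal{I}^{(k)}_{\binom{s}{k}+E_2}\setminus\mathcal{I}^{(k)}_{\binom{s}{k}}\big)$. -}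

module Defs where

open import Level using (0ℓ)
open import Data.Bool using (Bool; true; false; _∧_; _∨_; not; if_then_else_)
open import Data.Nat using (ℕ; zero; suc; _∸_; _≡ᵇ_; _<ᵇ_)
open import Data.Nat.Base using (_!) renaming (_+_ to _+ℕ_)
open import Data.Nat.Combinatorics using (_C_)
open import Data.List using (List; []; _∷_; map; _++_)
open import Data.Nat.ListAction using (sum)
open import Data.Bool.ListAction using (any)
open import Data.Vec using (Vec; []; _∷_)
open import Data.Fin.Subset using (Subset; ∣_∣)
open import Data.Product using (∃; _×_)
open import Relation.Nullary using (¬_)
open import Relation.Binary.Structures using (IsTotalOrder)
open import Algebra.Bundles using (CommutativeRing)

-- The real numbers, axiomatised as a complete ordered field
-- (unique up to isomorphism, so quantifying over all models = ℝ).

record CompleteOrderedField : Set₁ where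
  field
    ℝring : CommutativeRing 0ℓ 0ℓ
  open CommutativeRing ℝring public
  infix 4 _≤_
  infix 8 _⁻¹
  field
    _≤_           : Carrier → Carrier → Set
    ≤-isTotalOrder : IsTotalOrder _≈_ _≤_
    0≉1           : ¬ (0# ≈ 1#)
    _⁻¹           : Carrier → Carrier
    ⁻¹-inverse    : ∀ x → ¬ (x ≈ 0#) → (x * (x ⁻¹)) ≈ 1#
    +-monoˡ-≤     : ∀ {x y} z → x ≤ y → (x + z) ≤ (y + z)
    *-nonneg      : ∀ {x y} → 0# ≤ x → 0# ≤ y → 0# ≤ (x * y)
    sup : (P : Carrier → Set) → ∃ P → ∃ (λ b → ∀ y → P y → y ≤ b) →
          ∃ (λ s → (∀ y → P y → y ≤ s) × (∀ b → (∀ y → P y → y ≤ b) → s ≤ b))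

  infix 4 _<_
  _<_ : Carrier → Carrier → Set
  x < y = (x ≤ y) × ¬ (x ≈ y)

  fromℕ : ℕ → Carrier
  fromℕ zero    = 0#
  fromℕ (suc m) = 1# + fromℕ m

  _/_ : Carrier → Carrier → Carrier
  x / y = x * (y ⁻¹)

  falling : Carrier → ℕ → Carrier
  falling x zero    = 1#
  falling x (suc k) = falling x k * (x - fromℕ k)

  binomR : Carrier → ℕ → Carrier
  binomR x k = falling x k / fromℕ (k !)

-- Finite set systems.  Subsets of [n] are represented as Subset n
-- (= Vec Bool n over Fin n; element i of Fin n stands for i+1 ∈ [n]).
-- A family of subsets of [n] is a Boolean predicate on Subset n.

allSubsets : ∀ n → List (Subset n)
allSubsets zero    = [] ∷ []
allSubsets (suc n) = map (false ∷_) (allSubsets n) ++ map (true ∷_) (allSubsets n)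

Family : ℕ → Set
Family n = Subset n → Bool

card : ∀ {n} → Family n → ℕ
card {n} F = sum (map (λ X → if F X then 1 else 0) (allSubsets n))

_⊆ᵇ_ : ∀ {n} → Subset n → Subset n → Bool
[] ⊆ᵇ [] = true
(x ∷ xs) ⊆ᵇ (y ∷ ys) = (not x ∨ y) ∧ (xs ⊆ᵇ ys)

eqᵇ : ∀ {n} → Subset n → Subset n → Bool
eqᵇ [] [] = true
eqᵇ (x ∷ xs) (y ∷ ys) = (if x then y else not y) ∧ eqᵇ xs ys

hasSize : ∀ {n} → ℕ → Subset n → Bool
hasSize k X = ∣ X ∣ ≡ᵇ k

kSubsetsOf : ∀ {n} → ℕ → Subset n → Family n
kSubsetsOf k S X = hasSize k X ∧ (X ⊆ᵇ S)

_∩ᶠ_ _∪ᶠ_ _∖ᶠ_ _△ᶠ_ : ∀ {n} → Family n → Family n → Family n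
(F ∩ᶠ G) X = F X ∧ G X
(F ∪ᶠ G) X = F X ∨ G X
(F ∖ᶠ G) X = F X ∧ not (G X)
(F △ᶠ G) X = (F X ∧ not (G X)) ∨ (G X ∧ not (F X))

shadow : ∀ {n} → ℕ → Family n → Family n
shadow {n} k F B =
  hasSize (k ∸ 1) B ∧ any (λ A → F A ∧ (B ⊆ᵇ A)) (allSubsets n)

-- colex order: A <colex B iff max(A △ B) ∈ B.
-- Index 0 is the smallest element, so the largest elements sit at the
-- end of the vector: if the parts above the first coordinate agree,
-- the maximum of A △ B is that coordinate (if they differ there).
colexLt : ∀ {n} → Subset n → Subset n → Bool
colexLt [] [] = false
colexLt (a ∷ as) (b ∷ bs) = if eqᵇ as bs then (not a ∧ b) else colexLt as bs

-- initial segment I^{(k)}_m of the colex order on k-subsets,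
-- realised inside the ground set [N]: the k-sets having fewer than m
-- colex-predecessors.  (All colex-predecessors of a k-set A lie in
-- [max A], so for N large enough this is exactly I^{(k)}_m.)
initSeg : ∀ N → ℕ → ℕ → Family N
initSeg N k m A =
  hasSize k A ∧ (card (λ B → hasSize k B ∧ colexLt B A) <ᵇ m)

Jfam : ∀ N → (k s E₁ E₂ : ℕ) → Family N
Jfam N k s E₁ E₂ =
  initSeg N k (((s ∸ 1) C k) +ℕ E₁) ∪ᶠ
  (initSeg N k ((s C k) +ℕ E₂) ∖ᶠ initSeg N k (s C k))

{-# OPTIONS --safe #-}
module Submission where

-- The stability part descends along links.  If |∂A| is nearly minimal, some vertex v has a link whose ratio to the link of ∂A is
-- at least the average; q = |S| - r is unchanged and the relative deficiency does not grow, so that after r steps the links are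
-- nearly the singletons of a q-set S₀, and S is S₀ together with the chosen vertices.  Going back up, few sets of S^(r) and
-- S^(r+1) are missing because a set missing from ∂A comes from one missing from the link of ∂A or of A, and Lovász's bound
-- controls A outside S in terms of ∂A outside S.
-- To start, x must be close to s or s + 1, where C(s, k) ≤ |A| < C(s + 1, k): Kruskal–Katona gives |∂A| ≥ C(s, k - 1) + |∂L| with
-- |L| = |A| - C(s, k), and Lovász's bound for L then contradicts the smallness of |∂A| when x is far from an integer.
-- For the second part, Kruskal–Katona is applied to A ∩ S^(k), and to the links of the remaining sets at vertices outside S, put on
-- disjoint ground sets; the shadow of J is the shadow of its first segment together with the top vertex added to such a shadow.

-- The obstacle is that averaging over vertices controls the ratio of the link of A to the link of
-- ∂A but not their sizes: a larger clique has a better ratio. So a bound |B| ≤ C(q + r, r) + 10 ε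
-- C(q + r - 1, r - 1) must be proved again at every level with the same constant 10. A crude count
-- gives only 21; Kruskal-Katona applied to the surplus of the link, followed by Lovász's bound one
-- uniformity lower, brings it back to 10. Passing to lower uniformity costs a factor (j + 2)/(j +
-- 1), which `gap` regains for families with small shadow; the sets outside S are treated by the
-- same device. The deficiency is kept as ep ≤ ε q / |S| rather than ε: with this factor the error
-- constant 2 in `Close` reproduces itself on the way up. It also forces x to be located within O(c
-- q / s) of an integer, not merely O(c), and for q small against r this is what makes the passage
-- to complements necessary. Constants: ε = 1000 c. The smallness of c enters as 1000 ε ≤ 1, and as
-- 20000 c ≤ δ₀ for the final distance 14 ε = 14000 c.

open import Defs
open import Data.Nat.Base as ℕ using (ℕ; zero; suc; s≤s; _∸_; _^_; _!) renaming (_+_ to _+ℕ_; _≤_ to _≤ℕ_)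
import Data.Nat.Properties as ℕₚ
open import Data.Nat.Combinatorics using (_C_)
open import Data.Bool using (Bool; true; false; T; _∧_; _∨_; not; if_then_else_)
open import Data.Fin using (Fin; zero; suc)
open import Data.Fin.Subset using (Subset; ∣_∣; ⊥)
open import Data.List.Base using (List; []; _∷_)
open import Data.Vec.Base as Vec using (Vec; []; _∷_; lookup)
open import Data.Vec.Properties using (lookup∘update)
open import Data.Product using (∃; _×_; _,_; proj₁; proj₂)
open import Data.Sum using (_⊎_; inj₁; inj₂)
open import Data.Empty using (⊥-elim)
open import Data.Unit using (tt)
open import Function using (_∘_)
open import Relation.Nullary using (¬_; yes; no)
open import Relation.Binary.PropositionalEquality as ≡ using (_≡_)

-- Families as Boolean predicates: cardinalities, links, deletions and shadows.

module Families where
  open import Data.Nat.Base using (_+_; _≤_; _<_; z≤n)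
  open import Data.Nat.Properties
  open import Algebra.Properties.CommutativeSemigroup +-commutativeSemigroup using (interchange)
  open import Data.Nat.Combinatorics using (nCk+nC[k+1]≡[n+1]C[k+1])
  open import Data.Bool.Properties using (T-∧; T-∨)
  open import Data.Fin.Properties using () renaming (_≟_ to _≟ᶠ_)
  open import Data.List.Base using (map)
  open import Data.List.Properties using (map-++; map-∘; map-cong)
  open import Data.Nat.ListAction using (sum)
  open import Data.Nat.ListAction.Properties using (sum-++)
  open import Data.Vec.Base using (_[_]≔_)
  open import Data.Vec.Properties using (lookup∘update′; []≔-commutes; []≔-idempotent; []≔-lookup)
  open import Function.Bundles using (Equivalence)
  open import Relation.Binary.PropositionalEquality

  infix 4 _⊑_

  _⊑_ : ∀ {n} → Family n → Family n → Set
  F ⊑ G = ∀ X → T (F X) → T (G X)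

  ∧-intro : ∀ {x y} → T x → T y → T (x ∧ y)
  ∧-intro p q = Equivalence.from T-∧ (p , q)

  ∧-fst : ∀ {x y} → T (x ∧ y) → T x
  ∧-fst p = proj₁ (Equivalence.to T-∧ p)

  ∧-snd : ∀ {x y} → T (x ∧ y) → T y
  ∧-snd p = proj₂ (Equivalence.to T-∧ p)

  ∨-cases : ∀ {x y} → T (x ∨ y) → T x ⊎ T y
  ∨-cases = Equivalence.to T-∨

  ∨-left : ∀ {x y} → T x → T (x ∨ y)
  ∨-left p = Equivalence.from T-∨ (inj₁ p)

  ∨-right : ∀ {x y} → T y → T (x ∨ y)
  ∨-right p = Equivalence.from T-∨ (inj₂ p)

  true⇒T : ∀ {x} → x ≡ true → T x
  true⇒T refl = tt

  T⇒true : ∀ {x} → T x → x ≡ true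
  T⇒true {true} _ = refl

  not-intro : ∀ {x} → x ≡ false → T (not x)
  not-intro refl = tt

  not-elim : ∀ {x} → T (not x) → x ≡ false
  not-elim {false} _ = refl

  ¬T⇒not : ∀ {x} → ¬ T x → T (not x)
  ¬T⇒not {true}  h = h tt
  ¬T⇒not {false} h = tt

  not⇒¬T : ∀ {x} → T (not x) → ¬ T x
  not⇒¬T {false} _ ()

  T? : ∀ x → T x ⊎ T (not x)
  T? true  = inj₁ tt
  T? false = inj₂ tt

  true≢false : ∀ {x} → x ≡ true → x ≡ false → ∀ {A : Set} → A
  true≢false refl ()

  T-ext : ∀ {x y} → (T x → T y) → (T y → T x) → x ≡ y
  T-ext {true}  {true}  f g = refl
  T-ext {true}  {false} f g = ⊥-elim (f tt)
  T-ext {false} {true}  f g = ⊥-elim (g tt)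
  T-ext {false} {false} f g = refl

  bit : Bool → ℕ
  bit b = if b then 1 else 0

  card-suc : ∀ {n} (F : Family (suc n)) → card F ≡ card (F ∘ (false ∷_)) + card (F ∘ (true ∷_))
  card-suc {n} F = trans (cong sum (map-++ g (map (false ∷_) xs) (map (true ∷_) xs)))
      (trans (sum-++ (map g (map (false ∷_) xs)) (map g (map (true ∷_) xs)))
        (cong₂ _+_ (cong sum (sym (map-∘ xs))) (cong sum (sym (map-∘ xs)))))
    where
    xs = allSubsets n
    g = λ X → if F X then 1 else 0

  card-zero : (F : Family 0) → card F ≡ bit (F [])
  card-zero F = +-identityʳ _

  card-cong : ∀ {n} {F G : Family n} → (∀ X → F X ≡ G X) → card F ≡ card G
  card-cong {n} h = cong sum (map-cong (λ X → cong bit (h X)) (allSubsets n))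

  bit-mono : ∀ {x y} → (T x → T y) → bit x ≤ bit y
  bit-mono {false} h = z≤n
  bit-mono {true} {true} h = ≤-refl
  bit-mono {true} {false} h = ⊥-elim (h tt)

  card-mono : ∀ {n} {F G : Family n} → F ⊑ G → card F ≤ card G
  card-mono {zero} {F} {G} h rewrite card-zero F | card-zero G = bit-mono (h [])
  card-mono {suc n} {F} {G} h rewrite card-suc F | card-suc G =
    +-mono-≤ (card-mono (λ X → h (false ∷ X))) (card-mono (λ X → h (true ∷ X)))

  card-ext : ∀ {n} {F G : Family n} → F ⊑ G → G ⊑ F → card F ≡ card G
  card-ext h k = ≤-antisym (card-mono h) (card-mono k)

  bit-∪∩ : ∀ x y → bit (x ∨ y) + bit (x ∧ y) ≡ bit x + bit y
  bit-∪∩ true  true  = refl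
  bit-∪∩ true  false = refl
  bit-∪∩ false true  = refl
  bit-∪∩ false false = refl

  card-∪∩ : ∀ {n} (F G : Family n) → card (F ∪ᶠ G) + card (F ∩ᶠ G) ≡ card F + card G
  card-∪∩ {zero} F G rewrite card-zero (F ∪ᶠ G) | card-zero (F ∩ᶠ G) | card-zero F | card-zero G = bit-∪∩ (F []) (G [])
  card-∪∩ {suc n} F G rewrite card-suc (F ∪ᶠ G) | card-suc (F ∩ᶠ G) | card-suc F | card-suc G =
    trans (interchange (card ((F ∪ᶠ G) ∘ (false ∷_))) _ _ _)
      (trans (cong₂ _+_ (card-∪∩ (F ∘ (false ∷_)) (G ∘ (false ∷_))) (card-∪∩ (F ∘ (true ∷_)) (G ∘ (true ∷_))))
        (interchange (card (F ∘ (false ∷_))) _ _ _))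

  bit-split : ∀ x y → bit x ≡ bit (x ∧ y) + bit (x ∧ not y)
  bit-split true  true  = refl
  bit-split true  false = refl
  bit-split false y     = refl

  card-split : ∀ {n} (F G : Family n) → card F ≡ card (F ∩ᶠ G) + card (F ∖ᶠ G)
  card-split {zero} F G rewrite card-zero (F ∖ᶠ G) | card-zero (F ∩ᶠ G) | card-zero F = bit-split (F []) (G [])
  card-split {suc n} F G rewrite card-suc (F ∖ᶠ G) | card-suc (F ∩ᶠ G) | card-suc F =
    trans (cong₂ _+_ (card-split (F ∘ (false ∷_)) (G ∘ (false ∷_))) (card-split (F ∘ (true ∷_)) (G ∘ (true ∷_))))
      (interchange (card ((F ∘ (false ∷_)) ∩ᶠ (G ∘ (false ∷_)))) _ _ _)

  card-empty : ∀ {n} {F : Family n} → (∀ X → ¬ T (F X)) → card F ≡ 0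
  card-empty {zero} {F} h rewrite card-zero F with F [] | h []
  ... | true  | q = ⊥-elim (q tt)
  ... | false | q = refl
  card-empty {suc n} {F} h rewrite card-suc F =
    cong₂ _+_ (card-empty (λ X → h (false ∷ X))) (card-empty (λ X → h (true ∷ X)))

  card-≥1 : ∀ {n} {F : Family n} X → T (F X) → 1 ≤ card F
  card-≥1 {F = F} [] p rewrite card-zero F | T⇒true p = ≤-refl
  card-≥1 {F = F} (false ∷ X) p rewrite card-suc F = ≤-trans (card-≥1 X p) (m≤m+n _ _)
  card-≥1 {F = F} (true ∷ X) p rewrite card-suc F = ≤-trans (card-≥1 X p) (m≤n+m _ _)

  find : ∀ {n} (F : Family n) → ∃ (λ X → T (F X)) ⊎ (∀ X → ¬ T (F X))
  find {zero} F with F [] in eq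
  ... | true  = inj₁ ([] , true⇒T eq)
  ... | false = inj₂ λ { [] p → true≢false (T⇒true p) eq }
  find {suc n} F with find (F ∘ (false ∷_)) | find (F ∘ (true ∷_))
  ... | inj₁ (X , p) | _ = inj₁ (false ∷ X , p)
  ... | inj₂ _ | inj₁ (X , p) = inj₁ (true ∷ X , p)
  ... | inj₂ h | inj₂ k = inj₂ λ { (false ∷ X) → h X ; (true ∷ X) → k X }

  card-witness : ∀ {n} (F : Family n) → 1 ≤ card F → ∃ λ X → T (F X)
  card-witness F h with find F
  ... | inj₁ w = w
  ... | inj₂ k rewrite card-empty k with h
  ... | ()

  card-<-witness : ∀ {n} (F G : Family n) → card G < card F → ∃ λ X → T (F X) × ¬ T (G X)
  card-<-witness F G h with find (F ∖ᶠ G)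
  ... | inj₁ (X , p) = X , ∧-fst p , not⇒¬T (∧-snd {F X} p)
  ... | inj₂ k = ⊥-elim (<⇒≱ h (card-mono λ X p → sub X p))
    where
    sub : ∀ X → T (F X) → T (G X)
    sub X p with T? (G X)
    ... | inj₁ q = q
    ... | inj₂ q = ⊥-elim (k X (∧-intro p q))

  card-disjoint : ∀ {n} (F G H : Family n) → F ⊑ H → G ⊑ H → (∀ X → T (F X) → ¬ T (G X)) → card F + card G ≤ card H
  card-disjoint F G H f g d = ≤-trans (≤-reflexive (trans (sym (card-∪∩ F G))
      (trans (cong (card (F ∪ᶠ G) +_) (card-empty λ X p → d X (∧-fst p) (∧-snd {F X} p))) (+-identityʳ _))))
    (card-mono {G = H} λ X p → helper X (∨-cases p))
    where
    helper : ∀ X → T (F X) ⊎ T (G X) → T (H X)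
    helper X (inj₁ p) = f X p
    helper X (inj₂ p) = g X p

  card-cover : ∀ {n} (F G H : Family n) → (∀ X → T (H X) → T (F X) ⊎ T (G X)) → card H ≤ card F + card G
  card-cover F G H h = ≤-trans (card-mono {G = F ∪ᶠ G} λ X p → helper X (h X p))
      (≤-trans (m≤m+n _ _) (≤-reflexive (card-∪∩ F G)))
    where
    helper : ∀ X → T (F X) ⊎ T (G X) → T (F X ∨ G X)
    helper X (inj₁ p) = ∨-left p
    helper X (inj₂ p) = ∨-right {F X} p

  Uniform : ∀ {n} → ℕ → Family n → Set
  Uniform k F = ∀ X → T (F X) → ∣ X ∣ ≡ k

  insert : ∀ {n} → Fin n → Subset n → Subset n
  insert v X = X [ v ]≔ true

  erase : ∀ {n} → Fin n → Subset n → Subset n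
  erase v X = X [ v ]≔ false

  size-insert : ∀ {n} (v : Fin n) X → lookup X v ≡ false → ∣ insert v X ∣ ≡ suc ∣ X ∣
  size-insert zero    (false ∷ X) refl = refl
  size-insert (suc v) (false ∷ X) h = size-insert v X h
  size-insert (suc v) (true ∷ X)  h = cong suc (size-insert v X h)

  insert-erase : ∀ {n} (v : Fin n) X → lookup X v ≡ true → insert v (erase v X) ≡ X
  insert-erase v X h = trans ([]≔-idempotent X v) (trans (cong (X [ v ]≔_) (sym h)) ([]≔-lookup X v))

  erase-insert : ∀ {n} (v : Fin n) X → lookup X v ≡ false → erase v (insert v X) ≡ X
  erase-insert v X h = trans ([]≔-idempotent X v) (trans (cong (X [ v ]≔_) (sym h)) ([]≔-lookup X v))

  -- Links and deletions stay on the same ground set; their members avoid v.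
  link : ∀ {n} → Fin n → Family n → Family n
  link v F X = F (insert v X) ∧ not (lookup X v)

  del : ∀ {n} → Fin n → Family n → Family n
  del v F X = F X ∧ not (lookup X v)

  link-∉ : ∀ {n} (v : Fin n) (F : Family n) X → T (link v F X) → lookup X v ≡ false
  link-∉ v F X p = not-elim (∧-snd {F (insert v X)} p)

  del-∉ : ∀ {n} (v : Fin n) (F : Family n) X → T (del v F X) → lookup X v ≡ false
  del-∉ v F X p = not-elim (∧-snd {F X} p)

  card-link-del : ∀ {n} (v : Fin n) (F : Family n) → card F ≡ card (link v F) + card (del v F)
  card-link-del {suc n} zero F rewrite card-suc F | card-suc (link zero F) | card-suc (del zero F) =
    trans (+-comm (card (F ∘ (false ∷_))) _) (cong₂ _+_
      (sym (trans (cong₂ _+_ (card-ext {F = link zero F ∘ (false ∷_)} {G = F ∘ (true ∷_)} (λ X p → ∧-fst p) (λ X p → ∧-intro p tt))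
                    (card-empty {F = link zero F ∘ (true ∷_)} (λ X p → ∧-snd {F (true ∷ X)} p))) (+-identityʳ _)))
      (sym (trans (cong₂ _+_ (card-ext {F = del zero F ∘ (false ∷_)} {G = F ∘ (false ∷_)} (λ X p → ∧-fst p) (λ X p → ∧-intro p tt))
                    (card-empty {F = del zero F ∘ (true ∷_)} (λ X p → ∧-snd {F (true ∷ X)} p))) (+-identityʳ _))))
  card-link-del {suc n} (suc v) F rewrite card-suc F | card-suc (link (suc v) F) | card-suc (del (suc v) F) =
    trans (cong₂ _+_ (card-link-del v (F ∘ (false ∷_))) (card-link-del v (F ∘ (true ∷_))))
      (interchange (card (link v (F ∘ (false ∷_)))) _ _ _)

  link-uniform : ∀ {n k} (v : Fin n) {F : Family n} → Uniform (suc k) F → Uniform k (link v F)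
  link-uniform v {F} u X p = suc-injective (trans (sym (size-insert v X (link-∉ v F X p))) (u (insert v X) (∧-fst p)))

  del-uniform : ∀ {n k} (v : Fin n) {F : Family n} → Uniform k F → Uniform k (del v F)
  del-uniform v u X p = u X (∧-fst p)

  link-mono : ∀ {n} (v : Fin n) {F G : Family n} → F ⊑ G → link v F ⊑ link v G
  link-mono v {F} {G} h X p = ∧-intro (h _ (∧-fst p)) (∧-snd {F (insert v X)} p)

  del-mono : ∀ {n} (v : Fin n) {F G : Family n} → F ⊑ G → del v F ⊑ del v G
  del-mono v {F} {G} h X p = ∧-intro (h _ (∧-fst p)) (∧-snd {F X} p)

  -- Recursion on the first coordinate makes the two sections of a shadow definitional, which is
  -- what the induction for Kruskal-Katona splits on. `shadow≡∂` identifies it with `shadow` for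
  -- uniform families.
  ∂ : ∀ {n} → Family n → Family n
  ∂ {zero}  F X           = false
  ∂ {suc n} F (false ∷ X) = ∂ (F ∘ (false ∷_)) X ∨ F (true ∷ X)
  ∂ {suc n} F (true ∷ X)  = ∂ (F ∘ (true ∷_)) X

  ∂-intro : ∀ {n} (F : Family n) v X → lookup X v ≡ false → T (F (insert v X)) → T (∂ F X)
  ∂-intro F zero    (false ∷ X) refl p = ∨-right {∂ (F ∘ (false ∷_)) X} p
  ∂-intro F (suc v) (false ∷ X) h p = ∨-left (∂-intro (F ∘ (false ∷_)) v X h p)
  ∂-intro F (suc v) (true ∷ X)  h p = ∂-intro (F ∘ (true ∷_)) v X h p

  ∂-elim : ∀ {n} (F : Family n) X → T (∂ F X) → ∃ λ v → lookup X v ≡ false × T (F (insert v X))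
  ∂-elim {zero} F X ()
  ∂-elim {suc n} F (false ∷ X) p with ∨-cases {∂ (F ∘ (false ∷_)) X} p
  ... | inj₁ q = let (v , h , r) = ∂-elim (F ∘ (false ∷_)) X q in suc v , h , r
  ... | inj₂ q = zero , refl , q
  ∂-elim {suc n} F (true ∷ X) p = let (v , h , r) = ∂-elim (F ∘ (true ∷_)) X p in suc v , h , r

  ∂-erase : ∀ {n} (F : Family n) v X → lookup X v ≡ true → T (F X) → T (∂ F (erase v X))
  ∂-erase F v X h p = ∂-intro F v (erase v X) (lookup∘update v X false) (subst (T ∘ F) (sym (insert-erase v X h)) p)

  ∂-mono : ∀ {n} {F G : Family n} → F ⊑ G → ∂ F ⊑ ∂ G
  ∂-mono {F = F} {G} h X p = let (v , q , r) = ∂-elim F X p in ∂-intro G v X q (h _ r)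

  ∂-uniform : ∀ {n k} {F : Family n} → Uniform (suc k) F → Uniform k (∂ F)
  ∂-uniform {F = F} u X p = let (v , q , r) = ∂-elim F X p in
    suc-injective (trans (sym (size-insert v X q)) (u _ r))

  ∂-uniform₀ : ∀ {n} {F : Family n} → Uniform 0 F → ∀ X → ¬ T (∂ F X)
  ∂-uniform₀ {F = F} u X p with ∂-elim F X p
  ... | v , q , r with trans (sym (size-insert v X q)) (u _ r)
  ... | ()

  lookup-insert′ : ∀ {n} {u v : Fin n} X → u ≢ v → lookup (insert u X) v ≡ lookup X v
  lookup-insert′ {u = u} {v} X ne = lookup∘update′ {i = v} {j = u} (ne ∘ sym) X true

  lookup-erase′ : ∀ {n} {u v : Fin n} X → u ≢ v → lookup (erase u X) v ≡ lookup X v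
  lookup-erase′ {u = u} {v} X ne = lookup∘update′ {i = v} {j = u} (ne ∘ sym) X false

  ∂-link : ∀ {n} (v : Fin n) (F : Family n) → ∂ (link v F) ⊑ link v (∂ F)
  ∂-link v F X p with ∂-elim (link v F) X p
  ... | u , q , r with u ≟ᶠ v
  ... | yes refl = true≢false (lookup∘update u X true) (link-∉ u F _ r)
  ... | no ne = ∧-intro (∂-intro F u (insert v X) (trans (lookup-insert′ X (ne ∘ sym)) q)
                  (subst (T ∘ F) ([]≔-commutes X u v ne) (∧-fst r)))
                (not-intro (trans (sym (lookup-insert′ X ne)) (link-∉ v F _ r)))

  ∂-del : ∀ {n} (v : Fin n) (F : Family n) → ∂ (del v F) ⊑ del v (∂ F)
  ∂-del v F X p with ∂-elim (del v F) X p
  ... | u , q , r with u ≟ᶠ v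
  ... | yes refl = true≢false (lookup∘update u X true) (del-∉ u F _ r)
  ... | no ne = ∧-intro (∂-intro F u X q (∧-fst r)) (not-intro (trans (sym (lookup-insert′ X ne)) (del-∉ v F _ r)))

  link⊑del-∂ : ∀ {n} (v : Fin n) (F : Family n) → link v F ⊑ del v (∂ F)
  link⊑del-∂ v F X p = ∧-intro (∂-intro F v X (link-∉ v F X p) (∧-fst p)) (∧-snd {F (insert v X)} p)

  ∂-link⊑ : ∀ {n} (v : Fin n) {F H : Family n} → ∂ F ⊑ H → ∂ (link v F) ⊑ link v H
  ∂-link⊑ v {F} {H} h X p = link-mono v h X (∂-link v F X p)

  ∂-del⊑ : ∀ {n} (v : Fin n) {F H : Family n} → ∂ F ⊑ H → ∂ (del v F) ⊑ del v H
  ∂-del⊑ v {F} {H} h X p = del-mono v h X (∂-del v F X p)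

  -- The members of `H` containing v are counted by `link v H`; those avoiding v include `link v F`,
  -- since removing v from a member of `F` gives a shadow set.
  card-link+link : ∀ {n} (v : Fin n) {F H : Family n} → ∂ F ⊑ H → card (link v F) + card (link v H) ≤ card H
  card-link+link v {F} {H} h = ≤-trans (+-monoˡ-≤ _ (card-mono λ X p → del-mono v h X (link⊑del-∂ v F X p)))
    (≤-reflexive (trans (+-comm (card (del v H)) _) (sym (card-link-del v H))))

  hasSize-intro : ∀ {n k} (X : Subset n) → ∣ X ∣ ≡ k → T (hasSize k X)
  hasSize-intro {k = k} X h = ≡⇒≡ᵇ ∣ X ∣ k h

  hasSize-elim : ∀ {n k} (X : Subset n) → T (hasSize k X) → ∣ X ∣ ≡ k
  hasSize-elim {k = k} X h = ≡ᵇ⇒≡ ∣ X ∣ k h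

  ⊆ᵇ-elim : ∀ {n} (X S : Subset n) → T (X ⊆ᵇ S) → ∀ v → lookup X v ≡ true → lookup S v ≡ true
  ⊆ᵇ-elim (true ∷ X) (true ∷ S) p zero h = refl
  ⊆ᵇ-elim (x ∷ X) (s ∷ S) p (suc v) h = ⊆ᵇ-elim X S (∧-snd {not x ∨ s} p) v h

  ⊆ᵇ-intro : ∀ {n} (X S : Subset n) → (∀ v → lookup X v ≡ true → lookup S v ≡ true) → T (X ⊆ᵇ S)
  ⊆ᵇ-intro [] [] h = tt
  ⊆ᵇ-intro (false ∷ X) (s ∷ S) h = ⊆ᵇ-intro X S (λ v → h (suc v))
  ⊆ᵇ-intro (true ∷ X) (s ∷ S) h rewrite h zero refl = ⊆ᵇ-intro X S (λ v → h (suc v))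

  ⊆ᵇ-witness : ∀ {n} (X S : Subset n) → ¬ T (X ⊆ᵇ S) → ∃ λ v → lookup X v ≡ true × lookup S v ≡ false
  ⊆ᵇ-witness [] [] h = ⊥-elim (h tt)
  ⊆ᵇ-witness (true ∷ X) (false ∷ S) h = zero , refl , refl
  ⊆ᵇ-witness (true ∷ X) (true ∷ S) h = let (v , p , q) = ⊆ᵇ-witness X S h in suc v , p , q
  ⊆ᵇ-witness (false ∷ X) (s ∷ S) h = let (v , p , q) = ⊆ᵇ-witness X S h in suc v , p , q

  ⊆ᵇ-erase : ∀ {n} (v : Fin n) (X S : Subset n) → T (X ⊆ᵇ S) → T (erase v X ⊆ᵇ S)
  ⊆ᵇ-erase v X S p = ⊆ᵇ-intro (erase v X) S λ u h → helper u h
    where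
    helper : ∀ u → lookup (erase v X) u ≡ true → lookup S u ≡ true
    helper u h with v ≟ᶠ u
    ... | yes refl = true≢false h (lookup∘update v X false)
    ... | no ne = ⊆ᵇ-elim X S p u (trans (sym (lookup-erase′ X ne)) h)

  ⊆ᵇ-insert⁻ : ∀ {n} (v : Fin n) (X S : Subset n) → lookup X v ≡ false → T (insert v X ⊆ᵇ S) → T (X ⊆ᵇ S)
  ⊆ᵇ-insert⁻ v X S h p = subst (λ Y → T (Y ⊆ᵇ S)) (erase-insert v X h) (⊆ᵇ-erase v (insert v X) S p)

  kSub-intro : ∀ {n k} (S X : Subset n) → ∣ X ∣ ≡ k → T (X ⊆ᵇ S) → T (kSubsetsOf k S X)
  kSub-intro S X h p = ∧-intro (hasSize-intro X h) p

  kSub-size : ∀ {n k} (S : Subset n) → Uniform k (kSubsetsOf k S)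
  kSub-size S X p = hasSize-elim X (∧-fst p)

  kSub-⊆ : ∀ {n k} (S X : Subset n) → T (kSubsetsOf k S X) → T (X ⊆ᵇ S)
  kSub-⊆ {k = k} S X p = ∧-snd {hasSize k X} p

  card-kSubsets : ∀ {n} k (S : Subset n) → card (kSubsetsOf k S) ≡ ∣ S ∣ C k
  card-kSubsets {zero} zero [] = refl
  card-kSubsets {zero} (suc k) [] = refl
  card-kSubsets {suc n} k (false ∷ S) rewrite card-suc (kSubsetsOf k (false ∷ S)) =
    trans (cong₂ _+_ (card-kSubsets k S) (card-empty {F = λ X → kSubsetsOf k (false ∷ S) (true ∷ X)} λ X p → ∧-snd {hasSize k (true ∷ X)} p)) (+-identityʳ _)
  card-kSubsets {suc n} zero (true ∷ S) rewrite card-suc (kSubsetsOf zero (true ∷ S)) =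
    trans (cong₂ _+_ (card-kSubsets zero S) (card-empty {F = λ X → kSubsetsOf zero (true ∷ S) (true ∷ X)} λ X ())) refl
  card-kSubsets {suc n} (suc k) (true ∷ S) rewrite card-suc (kSubsetsOf (suc k) (true ∷ S)) =
    trans (cong₂ _+_ (card-kSubsets (suc k) S) (card-kSubsets k S))
      (trans (+-comm (∣ S ∣ C suc k) _) (nCk+nC[k+1]≡[n+1]C[k+1] ∣ S ∣ k))

  ∣⊥∣₀ : ∀ {n} (X : Subset n) → ∣ X ∣ ≡ 0 → X ≡ ⊥
  ∣⊥∣₀ [] h = refl
  ∣⊥∣₀ (false ∷ X) h = cong (false ∷_) (∣⊥∣₀ X h)

  card-uniform₀ : ∀ {n} {F : Family n} → Uniform 0 F → card F ≤ 1
  card-uniform₀ {n} {F} u = ≤-trans (card-mono {G = kSubsetsOf 0 ⊥} λ X p →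
      kSub-intro ⊥ X (u X p) (subst (λ Y → T (Y ⊆ᵇ ⊥)) (sym (∣⊥∣₀ X (u X p))) (⊆ᵇ-intro (⊥ {n}) ⊥ (λ v h → h))))
    (≤-reflexive (card-kSubsets 0 (⊥ {n})))

-- The Kruskal-Katona theorem by compression of sections.

module KruskalKatona where
  open Families
  open import Data.Nat.Base using (_+_; _≤_; _<_; z≤n)
  open import Data.Nat.Properties
  open import Algebra.Properties.CommutativeSemigroup +-commutativeSemigroup using (interchange)
  open import Data.Bool.Properties using (∧-zeroʳ)
  open import Data.Fin.Properties using () renaming (_≟_ to _≟ᶠ_)
  open import Data.Fin.Subset.Properties using (∣⊥∣≡0)
  open import Data.Vec.Properties using ([]≔-commutes)
  open import Relation.Binary.PropositionalEquality

  infix 4 _≺_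

  -- Colex on all subsets, also of different sizes: the last differing coordinate decides, as for
  -- binary numbers with the least digit first.
  data _≺_ : ∀ {n} → Subset n → Subset n → Set where
    here  : ∀ {n} {X : Subset n} → (false ∷ X) ≺ (true ∷ X)
    there : ∀ {n x y} {X Y : Subset n} → X ≺ Y → (x ∷ X) ≺ (y ∷ Y)

  ≺-irrefl : ∀ {n} {X : Subset n} → ¬ (X ≺ X)
  ≺-irrefl (there p) = ≺-irrefl p

  ≺-trans : ∀ {n} {X Y Z : Subset n} → X ≺ Y → Y ≺ Z → X ≺ Z
  ≺-trans here (there q) = there q
  ≺-trans (there p) here = there p
  ≺-trans (there p) (there q) = there (≺-trans p q)

  ≺-compare : ∀ {n} (X Y : Subset n) → X ≺ Y ⊎ X ≡ Y ⊎ Y ≺ X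
  ≺-compare [] [] = inj₂ (inj₁ refl)
  ≺-compare (x ∷ X) (y ∷ Y) with ≺-compare X Y
  ... | inj₁ p = inj₁ (there p)
  ... | inj₂ (inj₂ p) = inj₂ (inj₂ (there p))
  ≺-compare (false ∷ X) (false ∷ X) | inj₂ (inj₁ refl) = inj₂ (inj₁ refl)
  ≺-compare (false ∷ X) (true ∷ X)  | inj₂ (inj₁ refl) = inj₁ here
  ≺-compare (true ∷ X) (false ∷ X)  | inj₂ (inj₁ refl) = inj₂ (inj₂ here)
  ≺-compare (true ∷ X) (true ∷ X)   | inj₂ (inj₁ refl) = inj₂ (inj₁ refl)

  eqᵇ-refl : ∀ {n} (X : Subset n) → T (eqᵇ X X)
  eqᵇ-refl [] = tt
  eqᵇ-refl (true ∷ X) = eqᵇ-refl X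
  eqᵇ-refl (false ∷ X) = eqᵇ-refl X

  eqᵇ-sound : ∀ {n} (X Y : Subset n) → T (eqᵇ X Y) → X ≡ Y
  eqᵇ-sound [] [] p = refl
  eqᵇ-sound (true ∷ X) (true ∷ Y) p = cong (true ∷_) (eqᵇ-sound X Y p)
  eqᵇ-sound (false ∷ X) (false ∷ Y) p = cong (false ∷_) (eqᵇ-sound X Y p)

  colexLt⇒≺ : ∀ {n} (X Y : Subset n) → T (colexLt X Y) → X ≺ Y
  colexLt⇒≺ [] [] ()
  colexLt⇒≺ (x ∷ X) (y ∷ Y) p with eqᵇ X Y in eq
  ... | false = there (colexLt⇒≺ X Y p)
  colexLt⇒≺ (false ∷ X) (true ∷ Y) p | true with eqᵇ-sound X Y (true⇒T eq)
  ... | refl = here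

  ≺⇒colexLt : ∀ {n} {X Y : Subset n} → X ≺ Y → T (colexLt X Y)
  ≺⇒colexLt {X = false ∷ X} here rewrite T⇒true (eqᵇ-refl X) = tt
  ≺⇒colexLt {X = x ∷ X} {y ∷ Y} (there p) with eqᵇ X Y in eq
  ... | false = ≺⇒colexLt p
  ... | true with eqᵇ-sound X Y (true⇒T eq)
  ... | refl = ⊥-elim (≺-irrefl p)

  -- Later coordinates dominate, so the tail is minimised over both values of the head, and only
  -- then is the head chosen.
  ≺-min : ∀ {n} (P : Family n) → ∃ (λ X → T (P X)) → ∃ λ Y → T (P Y) × (∀ X → X ≺ Y → ¬ T (P X))
  ≺-min {zero} P ([] , p) = [] , p , λ _ ()
  ≺-min {suc n} P (x ∷ X , p) with ≺-min (λ Z → P (false ∷ Z) ∨ P (true ∷ Z)) (X , proof x p)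
    where
    proof : ∀ x → T (P (x ∷ X)) → T (P (false ∷ X) ∨ P (true ∷ X))
    proof false p = ∨-left p
    proof true p = ∨-right {P (false ∷ X)} p
  ... | Y , q , m with T? (P (false ∷ Y))
  ... | inj₁ r = false ∷ Y , r , λ { (false ∷ X) (there l) s → m X l (∨-left s)
                                   ; (true ∷ X) (there l) s → m X l (∨-right {P (false ∷ X)} s) }
  ... | inj₂ r = true ∷ Y , second (∨-cases q) , λ { (false ∷ X) here s → not⇒¬T r s
                                          ; (false ∷ X) (there l) s → m X l (∨-left s)
                                          ; (true ∷ X) (there l) s → m X l (∨-right {P (false ∷ X)} s) }
    where
    second : T (P (false ∷ Y)) ⊎ T (P (true ∷ Y)) → T (P (true ∷ Y))
    second (inj₁ s) = ⊥-elim (not⇒¬T r s)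
    second (inj₂ s) = s

  ≺-max : ∀ {n} (P : Family n) → ∃ (λ X → T (P X)) → ∃ λ Y → T (P Y) × (∀ X → Y ≺ X → ¬ T (P X))
  ≺-max {zero} P ([] , p) = [] , p , λ _ ()
  ≺-max {suc n} P (x ∷ X , p) with ≺-max (λ Z → P (true ∷ Z) ∨ P (false ∷ Z)) (X , proof x p)
    where
    proof : ∀ x → T (P (x ∷ X)) → T (P (true ∷ X) ∨ P (false ∷ X))
    proof true p = ∨-left p
    proof false p = ∨-right {P (true ∷ X)} p
  ... | Y , q , m with T? (P (true ∷ Y))
  ... | inj₁ r = true ∷ Y , r , λ { (true ∷ X) (there l) s → m X l (∨-left s)
                                   ; (false ∷ X) (there l) s → m X l (∨-right {P (true ∷ X)} s) }
  ... | inj₂ r = false ∷ Y , second (∨-cases q) , λ { (true ∷ X) here s → not⇒¬T r s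
                                          ; (true ∷ X) (there l) s → m X l (∨-left s)
                                          ; (false ∷ X) (there l) s → m X l (∨-right {P (true ∷ X)} s) }
    where
    second : T (P (true ∷ Y)) ⊎ T (P (false ∷ Y)) → T (P (false ∷ Y))
    second (inj₁ s) = ⊥-elim (not⇒¬T r s)
    second (inj₂ s) = s

  -- This is how a smaller set below a member of a colex segment is recognised as lying in the
  -- shadow of the segment: some element can be added without passing `Y`. If the heads are `true`
  -- and `false`, the size condition excludes that the filled tail equals that of `Y`.
  ≺-fill : ∀ {n} {B Y : Subset n} → B ≺ Y → ∣ B ∣ < ∣ Y ∣ →
           ∃ λ v → lookup B v ≡ false × (insert v B ≡ Y ⊎ insert v B ≺ Y)
  ≺-fill here h = zero , refl , inj₁ refl
  ≺-fill {B = false ∷ B} {true ∷ Y} (there p) h = zero , refl , inj₂ (there p)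
  ≺-fill {B = false ∷ B} {false ∷ Y} (there p) h with ≺-fill p h
  ... | v , q , inj₁ r = suc v , q , inj₁ (cong (false ∷_) r)
  ... | v , q , inj₂ r = suc v , q , inj₂ (there r)
  ≺-fill {B = true ∷ B} {true ∷ Y} (there p) h with ≺-fill p (≤-pred h)
  ... | v , q , inj₁ r = suc v , q , inj₁ (cong (true ∷_) r)
  ... | v , q , inj₂ r = suc v , q , inj₂ (there r)
  ≺-fill {B = true ∷ B} {false ∷ Y} (there p) h with ≺-fill p (<-trans (n<1+n _) h)
  ... | v , q , inj₁ r = ⊥-elim (<-irrefl (trans (sym (size-insert v B q)) (cong ∣_∣ r)) h)
  ... | v , q , inj₂ r = suc v , q , inj₂ (there r)

  record Initial {n} (k : ℕ) (G : Family n) : Set where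
    field
      uniform : Uniform k G
      down    : ∀ {X Y} → T (G X) → Y ≺ X → ∣ Y ∣ ≡ k → T (G Y)

  card-singleton : ∀ {n} (Y : Subset n) → card (λ X → eqᵇ X Y) ≡ 1
  card-singleton [] = refl
  card-singleton {suc n} (false ∷ Y) rewrite card-suc (λ X → eqᵇ X (false ∷ Y)) =
    trans (cong₂ _+_ (card-singleton Y) (card-empty {n} {λ X → eqᵇ (true ∷ X) (false ∷ Y)} λ X ())) refl
  card-singleton {suc n} (true ∷ Y) rewrite card-suc (λ X → eqᵇ X (true ∷ Y)) =
    trans (cong₂ _+_ (card-empty {n} {λ X → eqᵇ (false ∷ X) (true ∷ Y)} λ X ()) (card-singleton Y)) refl

  -- A family F and H ⊒ ∂ F, split by the first coordinate.  Kruskal–Katona is proved by induction on the ground set: the two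
  -- sections are shifted, replacing a vertex v by the first one, until ∂ F₀ ⊑ F₁.
  record Sections {n} (k : ℕ) (F₀ F₁ H₀ H₁ : Family n) : Set where
    field
      uniform₀ : Uniform (suc k) F₀
      uniform₁ : Uniform k F₁
      ∂F₀⊑H₀   : ∂ F₀ ⊑ H₀
      F₁⊑H₀    : F₁ ⊑ H₀
      ∂F₁⊑H₁   : ∂ F₁ ⊑ H₁

  ∧-true : ∀ a b → (a ∧ b) ∧ true ≡ (a ∧ true) ∧ (b ∧ true)
  ∧-true true b = refl
  ∧-true false b = refl

  ∧-false : ∀ x a b → x ∧ false ≡ (a ∧ false) ∧ (b ∧ false)
  ∧-false x a b = trans (∧-zeroʳ x) (sym (trans (cong (_∧ (b ∧ false)) (∧-zeroʳ a)) refl))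

  ∨-true : ∀ b a → (b ∨ a) ∧ true ≡ (a ∧ true) ∨ (b ∧ true)
  ∨-true true true = refl
  ∨-true true false = refl
  ∨-true false true = refl
  ∨-true false false = refl

  ∨-false : ∀ x a b → x ∧ false ≡ (a ∧ false) ∨ (b ∧ false)
  ∨-false x a b = trans (∧-zeroʳ x) (sym (cong₂ _∨_ (∧-zeroʳ a) (∧-zeroʳ b)))

  module _ {n} (v : Fin n) where
    -- Compression towards the first vertex: a set of the first section containing v loses v and
    -- moves to the second section, unless the resulting set is already there.
    shift₀ : Family n → Family n → Family n
    shift₀ F₀ F₁ X = if lookup X v then F₀ X ∧ F₁ (erase v X) else F₀ X

    shift₁ : Family n → Family n → Family n
    shift₁ F₀ F₁ X = if lookup X v then F₁ X else F₁ X ∨ F₀ (insert v X)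

    module _ (F₀ F₁ : Family n) where
      link-shift₀ : ∀ X → link v (shift₀ F₀ F₁) X ≡ (link v F₀ ∩ᶠ del v F₁) X
      link-shift₀ X with lookup X v in eq
      ... | true = ∧-false (shift₀ F₀ F₁ (insert v X)) (F₀ (insert v X)) (F₁ X)
      ... | false rewrite lookup∘update v X true | erase-insert v X eq = ∧-true (F₀ (insert v X)) (F₁ X)

      del-shift₀ : ∀ X → del v (shift₀ F₀ F₁) X ≡ del v F₀ X
      del-shift₀ X with lookup X v
      ... | true = trans (∧-zeroʳ (F₀ X ∧ F₁ (erase v X))) (sym (∧-zeroʳ (F₀ X)))
      ... | false = refl

      link-shift₁ : ∀ X → link v (shift₁ F₀ F₁) X ≡ link v F₁ X
      link-shift₁ X rewrite lookup∘update v X true = refl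

      del-shift₁ : ∀ X → del v (shift₁ F₀ F₁) X ≡ (link v F₀ ∪ᶠ del v F₁) X
      del-shift₁ X with lookup X v
      ... | true = ∨-false (F₁ X) (F₀ (insert v X)) (F₁ X)
      ... | false = ∨-true (F₁ X) (F₀ (insert v X))

      card-shift : card (shift₀ F₀ F₁) + card (shift₁ F₀ F₁) ≡ card F₀ + card F₁
      card-shift = begin
        card (shift₀ F₀ F₁) + card (shift₁ F₀ F₁)
          ≡⟨ cong₂ _+_ (card-link-del v (shift₀ F₀ F₁)) (card-link-del v (shift₁ F₀ F₁)) ⟩
        (card (link v (shift₀ F₀ F₁)) + card (del v (shift₀ F₀ F₁))) + (card (link v (shift₁ F₀ F₁)) + card (del v (shift₁ F₀ F₁)))
          ≡⟨ cong₂ _+_ (cong₂ _+_ (card-cong link-shift₀) (card-cong del-shift₀)) (cong₂ _+_ (card-cong link-shift₁) (card-cong del-shift₁)) ⟩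
        (card (link v F₀ ∩ᶠ del v F₁) + d₀) + (l₁ + card (link v F₀ ∪ᶠ del v F₁))
          ≡⟨ rearrange (card (link v F₀ ∩ᶠ del v F₁)) d₀ l₁ (card (link v F₀ ∪ᶠ del v F₁)) ⟩
        (card (link v F₀ ∪ᶠ del v F₁) + card (link v F₀ ∩ᶠ del v F₁)) + (d₀ + l₁)
          ≡⟨ cong (_+ (d₀ + l₁)) (card-∪∩ (link v F₀) (del v F₁)) ⟩
        (l₀ + d₁) + (d₀ + l₁)
          ≡⟨ trans (cong ((l₀ + d₁) +_) (+-comm d₀ l₁)) (trans (interchange l₀ d₁ l₁ d₀) (trans (cong ((l₀ + l₁) +_) (+-comm d₁ d₀)) (interchange l₀ l₁ d₀ d₁))) ⟩
        (l₀ + d₀) + (l₁ + d₁)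
          ≡⟨ cong₂ _+_ (card-link-del v F₀) (card-link-del v F₁) ⟨
        card F₀ + card F₁ ∎
        where
        open ≡-Reasoning
        l₀ = card (link v F₀)
        d₀ = card (del v F₀)
        l₁ = card (link v F₁)
        d₁ = card (del v F₁)
        rearrange : ∀ a b c d → (a + b) + (c + d) ≡ (d + a) + (b + c)
        rearrange a b c d = trans (sym (+-assoc (a + b) c d)) (trans (+-comm (a + b + c) d) (trans (cong (d +_) (+-assoc a b c)) (sym (+-assoc d a (b + c)))))

      -- The termination measure: every witness against `∂ F₀ ⊑ F₁` supplies a compression that
      -- makes the first section strictly smaller.
      shift-shrinks : ∀ X → T (link v F₀ X) → ¬ T (F₁ X) → card (shift₀ F₀ F₁) < card F₀
      shift-shrinks X p q = begin-strict
        card (shift₀ F₀ F₁)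
          ≡⟨ trans (card-link-del v (shift₀ F₀ F₁)) (cong₂ _+_ (card-cong link-shift₀) (card-cong del-shift₀)) ⟩
        card (link v F₀ ∩ᶠ del v F₁) + card (del v F₀)
          <⟨ +-monoˡ-< (card (del v F₀)) (m<m+n _ (card-≥1 {F = link v F₀ ∖ᶠ del v F₁} X (∧-intro p (¬T⇒not (q ∘ ∧-fst))))) ⟩
        (card (link v F₀ ∩ᶠ del v F₁) + card (link v F₀ ∖ᶠ del v F₁)) + card (del v F₀)
          ≡⟨ cong (_+ card (del v F₀)) (card-split (link v F₀) (del v F₁)) ⟨
        card (link v F₀) + card (del v F₀)
          ≡⟨ card-link-del v F₀ ⟨
        card F₀ ∎
        where open ≤-Reasoning

    module _ {k} {F₀ F₁ H₀ H₁ : Family n} (S : Sections k F₀ F₁ H₀ H₁) where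
      open Sections S

      erase-insert-comm : ∀ {u} X → u ≢ v → insert u (erase v X) ≡ erase v (insert u X)
      erase-insert-comm {u} X ne = []≔-commutes X v u (ne ∘ sym)

      -- The classical fact that compression does not enlarge the shadow, in the form that the
      -- compressed `H` still contains the shadow of the compressed `F`.
      shift-sections : Sections k (shift₀ F₀ F₁) (shift₁ F₀ F₁) (shift₀ H₀ H₁) (shift₁ H₀ H₁)
      shift-sections = record
        { uniform₀ = u₀ ; uniform₁ = u₁ ; ∂F₀⊑H₀ = a ; F₁⊑H₀ = b ; ∂F₁⊑H₁ = c }
        where
        u₀ : Uniform (suc k) (shift₀ F₀ F₁)
        u₀ X p with lookup X v
        ... | true = uniform₀ X (∧-fst p)
        ... | false = uniform₀ X p
        u₁ : Uniform k (shift₁ F₀ F₁)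
        u₁ X p with lookup X v in eq
        ... | true = uniform₁ X p
        ... | false with ∨-cases {F₁ X} p
        ... | inj₁ q = uniform₁ X q
        ... | inj₂ q = suc-injective (trans (sym (size-insert v X eq)) (uniform₀ _ q))
        a : ∂ (shift₀ F₀ F₁) ⊑ shift₀ H₀ H₁
        a X p with ∂-elim (shift₀ F₀ F₁) X p
        ... | u , q , r with u ≟ᶠ v
        a X p | u , q , r | yes refl rewrite q | lookup∘update u X true | erase-insert u X q = F₁⊑H₀ X (∧-snd {F₀ (insert u X)} r)
        a X p | u , q , r | no ne rewrite lookup-insert′ X ne with lookup X v
        ... | true = ∧-intro (∂F₀⊑H₀ X (∂-intro F₀ u X q (∧-fst r)))
                (∂F₁⊑H₁ _ (∂-intro F₁ u (erase v X) (trans (lookup-erase′ X (ne ∘ sym)) q)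
                  (subst (T ∘ F₁) (sym (erase-insert-comm X ne)) (∧-snd {F₀ (insert u X)} r))))
        ... | false = ∂F₀⊑H₀ X (∂-intro F₀ u X q r)
        b : shift₁ F₀ F₁ ⊑ shift₀ H₀ H₁
        b X p with lookup X v in eq
        ... | true = ∧-intro (F₁⊑H₀ X p) (∂F₁⊑H₁ _ (∂-erase F₁ v X eq p))
        ... | false with ∨-cases {F₁ X} p
        ... | inj₁ q = F₁⊑H₀ X q
        ... | inj₂ q = ∂F₀⊑H₀ X (∂-intro F₀ v X eq q)
        c : ∂ (shift₁ F₀ F₁) ⊑ shift₁ H₀ H₁
        c X p with ∂-elim (shift₁ F₀ F₁) X p
        ... | u , q , r with u ≟ᶠ v
        c X p | u , q , r | yes refl rewrite q | lookup∘update u X true = ∨-left (∂F₁⊑H₁ X (∂-intro F₁ u X q r))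
        c X p | u , q , r | no ne rewrite lookup-insert′ X ne with lookup X v
        ... | true = ∂F₁⊑H₁ X (∂-intro F₁ u X q r)
        ... | false with ∨-cases {F₁ (insert u X)} r
        ... | inj₁ s = ∨-left (∂F₁⊑H₁ X (∂-intro F₁ u X q s))
        ... | inj₂ s = ∨-right {H₁ X} (∂F₀⊑H₀ _ (∂-intro F₀ u (insert v X) (trans (lookup-insert′ X (ne ∘ sym)) q)
                (subst (T ∘ F₀) ([]≔-commutes X u v ne) s)))

  record Shifted {n} (k : ℕ) (F₀ F₁ H₀ H₁ : Family n) : Set where
    field
      {F₀′ F₁′ H₀′ H₁′} : Family n
      sections : Sections k F₀′ F₁′ H₀′ H₁′
      cardF    : card F₀′ + card F₁′ ≡ card F₀ + card F₁
      cardH    : card H₀′ + card H₁′ ≡ card H₀ + card H₁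
      stable   : ∂ F₀′ ⊑ F₁′

  shift-until-stable : ∀ {n k} fuel {F₀ F₁ H₀ H₁ : Family n} → card F₀ < fuel → Sections k F₀ F₁ H₀ H₁ → Shifted k F₀ F₁ H₀ H₁
  shift-until-stable (suc fuel) {F₀} {F₁} {H₀} {H₁} h S with find (∂ F₀ ∖ᶠ F₁)
  ... | inj₂ none = record { sections = S ; cardF = refl ; cardH = refl ; stable = sub }
    where
    sub : ∂ F₀ ⊑ F₁
    sub X p with T? (F₁ X)
    ... | inj₁ q = q
    ... | inj₂ q = ⊥-elim (none X (∧-intro p q))
  ... | inj₁ (X , p) with ∂-elim F₀ X (∧-fst p)
  ... | v , q , r = record
    { sections = sections ; stable = stable
    ; cardF = trans cardF (card-shift v F₀ F₁) ; cardH = trans cardH (card-shift v H₀ H₁) }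
    where
    open Shifted (shift-until-stable fuel {shift₀ v F₀ F₁} {shift₁ v F₀ F₁} {shift₀ v H₀ H₁} {shift₁ v H₀ H₁}
      (<-≤-trans (shift-shrinks v F₀ F₁ X (∧-intro r (not-intro q)) (not⇒¬T (∧-snd {∂ F₀ X} p))) (≤-pred h))
      (shift-sections v S))

  module _ {n k} {G : Family (suc n)} (I : Initial (suc k) G) where
    open Initial I
    private
      G₀ = G ∘ (false ∷_)
      G₁ = G ∘ (true ∷_)

    initial₁ : Initial k G₁
    initial₁ = record { uniform = λ X p → suc-injective (uniform (true ∷ X) p) ; down = λ p l s → down p (there l) (cong suc s) }

    private
      insert-≺ : ∀ {m} (v : Fin m) B → lookup B v ≡ false → B ≺ insert v B
      insert-≺ zero (false ∷ B) h = here
      insert-≺ (suc v) (b ∷ B) h = there (insert-≺ v B h)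

    ∂G₀⊑G₁ : ∂ G₀ ⊑ G₁
    ∂G₀⊑G₁ B p with ∂-elim G₀ B p
    ... | v , q , r = down r (there (insert-≺ v B q)) (trans (sym (size-insert v B q)) (uniform _ r))

    module _ (Y : Subset n) (size : ∣ Y ∣ ≡ suc k) (out : ¬ T (G₀ Y)) (least : ∀ X → X ≺ Y → ∣ X ∣ ≡ suc k → T (G₀ X)) where
      next : Family n
      next X = G₀ X ∨ eqᵇ X Y

      next-initial : Initial (suc k) next
      next-initial = record { uniform = λ X p → u X (∨-cases p) ; down = λ {X} p l s → ∨-left (d X l s (∨-cases {G₀ X} p)) }
        where
        u : ∀ X → T (G₀ X) ⊎ T (eqᵇ X Y) → ∣ X ∣ ≡ suc k
        u X (inj₁ p) = uniform (false ∷ X) p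
        u X (inj₂ p) = trans (cong ∣_∣ (eqᵇ-sound X Y p)) size
        d : ∀ X {Z} → Z ≺ X → ∣ Z ∣ ≡ suc k → T (G₀ X) ⊎ T (eqᵇ X Y) → T (G₀ Z)
        d X l s (inj₁ p) = down p (there l) s
        d X l s (inj₂ p) = least _ (subst (_ ≺_) (eqᵇ-sound X Y p) l) s

      -- `Y` is the first set missing from `G₀`. If it came before some B in `G₁`, then `false ∷ Y`
      -- would precede `true ∷ B` and lie in `G`. Hence B precedes `Y` and can be filled up to a set
      -- at or before `Y`.
      G₁⊑∂next : G₁ ⊑ ∂ next
      G₁⊑∂next B p with ≺-compare B Y
      ... | inj₂ (inj₂ l) = ⊥-elim (out (down p (there l) size))
      ... | inj₂ (inj₁ refl) = ⊥-elim (1+n≢n (trans (sym size) (suc-injective (uniform (true ∷ B) p))))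
      ... | inj₁ l with ≺-fill l (≤-reflexive (trans (uniform (true ∷ B) p) (sym size)))
      ... | v , q , inj₁ r = ∂-intro next v B q (∨-right {G₀ (insert v B)} (subst (λ Z → T (eqᵇ Z Y)) (sym r) (eqᵇ-refl Y)))
      ... | v , q , inj₂ r = ∂-intro next v B q (∨-left (least _ r (trans (size-insert v B q) (uniform (true ∷ B) p))))

      card-next : card next ≤ suc (card G₀)
      card-next = ≤-trans (card-cover G₀ (λ X → eqᵇ X Y) next (λ X p → ∨-cases p))
        (≤-reflexive (trans (cong (card G₀ +_) (card-singleton Y)) (+-comm _ 1)))

  kruskal-katona : ∀ n k {F H G : Family n} → Uniform k F → ∂ F ⊑ H → Initial k G → card G ≤ card F → card (∂ G) ≤ card H
  kruskal-katona zero k {G = G} _ _ _ _ = ≤-trans (≤-reflexive (card-empty {F = ∂ G} λ X ())) z≤n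
  kruskal-katona (suc n) zero {G = G} _ _ I _ = ≤-trans (≤-reflexive (card-empty (∂-uniform₀ (Initial.uniform I)))) z≤n
  kruskal-katona (suc n) (suc k) {F} {H} {G} u s I le = begin
    card (∂ G)                   ≡⟨ card-suc (∂ G) ⟩
    card (λ X → ∂ G₀ X ∨ G₁ X) + card (∂ G₁)
      -- For an initial segment `∂ G₀` is swallowed by `G₁`, so only the second section matters, and
      -- it remains to compare `G₁` with `F₁′`.
      ≤⟨ +-mono-≤ (card-mono {G = G₁} λ X p → absorb X (∨-cases p)) ≤-refl ⟩
    card G₁ + card (∂ G₁)        ≤⟨ +-mono-≤ (≤-trans G₁≤F₁ (card-mono F₁⊑H₀)) (kruskal-katona n k uniform₁ ∂F₁⊑H₁ (initial₁ I) G₁≤F₁) ⟩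
    card H₀′ + card H₁′          ≡⟨ cardH ⟩
    card (H ∘ (false ∷_)) + card (H ∘ (true ∷_)) ≡⟨ card-suc H ⟨
    card H                       ∎
    where
    open ≤-Reasoning
    G₀ = G ∘ (false ∷_)
    G₁ = G ∘ (true ∷_)
    split : Sections k (F ∘ (false ∷_)) (F ∘ (true ∷_)) (H ∘ (false ∷_)) (H ∘ (true ∷_))
    split = record
      { uniform₀ = λ X → u (false ∷ X) ; uniform₁ = λ X p → suc-injective (u (true ∷ X) p)
      ; ∂F₀⊑H₀ = λ X p → s (false ∷ X) (∨-left p) ; F₁⊑H₀ = λ X p → s (false ∷ X) (∨-right {∂ (F ∘ (false ∷_)) X} p)
      ; ∂F₁⊑H₁ = λ X p → s (true ∷ X) p }
    open Shifted (shift-until-stable (suc (card (F ∘ (false ∷_)))) (n<1+n _) split)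
    open Sections sections
    absorb : ∀ X → T (∂ G₀ X) ⊎ T (G₁ X) → T (G₁ X)
    absorb X (inj₁ p) = ∂G₀⊑G₁ I X p
    absorb X (inj₂ p) = p
    sum≤ : card G₀ + card G₁ ≤ card F₀′ + card F₁′
    sum≤ = ≤-trans (≤-reflexive (sym (card-suc G))) (≤-trans le (≤-reflexive (trans (card-suc F) (sym cardF))))
    -- If this failed, `G₀` would be smaller than `F₀′`, so `G₀` with one more set is an initial
    -- segment still no larger than `F₀′`. Its shadow contains `G₁`, and stability puts the shadow
    -- of `F₀′` inside `F₁′`, so induction on the smaller ground set gives the inequality after all.
    G₁≤F₁ : card G₁ ≤ card F₁′
    G₁≤F₁ with ≤-<-connex (card G₁) (card F₁′)
    ... | inj₁ ok = ok
    ... | inj₂ lt with ≺-min (λ X → hasSize (suc k) X ∧ not (G₀ X)) (proj₁ w , ∧-intro (hasSize-intro (proj₁ w) (uniform₀ _ (proj₁ (proj₂ w)))) (¬T⇒not (proj₂ (proj₂ w))))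
      where
      G₀<F₀ : card G₀ < card F₀′
      G₀<F₀ = ≰⇒> λ ge → <⇒≱ (+-mono-≤-< ge lt) sum≤
      w = card-<-witness F₀′ G₀ G₀<F₀
    ... | Y , p , m = ≤-trans (card-mono (G₁⊑∂next I Y size out least))
            (kruskal-katona n (suc k) uniform₀ stable (next-initial I Y size out least)
              (≤-trans (card-next I Y size out least) G₀<F₀))
      where
      G₀<F₀ : card G₀ < card F₀′
      G₀<F₀ = ≰⇒> λ ge → <⇒≱ (+-mono-≤-< ge lt) sum≤
      size = hasSize-elim Y (∧-fst p)
      out = not⇒¬T (∧-snd {hasSize (suc k) Y} p)
      least : ∀ X → X ≺ Y → ∣ X ∣ ≡ suc k → T (G₀ X)
      least X l s with T? (G₀ X)
      ... | inj₁ q = q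
      ... | inj₂ q = ⊥-elim (m X l (∧-intro (hasSize-intro X s) q))

  padˡ : ∀ {n} N → Family n → Family (N + n)
  padˡ zero F X = F X
  padˡ (suc N) F (false ∷ X) = padˡ N F X
  padˡ (suc N) F (true ∷ X) = false

  card-padˡ : ∀ {n} N (F : Family n) → card (padˡ N F) ≡ card F
  card-padˡ zero F = refl
  card-padˡ {n} (suc N) F rewrite card-suc (padˡ (suc N) F) =
    trans (cong₂ _+_ (card-padˡ N F) (card-empty {N + n} {padˡ (suc N) F ∘ (true ∷_)} λ X ())) (+-identityʳ _)

  uniform-padˡ : ∀ {n k} N {F : Family n} → Uniform k F → Uniform k (padˡ N F)
  uniform-padˡ zero u X p = u X p
  uniform-padˡ (suc N) u (false ∷ X) p = uniform-padˡ N u X p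

  ∂-padˡ : ∀ {n} N {F H : Family n} → ∂ F ⊑ H → ∂ (padˡ N F) ⊑ padˡ N H
  ∂-padˡ zero h X p = h X p
  ∂-padˡ (suc N) {F} h (false ∷ X) p with ∨-cases {∂ (padˡ N F) X} p
  ... | inj₁ q = ∂-padˡ N h X q
  ∂-padˡ {n} (suc N) {F} h (true ∷ X) p with ∂-elim {N + n} (padˡ (suc N) F ∘ (true ∷_)) X p
  ... | _ , _ , ()

  padʳ : ∀ {N} n → Family N → Family (N + n)
  padʳ {zero} n G X = G [] ∧ eqᵇ X ⊥
  padʳ {suc N} n G (b ∷ X) = padʳ n (G ∘ (b ∷_)) X

  card-padʳ : ∀ {N} n (G : Family N) → card (padʳ n G) ≡ card G
  card-padʳ {zero} n G with G [] in eq
  ... | true = card-singleton (⊥ {n})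
  ... | false = card-empty {n} {λ X → false} λ X ()
  card-padʳ {suc N} n G rewrite card-suc (padʳ n G) | card-suc G = cong₂ _+_ (card-padʳ n (G ∘ (false ∷_))) (card-padʳ n (G ∘ (true ∷_)))

  padʳ-∨ : ∀ {N} n (F G : Family N) X → T (padʳ n (F ∪ᶠ G) X) → T (padʳ n F X) ⊎ T (padʳ n G X)
  padʳ-∨ {zero} n F G X p with ∨-cases {F []} (∧-fst p)
  ... | inj₁ q = inj₁ (∧-intro q (∧-snd {F [] ∨ G []} p))
  ... | inj₂ q = inj₂ (∧-intro q (∧-snd {F [] ∨ G []} p))
  padʳ-∨ {suc N} n F G (b ∷ X) p = padʳ-∨ n (F ∘ (b ∷_)) (G ∘ (b ∷_)) X p

  ∂-padʳ : ∀ {N} n (G : Family N) → padʳ n (∂ G) ⊑ ∂ (padʳ n G)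
  ∂-padʳ {zero} n G X ()
  ∂-padʳ {suc N} n G (false ∷ X) p with padʳ-∨ n (∂ (G ∘ (false ∷_))) (G ∘ (true ∷_)) X p
  ... | inj₁ q = ∨-left (∂-padʳ n (G ∘ (false ∷_)) X q)
  ... | inj₂ q = ∨-right {∂ (padʳ n (G ∘ (false ∷_))) X} q
  ∂-padʳ {suc N} n G (true ∷ X) p = ∂-padʳ n (G ∘ (true ∷_)) X p

  embed : ∀ {N} n → Subset N → Subset (N + n)
  embed n [] = ⊥
  embed n (x ∷ X) = x ∷ embed n X

  ⊀⊥ : ∀ {n} {X : Subset n} → ¬ (X ≺ ⊥)
  ⊀⊥ {suc n} (there p) = ⊀⊥ p

  size-embed : ∀ {N} n (X : Subset N) → ∣ embed n X ∣ ≡ ∣ X ∣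
  size-embed n [] = ∣⊥∣≡0 n
  size-embed n (true ∷ X) = cong suc (size-embed n X)
  size-embed n (false ∷ X) = size-embed n X

  padʳ-elim : ∀ {N} n (G : Family N) X → T (padʳ n G X) → ∃ λ Z → X ≡ embed n Z × T (G Z)
  padʳ-elim {zero} n G X p = [] , eqᵇ-sound X ⊥ (∧-snd {G []} p) , ∧-fst p
  padʳ-elim {suc N} n G (b ∷ X) p = let (Z , e , q) = padʳ-elim n (G ∘ (b ∷_)) X p in b ∷ Z , cong (b ∷_) e , q

  padʳ-intro : ∀ {N} n (G : Family N) X → T (G X) → T (padʳ n G (embed n X))
  padʳ-intro n G [] p = ∧-intro p (eqᵇ-refl (⊥ {n}))
  padʳ-intro n G (b ∷ X) p = padʳ-intro n (G ∘ (b ∷_)) X p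

  ≺-embed : ∀ {N} n {Y} (X : Subset N) → Y ≺ embed n X → ∃ λ Z → Y ≡ embed n Z × Z ≺ X
  ≺-embed n [] p = ⊥-elim (⊀⊥ p)
  ≺-embed n (true ∷ X) here = false ∷ X , refl , here
  ≺-embed n (x ∷ X) (there {x = y} p) = let (Z , e , q) = ≺-embed n X p in y ∷ Z , cong (y ∷_) e , there q

  initial-padʳ : ∀ {N k} n {G : Family N} → Initial k G → Initial k (padʳ n G)
  initial-padʳ {N} {k} n {G} I = record { uniform = u ; down = d }
    where
    open Initial I
    u : Uniform k (padʳ n G)
    u X p with padʳ-elim n G X p
    ... | Z , refl , q = trans (size-embed n Z) (uniform Z q)
    d : ∀ {X Y} → T (padʳ n G X) → Y ≺ X → ∣ Y ∣ ≡ k → T (padʳ n G Y)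
    d {X} p l s with padʳ-elim n G X p
    ... | Z , refl , q with ≺-embed n Z l
    ... | W , refl , m = padʳ-intro n G W (down q m (trans (sym (size-embed n W)) s))

  -- Both families move to a common ground set. The new vertices for `G` are put at the end, where
  -- they are largest in colex, so `G` remains an initial segment; for `F` the position is
  -- immaterial and they go in front.
  kruskal-katona′ : ∀ {n N k} {F H : Family n} {G : Family N} →
    Uniform k F → ∂ F ⊑ H → Initial k G → card G ≤ card F → card (∂ G) ≤ card H
  kruskal-katona′ {n} {N} {k} {F} {H} {G} u s I le = begin
    card (∂ G)          ≡⟨ card-padʳ n (∂ G) ⟨
    card (padʳ n (∂ G)) ≤⟨ card-mono (∂-padʳ n G) ⟩
    card (∂ (padʳ n G)) ≤⟨ kruskal-katona (N + n) k (uniform-padˡ N u) (∂-padˡ N s) (initial-padʳ n I)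
                             (≤-trans (≤-reflexive (card-padʳ n G)) (≤-trans le (≤-reflexive (sym (card-padˡ N F))))) ⟩
    card (padˡ N H)     ≡⟨ card-padˡ N H ⟩
    card H              ∎
    where open ≤-Reasoning

-- Initial segments of colex, their complements, links on disjoint ground sets, and the shadow of J.

module InitialSegments where
  open Families
  open KruskalKatona
  open import Data.Nat.Base using (_+_; _≤_; _<_; z≤n; s≤s)
  open import Data.Nat.Properties
  open import Data.Nat.Combinatorics using (nCk+nC[k+1]≡[n+1]C[k+1])
  open import Data.Bool.Properties using (∧-zeroʳ)
  open import Data.Bool.ListAction using (any)
  open import Data.Fin using (fromℕ)
  open import Data.Fin.Properties using () renaming (_≟_ to _≟ᶠ_)
  open import Data.Fin.Subset using (⊤; ∁)
  open import Data.Fin.Subset.Properties using (∣⊤∣≡n)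
  open import Data.List.Base using (map)
  open import Data.List.Relation.Unary.Any using (here; there; satisfied) renaming (Any to AnyL)
  open import Data.List.Relation.Unary.Any.Properties using (any⁺; any⁻) renaming (++⁺ˡ to anyL-++⁺ˡ; ++⁺ʳ to anyL-++⁺ʳ; map⁺ to anyL-map⁺)
  open import Data.Vec.Properties using ([]≔-commutes; lookup-replicate)
  open import Relation.Binary.PropositionalEquality

  below : ∀ {n} → ℕ → Subset n → Family n
  below k A B = hasSize k B ∧ colexLt B A

  below-intro : ∀ {n k} {A B : Subset n} → ∣ B ∣ ≡ k → B ≺ A → T (below k A B)
  below-intro {B = B} h l = ∧-intro (hasSize-intro B h) (≺⇒colexLt l)

  below-≺ : ∀ {n k} {A B : Subset n} → T (below k A B) → B ≺ A
  below-≺ {k = k} {A} {B} p = colexLt⇒≺ B A (∧-snd {hasSize k B} p)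

  initSeg-size : ∀ {N k m} → Uniform k (initSeg N k m)
  initSeg-size X p = hasSize-elim X (∧-fst p)

  initSeg-rank : ∀ {N k m} X → T (initSeg N k m X) → card (below k X) < m
  initSeg-rank {k = k} {m} X p = <ᵇ⇒< _ m (∧-snd {hasSize k X} p)

  below-mono : ∀ {n} k {X Y : Subset n} → Y ≺ X → below k Y ⊑ below k X
  below-mono k {X} {Y} l Z q = below-intro {k = k} {A = X} {B = Z} (hasSize-elim {k = k} Z (∧-fst {hasSize k Z} q))
    (≺-trans (below-≺ {k = k} {A = Y} {B = Z} q) l)

  initSeg-initial : ∀ N k m → Initial k (initSeg N k m)
  initSeg-initial N k m = record
    { uniform = initSeg-size {m = m}
    ; down = λ {X} {Y} p l s → ∧-intro {hasSize k Y} (hasSize-intro Y s)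
        (<⇒<ᵇ (≤-<-trans (card-mono (below-mono k l)) (initSeg-rank {k = k} {m = m} X p))) }

  card-initSeg≤ : ∀ N k m → card (initSeg N k m) ≤ m
  card-initSeg≤ N k m with find (initSeg N k m)
  ... | inj₂ none = ≤-trans (≤-reflexive (card-empty none)) z≤n
  ... | inj₁ w with ≺-max (initSeg N k m) w
  ... | X , p , mx = ≤-trans (card-cover (below k X) (λ Y → eqᵇ Y X) (initSeg N k m) cover)
      (≤-trans (≤-reflexive (trans (cong (card (below k X) +_) (card-singleton X)) (+-comm _ 1))) (initSeg-rank {m = m} X p))
    where
    cover : ∀ Y → T (initSeg N k m Y) → T (below k X Y) ⊎ T (eqᵇ Y X)
    cover Y q with ≺-compare Y X
    ... | inj₁ l = inj₁ (below-intro (initSeg-size {m = m} Y q) l)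
    ... | inj₂ (inj₁ refl) = inj₂ (eqᵇ-refl Y)
    ... | inj₂ (inj₂ l) = ⊥-elim (mx Y l q)

  card-sized : ∀ n k → card {n} (hasSize k) ≡ n C k
  card-sized n k = trans (card-ext {n} {hasSize k} {kSubsetsOf k ⊤} (λ X p → ∧-intro p (⊆ᵇ-intro X (⊤ {n}) λ v _ → lookup-replicate v true)) (λ X p → ∧-fst p))
      (trans (card-kSubsets {n} k ⊤) (cong (_C k) (∣⊤∣≡n n)))

  -- The first k-set outside the segment, if there is one, has at least m predecessors, and all of
  -- them are inside.
  card-initSeg : ∀ N k m → m ≤ N C k → card (initSeg N k m) ≡ m
  card-initSeg N k m h = ≤-antisym (card-initSeg≤ N k m) lower
    where
    lower : m ≤ card (initSeg N k m)
    lower with find (hasSize k ∖ᶠ initSeg N k m)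
    ... | inj₂ none = ≤-trans h (≤-trans (≤-reflexive (sym (card-sized N k))) (card-mono λ X p → all X p (T? (initSeg N k m X))))
      where
      all : ∀ X → T (hasSize k X) → T (initSeg N k m X) ⊎ T (not (initSeg N k m X)) → T (initSeg N k m X)
      all X p (inj₁ q) = q
      all X p (inj₂ q) = ⊥-elim (none X (∧-intro p q))
    ... | inj₁ w with ≺-min (hasSize k ∖ᶠ initSeg N k m) w
    ... | X , p , mn = ≤-trans (≮⇒≥ λ lt → not⇒¬T (∧-snd {hasSize k X} p) (∧-intro (∧-fst p) (<⇒<ᵇ lt)))
        (card-mono {F = below k X} λ Y q → inside Y q (T? (initSeg N k m Y)))
      where
      inside : ∀ Y → T (below k X Y) → T (initSeg N k m Y) ⊎ T (not (initSeg N k m Y)) → T (initSeg N k m Y)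
      inside Y q (inj₁ r) = r
      inside Y q (inj₂ r) = ⊥-elim (mn Y (below-≺ {k = k} q) (∧-intro (∧-fst q) r))

  -- A member of `G` outside `G′` comes after all of `G′`, so `G` would contain `G′` and one set
  -- more.
  initial-⊑ : ∀ {n k} {G G′ : Family n} → Initial k G → Initial k G′ → card G ≤ card G′ → G ⊑ G′
  initial-⊑ {k = k} {G} {G′} I I′ le X p with T? (G′ X)
  ... | inj₁ q = q
  ... | inj₂ q = ⊥-elim (<⇒≱ (≤-trans (≤-reflexive (sym (trans (cong (_+ card G′) (card-singleton X)) refl)))
      (card-disjoint (λ Y → eqᵇ Y X) G′ G (λ Y e → subst (T ∘ G) (sym (eqᵇ-sound Y X e)) p) lower
        (λ Y e g → not⇒¬T q (subst (T ∘ G′) (eqᵇ-sound Y X e) g)))) le)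
    where
    lower : ∀ Y → T (G′ Y) → T (G Y)
    lower Y g with ≺-compare Y X
    ... | inj₁ l = Initial.down I p l (Initial.uniform I′ Y g)
    ... | inj₂ (inj₁ refl) = p
    ... | inj₂ (inj₂ l) = ⊥-elim (not⇒¬T q (Initial.down I′ g l (Initial.uniform I X p)))

  low : ∀ {N} → ℕ → Subset N
  low {zero} j = []
  low {suc N} zero = false ∷ low zero
  low {suc N} (suc j) = true ∷ low j

  size-low : ∀ {N j} → j ≤ N → ∣ low {N} j ∣ ≡ j
  size-low {zero} z≤n = refl
  size-low {suc N} {zero} h = size-low {N} {zero} z≤n
  size-low {suc N} {suc j} h = cong suc (size-low (≤-pred h))

  ⊀low0 : ∀ {n} (X Y : Subset n) → T (Y ⊆ᵇ low 0) → ¬ (X ≺ Y)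
  ⊀low0 (x ∷ X) (y ∷ Y) p (there l) = ⊀low0 X Y (∧-snd {not y ∨ false} p) l

  low-down : ∀ {n} j (X Y : Subset n) → T (Y ⊆ᵇ low j) → X ≺ Y → T (X ⊆ᵇ low j)
  low-down zero X Y p l = ⊥-elim (⊀low0 X Y p l)
  low-down (suc j) (false ∷ X) (true ∷ X) p here = p
  low-down (suc j) (x ∷ X) (y ∷ Y) p (there l) = ∧-intro (x∨true x) (low-down j X Y (∧-snd {not y ∨ true} p) l)
    where
    x∨true : ∀ x → T (not x ∨ true)
    x∨true true = tt
    x∨true false = tt

  low-≺ : ∀ {n} j (X Y : Subset n) → T (Y ⊆ᵇ low j) → ¬ T (X ⊆ᵇ low j) → Y ≺ X
  low-≺ j X Y p q with ≺-compare Y X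
  ... | inj₁ l = l
  ... | inj₂ (inj₁ refl) = ⊥-elim (q p)
  ... | inj₂ (inj₂ l) = ⊥-elim (q (low-down j X Y p l))

  low-initial : ∀ {n} k j → Initial {n} k (kSubsetsOf k (low j))
  low-initial k j = record
    { uniform = kSub-size (low j)
    ; down = λ {X} {Y} p l s → kSub-intro (low j) Y s (low-down j Y X (kSub-⊆ {k = k} (low j) X p) l) }

  card-low : ∀ {n} k j → j ≤ n → card (kSubsetsOf k (low {n} j)) ≡ j C k
  card-low {n} k j h = trans (card-kSubsets {n} k (low j)) (cong (_C k) (size-low {n} h))

  top : ∀ s → Fin (suc s)
  top = fromℕ

  lookup-low-top : ∀ s → lookup (low {suc s} s) (top s) ≡ false
  lookup-low-top zero = refl
  lookup-low-top (suc s) = lookup-low-top s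

  low-top-unique : ∀ s (v : Fin (suc s)) → lookup (low {suc s} s) v ≡ false → v ≡ top s
  low-top-unique zero zero h = refl
  low-top-unique (suc s) (suc v) h = cong suc (low-top-unique s v h)

  top∉⇒⊆low : ∀ s (X : Subset (suc s)) → lookup X (top s) ≡ false → T (X ⊆ᵇ low s)
  top∉⇒⊆low s X h with T? (X ⊆ᵇ low s)
  ... | inj₁ p = p
  ... | inj₂ p with ⊆ᵇ-witness X (low s) (not⇒¬T p)
  ... | v , q , r with low-top-unique s v r
  ... | refl = true≢false q h

  ⊆low⇒top∉ : ∀ s (X : Subset (suc s)) → T (X ⊆ᵇ low s) → lookup X (top s) ≡ false
  ⊆low⇒top∉ s X p with lookup X (top s) in eq
  ... | false = refl
  ... | true = true≢false (⊆ᵇ-elim X (low s) p (top s) eq) (lookup-low-top s)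

  insert-mono-≺ : ∀ {n} (v : Fin n) {X Y : Subset n} → X ≺ Y → lookup X v ≡ false → lookup Y v ≡ false → insert v X ≺ insert v Y
  insert-mono-≺ zero (there p) h k = there p
  insert-mono-≺ (suc v) here h k = here
  insert-mono-≺ (suc v) (there p) h k = there (insert-mono-≺ v p h k)

  link-top-initial : ∀ {s r} {I : Family (suc s)} → Initial (suc r) I → Initial r (link (top s) I)
  link-top-initial {s} {r} {I} J = record
    { uniform = link-uniform (top s) uniform
    ; down = λ {X} {Y} p l h →
        let x = link-∉ (top s) I X p
            y = ⊆low⇒top∉ s Y (low-down s Y X (top∉⇒⊆low s X x) l)
        in ∧-intro (down (∧-fst p) (insert-mono-≺ (top s) l y x) (trans (size-insert (top s) Y y) (cong suc h))) (not-intro y) }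
    where open Initial J

  size-⊆ : ∀ {n} (X Y : Subset n) → T (X ⊆ᵇ Y) → ∣ X ∣ ≤ ∣ Y ∣
  size-⊆ [] [] p = z≤n
  size-⊆ (true ∷ X) (true ∷ Y) p = s≤s (size-⊆ X Y p)
  size-⊆ (false ∷ X) (true ∷ Y) p = m≤n⇒m≤1+n (size-⊆ X Y p)
  size-⊆ (false ∷ X) (false ∷ Y) p = size-⊆ X Y p

  ⊆-size-≡ : ∀ {n} (X Y : Subset n) → T (X ⊆ᵇ Y) → ∣ Y ∣ ≤ ∣ X ∣ → X ≡ Y
  ⊆-size-≡ [] [] p h = refl
  ⊆-size-≡ (true ∷ X) (true ∷ Y) p h = cong (true ∷_) (⊆-size-≡ X Y p (≤-pred h))
  ⊆-size-≡ (false ∷ X) (true ∷ Y) p h = ⊥-elim (<⇒≱ h (size-⊆ X Y p))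
  ⊆-size-≡ (false ∷ X) (false ∷ Y) p h = cong (false ∷_) (⊆-size-≡ X Y p h)

  extend-within : ∀ {n} (X S : Subset n) → ∣ X ∣ < ∣ S ∣ → ∃ λ v → lookup S v ≡ true × lookup X v ≡ false
  extend-within X S h = ⊆ᵇ-witness S X λ p → <⇒≱ h (size-⊆ S X p)

  ⊆ᵇ-insert : ∀ {n} (v : Fin n) (X S : Subset n) → T (X ⊆ᵇ S) → lookup S v ≡ true → T (insert v X ⊆ᵇ S)
  ⊆ᵇ-insert v X S p h = ⊆ᵇ-intro (insert v X) S helper
    where
    helper : ∀ u → lookup (insert v X) u ≡ true → lookup S u ≡ true
    helper u q with v ≟ᶠ u
    ... | yes refl = h
    ... | no ne = ⊆ᵇ-elim X S p u (trans (sym (lookup-insert′ X ne)) q)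

  kSub⊑∂kSub : ∀ {n} r (S : Subset n) → r < ∣ S ∣ → kSubsetsOf r S ⊑ ∂ (kSubsetsOf (suc r) S)
  kSub⊑∂kSub r S h X p with extend-within X S (≤-<-trans (≤-reflexive (kSub-size S X p)) h)
  ... | v , q , x = ∂-intro (kSubsetsOf (suc r) S) v X x (kSub-intro S (insert v X)
          (trans (size-insert v X x) (cong suc (kSub-size S X p))) (⊆ᵇ-insert v X S (kSub-⊆ {k = r} S X p) q))

  Pascal : ∀ n k → n C k + n C suc k ≡ suc n C suc k
  Pascal = nCk+nC[k+1]≡[n+1]C[k+1]

  nCk≤[1+n]Ck : ∀ n k → n C k ≤ suc n C k
  nCk≤[1+n]Ck n zero = ≤-refl
  nCk≤[1+n]Ck n (suc k) = ≤-trans (m≤n+m _ (n C k)) (≤-reflexive (Pascal n k))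

  -- In this range of lengths the segment consists of all (r+1)-subsets of [s] and of sets
  -- containing the last vertex. The link at that vertex is therefore exactly the surplus, and it is
  -- again an initial segment.
  module TopLink (s r m : ℕ) (lo : s C suc r ≤ m) (hi : m ≤ suc s C suc r) where
    seg : Family (suc s)
    seg = initSeg (suc s) (suc r) m

    seg-initial : Initial (suc r) seg
    seg-initial = initSeg-initial (suc s) (suc r) m

    low⊑seg : kSubsetsOf (suc r) (low s) ⊑ seg
    low⊑seg = initial-⊑ (low-initial (suc r) s) seg-initial
      (≤-trans (≤-reflexive (card-low (suc r) s (n≤1+n s))) (≤-trans lo (≤-reflexive (sym (card-initSeg (suc s) (suc r) m hi)))))

    toplink : Family (suc s)
    toplink = link (top s) seg

    card-del-seg : card (del (top s) seg) ≡ s C suc r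
    card-del-seg = trans (card-ext {G = kSubsetsOf (suc r) (low s)}
        (λ X p → kSub-intro (low s) X (Initial.uniform seg-initial X (∧-fst p)) (top∉⇒⊆low s X (del-∉ (top s) seg X p)))
        (λ X p → ∧-intro (low⊑seg X p) (not-intro (⊆low⇒top∉ s X (kSub-⊆ {k = suc r} (low s) X p)))))
      (card-low (suc r) s (n≤1+n s))

    card-toplink : card toplink + s C suc r ≡ m
    card-toplink = trans (cong (card toplink +_) (sym card-del-seg)) (trans (sym (card-link-del (top s) seg)) (card-initSeg (suc s) (suc r) m hi))

    card-∂seg : r < s → card (∂ toplink) + s C r ≤ card (∂ seg)
    card-∂seg r<s = begin
      card (∂ toplink) + s C r
        ≤⟨ +-mono-≤ (card-mono (∂-link (top s) seg)) (≤-trans (≤-reflexive (sym (card-low r s (n≤1+n s)))) (card-mono inner)) ⟩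
      card (link (top s) (∂ seg)) + card (del (top s) (∂ seg)) ≡⟨ card-link-del (top s) (∂ seg) ⟨
      card (∂ seg) ∎
      where
      open ≤-Reasoning
      inner : kSubsetsOf r (low s) ⊑ del (top s) (∂ seg)
      inner X p = ∧-intro (∂-mono low⊑seg X (kSub⊑∂kSub r (low s) (<-≤-trans r<s (≤-reflexive (sym (size-low (n≤1+n s))))) X p))
        (not-intro (⊆low⇒top∉ s X (kSub-⊆ {k = r} (low s) X p)))

  -- The form in which Kruskal–Katona enters the stability argument: past s C (r+1), the surplus is paid for one level down.
  kk-surplus : ∀ {n} {A B : Family n} s r E → Uniform (suc r) A → ∂ A ⊑ B → r < s → E ≤ s C r → s C suc r + E ≤ card A →
    ∃ λ (L : Family (suc s)) → Uniform r L × card L ≡ E × card (∂ L) + s C r ≤ card B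
  kk-surplus {A = A} {B} s r E u h r<s hi le = toplink , Initial.uniform (link-top-initial {s} {r} seg-initial)
      , +-cancelʳ-≡ (s C suc r) (card toplink) E (trans card-toplink (+-comm (s C suc r) E))
      , ≤-trans (card-∂seg r<s) (kruskal-katona′ u h seg-initial (≤-trans (card-initSeg≤ (suc s) (suc r) (s C suc r + E)) le))
    where open TopLink s r (s C suc r + E) (m≤m+n (s C suc r) E)
               (≤-trans (+-monoʳ-≤ (s C suc r) hi) (≤-reflexive (trans (+-comm (s C suc r) (s C r)) (Pascal s r))))

  size-∁ : ∀ {n} (X : Subset n) → ∣ ∁ X ∣ + ∣ X ∣ ≡ n
  size-∁ [] = refl
  size-∁ (true ∷ X) = trans (+-suc ∣ ∁ X ∣ ∣ X ∣) (cong suc (size-∁ X))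
  size-∁ (false ∷ X) = cong suc (size-∁ X)

  card-∁ : ∀ {n} (F : Family n) → card (F ∘ ∁) ≡ card F
  card-∁ {zero} F = refl
  card-∁ {suc n} F rewrite card-suc (F ∘ ∁) | card-suc F =
    trans (cong₂ _+_ (card-∁ (F ∘ (true ∷_))) (card-∁ (F ∘ (false ∷_)))) (+-comm (card (F ∘ (true ∷_))) _)

  ∁-insert : ∀ {n} (v : Fin n) X → lookup X v ≡ false → insert v (∁ (insert v X)) ≡ ∁ X
  ∁-insert zero (false ∷ X) h = refl
  ∁-insert (suc v) (x ∷ X) h = cong (not x ∷_) (∁-insert v X h)

  lookup-∁-insert : ∀ {n} (v : Fin n) X → lookup (∁ (insert v X)) v ≡ false
  lookup-∁-insert zero (x ∷ X) = refl
  lookup-∁-insert (suc v) (x ∷ X) = lookup-∁-insert v X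

  -- G and H consist of the complements of the sets missing from the shadow of an initial segment and from the segment itself.
  complement-pair : ∀ {n} {A B : Family n} q r → Uniform (suc r) A → ∂ A ⊑ B → card A ≤ (suc q + r) C suc r →
    ∃ λ (G : Family (suc q + r)) → ∃ λ (H : Family (suc q + r)) →
      Uniform (suc q) G × ∂ G ⊑ H × card H + card A ≡ (suc q + r) C suc r × (suc q + r) C r ≤ card G + card B
  complement-pair {A = A} {B} q r u h le = G , H , uG , sub , cH , cG
    where
    N = suc q + r
    I = initSeg N (suc r) (card A)
    G H : Family N
    G = (hasSize r ∖ᶠ ∂ I) ∘ ∁
    H = (hasSize (suc r) ∖ᶠ I) ∘ ∁
    ∣∁∣ : ∀ X j → j + suc q ≡ N → ∣ ∁ X ∣ ≡ j → ∣ X ∣ ≡ suc q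
    ∣∁∣ X j e h = +-cancelˡ-≡ ∣ ∁ X ∣ _ _ (trans (size-∁ X) (trans (sym e) (cong (_+ suc q) (sym h))))
    uG : Uniform (suc q) G
    uG X p = ∣∁∣ X r (+-comm r (suc q)) (hasSize-elim (∁ X) (∧-fst p))
    sub : ∂ G ⊑ H
    sub X p with ∂-elim G X p
    ... | v , x , g = ∧-intro (hasSize-intro (∁ X) (trans (cong ∣_∣ (sym e)) (trans (size-insert v (∁ (insert v X)) (lookup-∁-insert v X))
              (cong suc (hasSize-elim (∁ (insert v X)) (∧-fst g))))))
            (¬T⇒not λ i → not⇒¬T (∧-snd {hasSize r (∁ (insert v X))} g) (∂-intro I v _ (lookup-∁-insert v X) (subst (T ∘ I) (sym e) i)))
      where e = ∁-insert v X x
    cH : card H + card A ≡ N C suc r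
    cH = begin
      card H + card A ≡⟨ cong₂ _+_ (card-∁ (hasSize (suc r) ∖ᶠ I)) (sym (card-initSeg N (suc r) (card A) le)) ⟩
      card (hasSize (suc r) ∖ᶠ I) + card I
        ≡⟨ cong (card (hasSize (suc r) ∖ᶠ I) +_) (card-ext {F = I} {G = hasSize (suc r) ∩ᶠ I} (λ X p → ∧-intro {hasSize (suc r) X} (∧-fst {hasSize (suc r) X} p) p) (λ X p → ∧-snd {hasSize (suc r) X} p)) ⟩
      card (hasSize (suc r) ∖ᶠ I) + card (hasSize (suc r) ∩ᶠ I) ≡⟨ +-comm (card (hasSize (suc r) ∖ᶠ I)) _ ⟩
      card (hasSize (suc r) ∩ᶠ I) + card (hasSize (suc r) ∖ᶠ I) ≡⟨ card-split (hasSize (suc r)) I ⟨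
      card {N} (hasSize (suc r)) ≡⟨ card-sized N (suc r) ⟩
      N C suc r ∎
      where open ≡-Reasoning
    cG : N C r ≤ card G + card B
    cG = begin
      N C r ≡⟨ card-sized N r ⟨
      card {N} (hasSize r) ≡⟨ card-split (hasSize r) (∂ I) ⟩
      card (hasSize r ∩ᶠ ∂ I) + card (hasSize r ∖ᶠ ∂ I) ≤⟨ +-monoˡ-≤ _ (card-mono {G = ∂ I} λ X p → ∧-snd {hasSize r X} p) ⟩
      card (∂ I) + card (hasSize r ∖ᶠ ∂ I) ≡⟨ cong (card (∂ I) +_) (card-∁ (hasSize r ∖ᶠ ∂ I)) ⟨
      card (∂ I) + card G ≤⟨ +-monoˡ-≤ (card G) (kruskal-katona′ u h (initSeg-initial N (suc r) (card A)) (card-initSeg≤ N (suc r) (card A))) ⟩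
      card B + card G ≡⟨ +-comm (card B) _ ⟩
      card G + card B ∎
      where open ≤-Reasoning

  ∂-∪ : ∀ {n} (F G : Family n) X → T (∂ (F ∪ᶠ G) X) → T (∂ F X) ⊎ T (∂ G X)
  ∂-∪ F G X p with ∂-elim (F ∪ᶠ G) X p
  ... | v , q , r with ∨-cases {F (insert v X)} r
  ... | inj₁ f = inj₁ (∂-intro F v X q f)
  ... | inj₂ g = inj₂ (∂-intro G v X q g)

  padʳ-∪ : ∀ {N} n (F G : Family N) X → T (padʳ n F X) ⊎ T (padʳ n G X) → T (padʳ n (F ∪ᶠ G) X)
  padʳ-∪ {zero} n F G X (inj₁ p) = ∧-intro {F [] ∨ G []} (∨-left {F []} (∧-fst {F []} p)) (∧-snd {F []} p)
  padʳ-∪ {zero} n F G X (inj₂ p) = ∧-intro {F [] ∨ G []} (∨-right {F []} (∧-fst {G []} p)) (∧-snd {G []} p)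
  padʳ-∪ {suc N} n F G (b ∷ X) p = padʳ-∪ n (F ∘ (b ∷_)) (G ∘ (b ∷_)) X p

  ∂-padʳ⁻ : ∀ {N} n (G : Family N) → ∂ (padʳ n G) ⊑ padʳ n (∂ G)
  ∂-padʳ⁻ {zero} n G X p with ∂-elim (padʳ n G) X p
  ... | v , q , r = true≢false (trans (cong (λ Z → lookup Z v) (sym (eqᵇ-sound (insert v X) ⊥ (∧-snd {G []} r)))) (lookup∘update v X true)) (lookup-replicate v false)
  ∂-padʳ⁻ {suc N} n G (false ∷ X) p with ∨-cases {∂ (padʳ n (G ∘ (false ∷_))) X} p
  ... | inj₁ q = padʳ-∪ n (∂ (G ∘ (false ∷_))) (G ∘ (true ∷_)) X (inj₁ (∂-padʳ⁻ n (G ∘ (false ∷_)) X q))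
  ... | inj₂ q = padʳ-∪ n (∂ (G ∘ (false ∷_))) (G ∘ (true ∷_)) X (inj₂ q)
  ∂-padʳ⁻ {suc N} n G (true ∷ X) p = ∂-padʳ⁻ n (G ∘ (true ∷_)) X p

  padˡ-embed : ∀ {N n} (G : Family n) (Z : Subset N) → T (padˡ N G (embed n Z)) → ∣ Z ∣ ≡ 0
  padˡ-embed G [] p = refl
  padˡ-embed G (false ∷ Z) p = padˡ-embed G Z p

  record ShadowPair (r a b : ℕ) : Set where
    field
      {ground} : ℕ
      G H      : Family ground
      uniform  : Uniform r G
      shadowed : ∂ G ⊑ H
      cardG    : card G ≡ a
      cardH    : card H ≤ b

  -- The padded copies could share only the empty set, which positive uniformity rules out for `G`.
  -- The two parts of `H` may overlap, which is harmless because `cardH` is only an upper bound.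
  disjoint-sum : ∀ {r a b a′ b′} → ShadowPair (suc r) a b → ShadowPair (suc r) a′ b′ → ShadowPair (suc r) (a + a′) (b + b′)
  disjoint-sum {r} P Q = record
    { G = padʳ m P.G ∪ᶠ padˡ n Q.G
    ; H = padʳ m P.H ∪ᶠ padˡ n Q.H
    ; uniform = λ X p → uni X (∨-cases {padʳ m P.G X} p)
    ; shadowed = λ X p → sh X (∂-∪ (padʳ m P.G) (padˡ n Q.G) X p)
    ; cardG = trans (trans (sym (+-identityʳ _)) (trans (cong (card (padʳ m P.G ∪ᶠ padˡ n Q.G) +_) (sym (card-empty disj)))
        (card-∪∩ (padʳ m P.G) (padˡ n Q.G)))) (cong₂ _+_ (trans (card-padʳ m P.G) P.cardG) (trans (card-padˡ n Q.G) Q.cardG))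
    ; cardH = ≤-trans (card-cover (padʳ m P.H) (padˡ n Q.H) (padʳ m P.H ∪ᶠ padˡ n Q.H) (λ X p → ∨-cases p))
        (+-mono-≤ (≤-trans (≤-reflexive (card-padʳ m P.H)) P.cardH) (≤-trans (≤-reflexive (card-padˡ n Q.H)) Q.cardH)) }
    where
    module P = ShadowPair P
    module Q = ShadowPair Q
    n = P.ground
    m = Q.ground
    uniʳ : ∀ X → T (padʳ m P.G X) → ∣ X ∣ ≡ suc r
    uniʳ X p with padʳ-elim m P.G X p
    ... | Z , refl , g = trans (size-embed m Z) (P.uniform Z g)
    uni : ∀ X → T (padʳ m P.G X) ⊎ T (padˡ n Q.G X) → ∣ X ∣ ≡ suc r
    uni X (inj₁ p) = uniʳ X p
    uni X (inj₂ p) = uniform-padˡ n Q.uniform X p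
    mono-padʳ : ∀ {N} m {F H : Family N} → F ⊑ H → padʳ m F ⊑ padʳ m H
    mono-padʳ {zero} m {F} h X p = ∧-intro (h [] (∧-fst p)) (∧-snd {F []} p)
    mono-padʳ {suc N} m h (b ∷ X) p = mono-padʳ m (λ Y → h (b ∷ Y)) X p
    sh : ∀ X → T (∂ (padʳ m P.G) X) ⊎ T (∂ (padˡ n Q.G) X) → T (padʳ m P.H X ∨ padˡ n Q.H X)
    sh X (inj₁ p) = ∨-left (mono-padʳ m P.shadowed X (∂-padʳ⁻ m P.G X p))
    sh X (inj₂ p) = ∨-right {padʳ m P.H X} (∂-padˡ n Q.shadowed X p)
    disj : ∀ X → ¬ T ((padʳ m P.G ∩ᶠ padˡ n Q.G) X)
    disj X p with padʳ-elim m P.G X (∧-fst p)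
    ... | Z , refl , g with trans (sym (P.uniform Z g)) (padˡ-embed Q.G Z (∧-snd {padʳ m P.G X} p))
    ... | ()

  hit : ∀ {n} → List (Fin n) → Subset n → Bool
  hit [] X = false
  hit (v ∷ vs) X = lookup X v ∨ hit vs X

  -- Each set is charged to the first vertex of the list that it contains: it is linked there, and
  -- the sets avoiding that vertex are passed on. No set is counted twice, so both cardinalities add
  -- up exactly, at the price of one level of uniformity.
  hit-pair : ∀ {n r} (vs : List (Fin n)) {A B : Family n} → Uniform (suc (suc r)) A → ∂ A ⊑ B →
             ShadowPair (suc r) (card (A ∩ᶠ hit vs)) (card (B ∩ᶠ hit vs))
  hit-pair [] {A} u h = record
    { ground = 0 ; G = λ _ → false ; H = λ _ → false ; uniform = λ _ () ; shadowed = λ _ ()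
    ; cardG = sym (card-empty λ X p → ∧-snd {A X} p) ; cardH = z≤n }
  hit-pair {r = r} (v ∷ vs) {A} {B} u h = record
    { G = G ; H = H ; uniform = uniform ; shadowed = shadowed
    ; cardG = trans cardG (sym (parts A)) ; cardH = ≤-trans cardH (≤-reflexive (sym (parts B))) }
    where
    parts : ∀ F → card (F ∩ᶠ hit (v ∷ vs)) ≡ card (link v F) + card (del v F ∩ᶠ hit vs)
    parts F = trans (card-link-del v (F ∩ᶠ hit (v ∷ vs))) (cong₂ _+_ (card-cong one) (card-cong two))
      where
      one : ∀ X → link v (F ∩ᶠ hit (v ∷ vs)) X ≡ link v F X
      one X rewrite lookup∘update v X true = cong (_∧ not (lookup X v)) (T-ext ∧-fst (λ p → ∧-intro p tt))
      two : ∀ X → del v (F ∩ᶠ hit (v ∷ vs)) X ≡ (del v F ∩ᶠ hit vs) X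
      two X with lookup X v
      ... | true = trans (∧-zeroʳ (F X ∧ true)) (sym (trans (cong (_∧ hit vs X) (∧-zeroʳ (F X))) refl))
      ... | false with F X | hit vs X
      ... | true | true = refl
      ... | true | false = refl
      ... | false | _ = refl
    at-v : ShadowPair (suc r) (card (link v A)) (card (link v B))
    at-v = record
      { G = link v A ; H = link v B ; uniform = link-uniform v u ; shadowed = ∂-link⊑ v h ; cardG = refl ; cardH = ≤-refl }
    open ShadowPair (disjoint-sum at-v (hit-pair vs (del-uniform v u) (∂-del⊑ v h)))

  outside : ∀ {n} → Subset n → List (Fin n)
  outside [] = []
  outside (true ∷ S) = map suc (outside S)
  outside (false ∷ S) = zero ∷ map suc (outside S)

  hit-map-suc : ∀ {n} (vs : List (Fin n)) x X → hit (map suc vs) (x ∷ X) ≡ hit vs X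
  hit-map-suc [] x X = refl
  hit-map-suc (v ∷ vs) x X = cong (lookup X v ∨_) (hit-map-suc vs x X)

  hit-outside : ∀ {n} (S X : Subset n) → hit (outside S) X ≡ not (X ⊆ᵇ S)
  hit-outside [] [] = refl
  hit-outside (true ∷ S) (true ∷ X) = trans (hit-map-suc (outside S) true X) (hit-outside S X)
  hit-outside (true ∷ S) (false ∷ X) = trans (hit-map-suc (outside S) false X) (hit-outside S X)
  hit-outside (false ∷ S) (true ∷ X) = refl
  hit-outside (false ∷ S) (false ∷ X) = trans (hit-map-suc (outside S) false X) (hit-outside S X)

  -- The sets outside S, each linked at an outside vertex; the links for different vertices are put on disjoint ground sets.
  outside-pair : ∀ {n r} (S : Subset n) {A B : Family n} → Uniform (suc (suc r)) A → Uniform (suc r) B → ∂ A ⊑ B →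
                 ShadowPair (suc r) (card (A ∖ᶠ kSubsetsOf (suc (suc r)) S)) (card (B ∖ᶠ kSubsetsOf (suc r) S))
  outside-pair {r = r} S {A} {B} u w h = record
    { G = G ; H = H ; uniform = uniform ; shadowed = shadowed
    ; cardG = trans cardG (sym (same u)) ; cardH = ≤-trans cardH (≤-reflexive (sym (same w))) }
    where
    open ShadowPair (hit-pair (outside S) u h)
    same : ∀ {k F} → Uniform k F → card (F ∖ᶠ kSubsetsOf k S) ≡ card (F ∩ᶠ hit (outside S))
    same {k} {F} u = card-ext
      (λ X p → ∧-intro (∧-fst p) (subst T (sym (hit-outside S X)) (¬T⇒not λ q → not⇒¬T (∧-snd {F X} p) (kSub-intro S X (u X (∧-fst p)) q))))
      (λ X p → ∧-intro (∧-fst p) (¬T⇒not λ q → not⇒¬T (subst T (hit-outside S X) (∧-snd {F X} p)) (kSub-⊆ {k = k} S X q)))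

  any-allSubsets : ∀ {n} (P : Family n) X → T (P X) → T (any P (allSubsets n))
  any-allSubsets P X p = any⁺ P (locate P X p)
    where
    locate : ∀ {n} (P : Family n) X → T (P X) → AnyL (T ∘ P) (allSubsets n)
    locate P [] p = here p
    locate P (false ∷ X) p = anyL-++⁺ˡ (anyL-map⁺ (locate (P ∘ (false ∷_)) X p))
    locate {suc n} P (true ∷ X) p = anyL-++⁺ʳ (map (false ∷_) (allSubsets n)) (anyL-map⁺ (locate (P ∘ (true ∷_)) X p))

  shadow≡∂ : ∀ {n r} {F : Family n} → Uniform (suc r) F → ∀ X → shadow (suc r) F X ≡ ∂ F X
  shadow≡∂ {n} {r} {F} u X = T-ext to from
    where
    to : T (shadow (suc r) F X) → T (∂ F X)
    to p with satisfied (any⁻ (λ A → F A ∧ (X ⊆ᵇ A)) (allSubsets n) (∧-snd {hasSize r X} p))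
    ... | A , q = go (extend-within X A (≤-reflexive (trans (cong suc size) (sym (u A (∧-fst q))))))
      where
      size = hasSize-elim X (∧-fst p)
      go : (∃ λ v → lookup A v ≡ true × lookup X v ≡ false) → T (∂ F X)
      go (v , a , x) = ∂-intro F v X x (subst (T ∘ F) (sym (⊆-size-≡ (insert v X) A (⊆ᵇ-insert v X A (∧-snd {F A} q) a)
        (≤-reflexive (trans (u A (∧-fst q)) (sym (trans (size-insert v X x) (cong suc size))))))) (∧-fst q))
    from : T (∂ F X) → T (shadow (suc r) F X)
    from p with ∂-elim F X p
    ... | v , x , q = ∧-intro (hasSize-intro X (∂-uniform u X p)) (any-allSubsets _ (insert v X)
        (∧-intro q (⊆ᵇ-insert⁻ v X (insert v X) x (⊆ᵇ-intro (insert v X) (insert v X) λ _ e → e))))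

  -- r + 1 ≥ 2 is the uniformity, |S| = s′ + 1, and 1 ≤ E₁ makes every (r+1)-subset of [s′] lie in the shadow of the first segment.
  module ShadowOfJ (s′ r E₁ E₂ : ℕ) (E₁≥1 : 1 ≤ E₁) (E₁≤ : E₁ ≤ s′ C suc r) (E₂≤ : E₂ ≤ s′ C suc r) where
    private
      k s : ℕ
      k = suc (suc r)
      s = suc s′
      I₁ I₂ I₃ : Family (suc s)
      I₁ = initSeg (suc s) k (s′ C k + E₁)
      I₂ = initSeg (suc s) k (s C k + E₂)
      I₃ = initSeg (suc s) k (s C k)
      hi₂ : s C k + E₂ ≤ suc s C k
      hi₂ = ≤-trans (+-monoʳ-≤ (s C k) (≤-trans E₂≤ (nCk≤[1+n]Ck s′ (suc r)))) (≤-reflexive (trans (+-comm (s C k) (s C suc r)) (Pascal s (suc r))))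
      hi₁ : s′ C k + E₁ ≤ suc s C k
      hi₁ = ≤-trans (+-monoʳ-≤ (s′ C k) E₁≤) (≤-trans (≤-reflexive (trans (+-comm (s′ C k) (s′ C suc r)) (Pascal s′ (suc r)))) (nCk≤[1+n]Ck s k))
      module L₂ = TopLink s (suc r) (s C k + E₂) (m≤m+n (s C k) E₂) hi₂
      L : Family (suc s)
      L = L₂.toplink
      L-initial : Initial (suc r) L
      L-initial = link-top-initial {s} L₂.seg-initial
      card-L : card L ≡ E₂
      card-L = +-cancelʳ-≡ (s C k) (card L) E₂ (trans L₂.card-toplink (+-comm (s C k) E₂))
      low⊑I₃ : kSubsetsOf k (low s) ⊑ I₃
      low⊑I₃ = TopLink.low⊑seg s (suc r) (s C k) ≤-refl (nCk≤[1+n]Ck s k)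
      -- The bound E₂ ≤ C(s′, r + 1) is what keeps the surplus link inside [s′].
      L-low : L ⊑ kSubsetsOf (suc r) (low s′)
      L-low = initial-⊑ L-initial (low-initial (suc r) s′) (≤-trans (≤-reflexive card-L)
        (≤-trans E₂≤ (≤-reflexive (sym (card-low (suc r) s′ (≤-trans (n≤1+n s′) (n≤1+n s)))))))
      big : ∃ λ X → T (I₁ X) × ¬ T (kSubsetsOf k (low s′) X)
      big = card-<-witness I₁ (kSubsetsOf k (low s′)) (begin-strict
          card (kSubsetsOf k (low {suc s} s′)) ≡⟨ card-low k s′ (≤-trans (n≤1+n s′) (n≤1+n s)) ⟩
          s′ C k <⟨ m<m+n (s′ C k) E₁≥1 ⟩
          s′ C k + E₁ ≡⟨ card-initSeg (suc s) k (s′ C k + E₁) hi₁ ⟨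
          card I₁ ∎)
        where open ≤-Reasoning
      I₁-initial = initSeg-initial (suc s) k (s′ C k + E₁)
      L⊑∂I₁ : L ⊑ ∂ I₁
      -- Some X in `I₁` is not contained in [s′], so every `B` inside [s′] precedes it and can be
      -- filled up to a set of `I₁`.
      L⊑∂I₁ B p with big
      ... | X , x , y with ≺-fill (low-≺ s′ X B (kSub-⊆ {k = suc r} (low s′) B (L-low B p)) (λ q → y (kSub-intro (low s′) X (Initial.uniform I₁-initial X x) q)))
                          (≤-reflexive (trans (cong suc (Initial.uniform L-initial B p)) (sym (Initial.uniform I₁-initial X x))))
      ... | v , q , inj₁ e = ∂-intro I₁ v B q (subst (T ∘ I₁) (sym e) x)
      ... | v , q , inj₂ l = ∂-intro I₁ v B q (Initial.down I₁-initial x l (trans (size-insert v B q) (cong suc (Initial.uniform L-initial B p))))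
      JF : Family (suc s)
      JF = Jfam (suc s) k s E₁ E₂
      -- A set of the second part of J consists of the top vertex and a member of `L`. Removing the
      -- top vertex leaves that member, which is already in `∂ I₁`; removing another vertex leaves a
      -- set of this family.
      Q : Family (suc s)
      Q B = lookup B (top s) ∧ ∂ L (erase (top s) B)
      top∈ : ∀ X → T ((I₂ ∖ᶠ I₃) X) → lookup X (top s) ≡ true
      top∈ X p with lookup X (top s) in eq
      ... | true = refl
      ... | false = ⊥-elim (not⇒¬T (∧-snd {I₂ X} p) (low⊑I₃ X (kSub-intro (low s) X (initSeg-size {m = s C k + E₂} X (∧-fst p)) (top∉⇒⊆low s X eq))))
      cover : ∀ B → T (∂ JF B) → T (∂ I₁ B) ⊎ T (Q B)
      cover B p with ∂-∪ I₁ (I₂ ∖ᶠ I₃) B p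
      ... | inj₁ q = inj₁ q
      ... | inj₂ q with ∂-elim (I₂ ∖ᶠ I₃) B q
      ... | v , b , d with v ≟ᶠ top s
      ... | yes refl = inj₁ (L⊑∂I₁ B (∧-intro (∧-fst d) (not-intro b)))
      ... | no ne = inj₂ (∧-intro (true⇒T t) (∂-intro L v (erase (top s) B) (trans (lookup-erase′ B (ne ∘ sym)) b)
              (∧-intro (subst (T ∘ I₂) (sym e) (∧-fst d)) (not-intro (trans (lookup-insert′ (erase (top s) B) ne) (lookup∘update (top s) B false))))))
        where
        t : lookup B (top s) ≡ true
        t = trans (sym (lookup-insert′ B ne)) (top∈ (insert v B) d)
        e : insert (top s) (insert v (erase (top s) B)) ≡ insert v B
        e = trans ([]≔-commutes (erase (top s) B) v (top s) ne) (cong (insert v) (insert-erase (top s) B t))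
      card-Q : card Q ≤ card (∂ L)
      card-Q = begin
        card Q ≡⟨ card-link-del (top s) Q ⟩
        card (link (top s) Q) + card (del (top s) Q)
          ≡⟨ cong (card (link (top s) Q) +_) (card-empty λ X p → true≢false (T⇒true (∧-fst (∧-fst {Q X} p))) (del-∉ (top s) Q X p)) ⟩
        card (link (top s) Q) + 0 ≡⟨ +-identityʳ _ ⟩
        card (link (top s) Q) ≤⟨ card-mono {G = ∂ L} (λ X p → subst (T ∘ ∂ L) (erase-insert (top s) X (link-∉ (top s) Q X p)) (∧-snd {lookup (insert (top s) X) (top s)} (∧-fst p))) ⟩
        card (∂ L) ∎
        where open ≤-Reasoning

    J-uniform : Uniform k (Jfam (suc s) k s E₁ E₂)
    J-uniform X p with ∨-cases {I₁ X} p
    ... | inj₁ q = initSeg-size {m = s′ C k + E₁} X q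
    ... | inj₂ q = initSeg-size {m = s C k + E₂} X (∧-fst q)

    card-shadow-J : ∀ {n} {F H₁ : Family n} {b} N → N ≡ suc s → Uniform k F → ∂ F ⊑ H₁ → card F ≡ s′ C k + E₁ → ShadowPair (suc r) E₂ b →
      card (shadow k (Jfam N k s E₁ E₂)) ≤ card H₁ + b
    card-shadow-J {F = F} {H₁} {b} _ refl u h e P = begin
      card (shadow k (Jfam (suc s) k s E₁ E₂)) ≡⟨ card-cong (shadow≡∂ J-uniform) ⟩
      card (∂ JF) ≤⟨ card-cover (∂ I₁) Q (∂ JF) cover ⟩
      card (∂ I₁) + card Q ≤⟨ +-mono-≤ (kruskal-katona′ u h I₁-initial (≤-trans (card-initSeg≤ (suc s) k (s′ C k + E₁)) (≤-reflexive (sym e))))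
                                (≤-trans card-Q (≤-trans (kruskal-katona′ P.uniform P.shadowed L-initial (≤-reflexive (trans card-L (sym P.cardG)))) P.cardH)) ⟩
      card H₁ + b ∎
      where
      open ≤-Reasoning
      module P = ShadowPair P

-- Ordered-field arithmetic with a checker for certificates of polynomial inequalities.

module RealArithmetic where
  open import Level using (0ℓ)
  open import Algebra.Bundles using (CommutativeRing)
  open import Data.Integer.Base as ℤ using (ℤ; +_; -[1+_]; _⊖_)
  import Data.Integer.Properties as ℤₚ
  open import Data.Vec.N-ary using (N-ary; _$ⁿ_)
  open import Data.Maybe using (nothing)
  open import Data.Unit using (⊤)
  open import Relation.Binary.Structures using (IsTotalOrder)
  open import Tactic.RingSolver.Core.AlmostCommutativeRing using (fromCommutativeRing)
  open import Tactic.RingSolver.Core.Polynomial.Parameters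
  open import Tactic.RingSolver.Core.Expression
  import Algebra.Properties.Ring as RingProperties

  -- The operators shadow those of the field, so that a sequent reads like the inequality it stands for; numerals are # k.
  module Syntax where
    infixl 7 _*_
    infixl 6 _+_ _-_
    infix 5.5 _≤_ _≈_
    infix 4 _⊢_≼_

    Term : ℕ → Set
    Term = Expr ℤ

    #_ : ∀ {n} → ℕ → Term n
    # k = Κ (+ k)

    _+_ _*_ _-_ : ∀ {n} → Term n → Term n → Term n
    a + b = a ⊕ b
    a * b = a ⊗ b
    a - b = a ⊕ ⊝ b

    data Relation (n : ℕ) : Set where
      _≤_ _≈_ : Term n → Term n → Relation n

    lhs rhs : ∀ {n} → Relation n → Term n
    lhs (a ≤ b) = a
    lhs (a ≈ b) = a
    rhs (a ≤ b) = b
    rhs (a ≈ b) = b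

    record Sequent (n : ℕ) : Set where
      constructor _⊢_≼_
      field
        hyps        : List (Relation n)
        lower upper : Term n

    variables : ∀ n → Vec (Term n) n
    variables n = Vec.tabulate Ι

    slacks : ∀ {n} → List (Relation n) → List (Term n)
    slacks [] = []
    slacks ((a ≤ b) ∷ hs) = (b - a) ∷ slacks hs
    slacks ((a ≈ b) ∷ hs) = (b - a) ∷ (a - b) ∷ slacks hs

    nth : ∀ {n} → List (Term n) → ℕ → Term n
    nth [] i = # 0
    nth (e ∷ es) zero = e
    nth (e ∷ es) (suc i) = nth es i

    -- A list of natural coefficients with products of slacks, the latter given by their positions.
    Certificate : Set
    Certificate = List (ℕ × List ℕ)

    product : ∀ {n} → List (Term n) → ℕ → List ℕ → Term n
    product es k [] = # k
    product es k (i ∷ is) = nth es i * product es k is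

    combination : ∀ {n} → List (Term n) → Certificate → Term n
    combination es [] = # 0
    combination es ((k , is) ∷ c) = product es k is + combination es c

  module OrderedField (R : CompleteOrderedField) where
    open CompleteOrderedField R
    open IsTotalOrder ≤-isTotalOrder public
      using (total; antisym) renaming (refl to ≤-refl; trans to ≤-trans; reflexive to ≤-reflexive; ≤-respʳ-≈ to ≤-respʳ; ≤-respˡ-≈ to ≤-respˡ)
    open RingProperties ring using (-‿+-comm; -‿involutive; -0#≈0#; -‿distribˡ-*; -‿distribʳ-*; -1*x≈-x)

    -- The literal 1 goes to `1#` itself and not to `1# + 0#`, so that the statements produced by
    -- `certify` match goals containing `1#` definitionally.
    fromℤ : ℤ → Carrier
    fromℤ (+ 1)      = 1#
    fromℤ (+ n)      = fromℕ n
    fromℤ (-[1+ n ]) = - fromℕ (suc n)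

    fromℤ-+ : ∀ n → fromℤ (+ n) ≈ fromℕ n
    fromℤ-+ zero = refl
    fromℤ-+ (suc zero) = sym (+-identityʳ 1#)
    fromℤ-+ (suc (suc n)) = refl

    fromℕ-+ : ∀ m n → fromℕ (m ℕ.+ n) ≈ fromℕ m + fromℕ n
    fromℕ-+ zero n = sym (+-identityˡ _)
    fromℕ-+ (suc m) n = trans (+-congˡ (fromℕ-+ m n)) (sym (+-assoc _ _ _))

    fromℕ-* : ∀ m n → fromℕ (m ℕ.* n) ≈ fromℕ m * fromℕ n
    fromℕ-* zero n = sym (zeroˡ _)
    fromℕ-* (suc m) n = trans (fromℕ-+ n (m ℕ.* n)) (trans (+-cong (sym (*-identityˡ _)) (fromℕ-* m n)) (sym (distribʳ _ _ _)))

    fromℤ-neg : ∀ i → fromℤ (ℤ.- i) ≈ - fromℤ i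
    fromℤ-neg (+ zero) = sym -0#≈0#
    fromℤ-neg (+ suc zero) = -‿cong (+-identityʳ 1#)
    fromℤ-neg (+ suc (suc n)) = refl
    fromℤ-neg (-[1+ n ]) = trans (fromℤ-+ (suc n)) (sym (-‿involutive _))

    fromℤ-⊖ : ∀ m n → fromℤ (m ⊖ n) ≈ fromℕ m - fromℕ n
    fromℤ-⊖ m zero = trans (fromℤ-+ m) (sym (trans (+-congˡ -0#≈0#) (+-identityʳ _)))
    fromℤ-⊖ zero (suc n) = sym (+-identityˡ _)
    fromℤ-⊖ (suc m) (suc n) = trans (reflexive (≡.cong fromℤ (ℤₚ.[1+m]⊖[1+n]≡m⊖n m n))) (trans (fromℤ-⊖ m n) (sym cancel))
      where
      cancel : (1# + fromℕ m) - (1# + fromℕ n) ≈ fromℕ m - fromℕ n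
      cancel = trans (+-congˡ (sym (-‿+-comm 1# (fromℕ n)))) (trans (+-congʳ (+-comm 1# (fromℕ m)))
        (trans (+-assoc _ _ _) (+-congˡ (trans (sym (+-assoc _ _ _)) (trans (+-congʳ (-‿inverseʳ 1#)) (+-identityˡ _))))))

    fromℤ-add : ∀ i j → fromℤ (i ℤ.+ j) ≈ fromℤ i + fromℤ j
    fromℤ-add (+ m) (+ n) = trans (fromℤ-+ (m ℕ.+ n)) (trans (fromℕ-+ m n) (sym (+-cong (fromℤ-+ m) (fromℤ-+ n))))
    fromℤ-add (+ m) -[1+ n ] = trans (fromℤ-⊖ m (suc n)) (+-congʳ (sym (fromℤ-+ m)))
    fromℤ-add -[1+ m ] (+ n) = trans (fromℤ-⊖ n (suc m)) (trans (+-comm _ _) (+-congˡ (sym (fromℤ-+ n))))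
    fromℤ-add -[1+ m ] -[1+ n ] = trans (-‿cong (trans (reflexive (≡.cong fromℕ (≡.sym (ℕₚ.+-suc (suc m) n)))) (fromℕ-+ (suc m) (suc n)))) (sym (-‿+-comm _ _))

    fromℤ-mul-pos : ∀ m j → fromℤ (+ m ℤ.* j) ≈ fromℕ m * fromℤ j
    fromℤ-mul-pos m (+ n) = trans (reflexive (≡.cong fromℤ (≡.sym (ℤₚ.pos-* m n)))) (trans (fromℤ-+ (m ℕ.* n)) (trans (fromℕ-* m n) (*-congˡ (sym (fromℤ-+ n)))))
    fromℤ-mul-pos m -[1+ n ] = trans (reflexive (≡.cong fromℤ (≡.sym (ℤₚ.neg-distribʳ-* (+ m) (+ suc n)))))
      (trans (fromℤ-neg (+ m ℤ.* + suc n)) (trans (-‿cong (trans (fromℤ-mul-pos m (+ suc n)) (*-congˡ (fromℤ-+ (suc n))))) (-‿distribʳ-* _ _)))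

    fromℤ-mul : ∀ i j → fromℤ (i ℤ.* j) ≈ fromℤ i * fromℤ j
    fromℤ-mul (+ m) j = trans (fromℤ-mul-pos m j) (*-congʳ (sym (fromℤ-+ m)))
    fromℤ-mul -[1+ m ] j = trans (reflexive (≡.cong fromℤ (≡.sym (ℤₚ.neg-distribˡ-* (+ suc m) j))))
      (trans (fromℤ-neg (+ suc m ℤ.* j)) (trans (-‿cong (fromℤ-mul-pos (suc m) j)) (-‿distribˡ-* _ _)))

    private
      isZeroℤ : ℤ → Bool
      isZeroℤ (+ 0) = true
      isZeroℤ _ = false

      homo : Homomorphism 0ℓ 0ℓ 0ℓ 0ℓ
      homo = record
        { from = record { rawRing = CommutativeRing.rawRing ℤₚ.+-*-commutativeRing ; isZero = isZeroℤ }
        ; to = fromCommutativeRing ℝring (λ _ → nothing)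
        ; morphism = record { ⟦_⟧ = fromℤ ; +-homo = fromℤ-add ; *-homo = fromℤ-mul ; -‿homo = fromℤ-neg ; 0-homo = refl ; 1-homo = refl }
        ; Zero-C⟶Zero-R = λ { (+ 0) _ → refl } }

    open Eval rawRing fromℤ
    open import Tactic.RingSolver.Core.Polynomial.Base (Homomorphism.from homo)
    open import Tactic.RingSolver.Core.Polynomial.Semantics homo renaming (⟦_⟧ to ⟦_⟧ₚ)
    open import Tactic.RingSolver.Core.Polynomial.Homomorphism homo

    norm : ∀ {n} → Expr ℤ n → Poly n
    norm (Κ x)   = κ x
    norm (Ι x)   = ι x
    norm (x ⊕ y) = norm x ⊞ norm y
    norm (x ⊗ y) = norm x ⊠ norm y
    norm (⊝ x)   = ⊟ norm x
    norm (x ⊛ i) = norm x ⊡ i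

    norm-correct : ∀ {n} (e : Expr ℤ n) ρ → ⟦ norm e ⟧ₚ ρ ≈ ⟦ e ⟧ ρ
    norm-correct (Κ x)   ρ = κ-hom x ρ
    norm-correct (Ι x)   ρ = ι-hom x ρ
    norm-correct (x ⊕ y) ρ = trans (⊞-hom (norm x) (norm y) ρ) (+-cong (norm-correct x ρ) (norm-correct y ρ))
    norm-correct (x ⊗ y) ρ = trans (⊠-hom (norm x) (norm y) ρ) (*-cong (norm-correct x ρ) (norm-correct y ρ))
    norm-correct (⊝ x)   ρ = trans (⊟-hom (norm x) ρ) (-‿cong (norm-correct x ρ))
    norm-correct (x ⊛ i) ρ = trans (⊡-hom (norm x) i ρ) (^-cong i)
      where
      open import Algebra.Properties.Semiring.Exp.TCOptimised semiring using (^-congˡ)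
      ^-cong : ∀ i → _
      ^-cong i = ^-congˡ i (norm-correct x ρ)

    open Syntax using (Term; Relation; Sequent; _⊢_≼_; variables; slacks; nth; Certificate; product; combination)

    -- Solver results are abstract: unfolding them would make the type checker normalise polynomials over open terms.
    abstract
      ring-equation : ∀ {n} (ρ : Vec Carrier n) (l r : Expr ℤ n) → norm l ≡ norm r → ⟦ l ⟧ ρ ≈ ⟦ r ⟧ ρ
      ring-equation ρ l r h = trans (sym (norm-correct l ρ)) (trans (reflexive (≡.cong (λ p → ⟦ p ⟧ₚ ρ) h)) (norm-correct r ρ))

    ForAll : ∀ n → (Vec Carrier n → Set) → Set
    ForAll zero P = P []
    ForAll (suc n) P = ∀ x → ForAll n (λ ρ → P (x ∷ ρ))

    for-all : ∀ n {P : Vec Carrier n → Set} → (∀ ρ → P ρ) → ForAll n P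
    for-all zero h = h []
    for-all (suc n) h x = for-all n (λ ρ → h (x ∷ ρ))

    identity : ∀ n (f : N-ary n (Term n) (Relation n)) → let l = Syntax.lhs (f $ⁿ variables n) ; r = Syntax.rhs (f $ⁿ variables n) in
               norm l ≡ norm r → ForAll n (λ ρ → ⟦ l ⟧ ρ ≈ ⟦ r ⟧ ρ)
    identity n f h = for-all n λ ρ → ring-equation ρ (Syntax.lhs (f $ⁿ variables n)) (Syntax.rhs (f $ⁿ variables n)) h

    -≥0 : ∀ {x y} → x ≤ y → 0# ≤ y - x
    -≥0 {x} {y} h = ≤-respˡ (-‿inverseʳ x) (+-monoˡ-≤ (- x) h)

    ≥0- : ∀ {x y} → 0# ≤ y - x → x ≤ y
    ≥0- {x} {y} h = ≤-respˡ (+-identityˡ x) (≤-respʳ (trans (+-assoc _ _ _) (trans (+-congˡ (-‿inverseˡ x)) (+-identityʳ y))) (+-monoˡ-≤ x h))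

    +-mono-≤ : ∀ {a b c d} → a ≤ b → c ≤ d → a + c ≤ b + d
    +-mono-≤ {a} {b} {c} {d} h k = ≤-trans (+-monoˡ-≤ c h) (≤-respˡ (+-comm c b) (≤-respʳ (+-comm d b) (+-monoˡ-≤ b k)))

    +-nonneg : ∀ {a b} → 0# ≤ a → 0# ≤ b → 0# ≤ a + b
    +-nonneg h k = ≤-respˡ (+-identityʳ 0#) (+-mono-≤ h k)

    0≤1 : 0# ≤ 1#
    0≤1 with total 0# 1#
    ... | inj₁ h = h
    ... | inj₂ h = ≤-respʳ (trans (-1*x≈-x (- 1#)) (-‿involutive 1#)) (*-nonneg neg neg)
      where
      neg : 0# ≤ - 1#
      neg = ≤-respʳ (+-identityˡ _) (-≥0 h)

    0≤fromℕ : ∀ n → 0# ≤ fromℕ n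
    0≤fromℕ zero = ≤-refl
    0≤fromℕ (suc n) = +-nonneg 0≤1 (0≤fromℕ n)

    fromℕ-mono : ∀ {m n} → m ℕ.≤ n → fromℕ m ≤ fromℕ n
    fromℕ-mono {n = n} ℕ.z≤n = 0≤fromℕ n
    fromℕ-mono (ℕ.s≤s h) = +-mono-≤ ≤-refl (fromℕ-mono h)

    1≤fromℕ : ∀ {n} → 1 ℕ.≤ n → 1# ≤ fromℕ n
    1≤fromℕ h = ≤-respˡ (+-identityʳ 1#) (fromℕ-mono h)

    1≰0 : ¬ (1# ≤ 0#)
    1≰0 h = 0≉1 (antisym 0≤1 h)

    fromℕ-reflect : ∀ {m n} → fromℕ m ≤ fromℕ n → m ℕ.≤ n
    fromℕ-reflect {zero} h = ℕ.z≤n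
    fromℕ-reflect {suc m} {zero} h = ⊥-elim (1≰0 (≤-trans (1≤fromℕ {suc m} (ℕ.s≤s ℕ.z≤n)) h))
    fromℕ-reflect {suc m} {suc n} h = ℕ.s≤s (fromℕ-reflect (≥0- (≤-respʳ
      (trans (+-congˡ (sym (-‿+-comm 1# (fromℕ m)))) (trans (+-congʳ (+-comm 1# (fromℕ n))) (trans (+-assoc _ _ _)
        (+-congˡ (trans (sym (+-assoc _ _ _)) (trans (+-congʳ (-‿inverseʳ 1#)) (+-identityˡ _))))))) (-≥0 h))))

    -- The way back from real estimates to strict inequalities of cardinalities: the opposite weak
    -- inequality is refuted in the field.
    fromℕ-< : ∀ {m n} → ¬ (fromℕ m ≤ fromℕ n) → n ℕ.< m
    fromℕ-< h = ℕₚ.≰⇒> λ k → h (fromℕ-mono k)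

    0<⇒≉0 : ∀ {c} → 0# < c → ¬ (c ≈ 0#)
    0<⇒≉0 (_ , h) e = h (sym e)

    1≤⇒0< : ∀ {c} → 1# ≤ c → 0# < c
    1≤⇒0< h = ≤-trans 0≤1 h , λ e → 1≰0 (≤-respʳ (sym e) h)

    *-cancel-≈0 : ∀ {c x} → ¬ (c ≈ 0#) → c * x ≈ 0# → x ≈ 0#
    *-cancel-≈0 {c} {x} h e = trans (sym (*-identityˡ x)) (trans (*-congʳ (sym (trans (*-comm _ _) (⁻¹-inverse c h))))
      (trans (*-assoc _ _ _) (trans (*-congˡ e) (zeroʳ _))))

    -- Only totality of the order is at hand. In the case y ≤ x the product c (x - y) is both
    -- nonnegative and nonpositive, which forces x and y to be equal.
    *-cancelˡ-≤ : ∀ {c x y} → 0# < c → c * x ≤ c * y → x ≤ y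
    *-cancelˡ-≤ {c} {x} {y} (0≤c , c≉0) h with total x y
    ... | inj₁ k = k
    ... | inj₂ k = ≤-reflexive (trans (sym (+-identityˡ x)) (trans (+-congʳ (sym (-‿inverseʳ y))) (trans (+-assoc _ _ _)
          (trans (+-congˡ (trans (+-comm _ _) zero-diff)) (+-identityʳ y)))))
      where
      zero-diff : x - y ≈ 0#
      zero-diff = *-cancel-≈0 (λ e → c≉0 (sym e)) (antisym
        (≤-respˡ (sym (trans (distribˡ c x (- y)) (+-congˡ (sym (-‿distribʳ-* c y))))) (≤-respʳ (-‿inverseʳ (c * y)) (+-monoˡ-≤ (- (c * y)) h)))
        (*-nonneg 0≤c (-≥0 k)))

    *-cancel-nonneg : ∀ {c x} → 0# < c → 0# ≤ c * x → 0# ≤ x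
    *-cancel-nonneg h k = *-cancelˡ-≤ h (≤-respˡ (sym (zeroʳ _)) k)

    ⟦_⟧ᴿ : ∀ {n} → Relation n → Vec Carrier n → Set
    ⟦ a Syntax.≤ b ⟧ᴿ ρ = ⟦ a ⟧ ρ ≤ ⟦ b ⟧ ρ
    ⟦ a Syntax.≈ b ⟧ᴿ ρ = ⟦ a ⟧ ρ ≈ ⟦ b ⟧ ρ

    Holds : ∀ {n} → Vec Carrier n → List (Relation n) → Set
    Holds ρ [] = ⊤
    Holds ρ (h ∷ hs) = ⟦ h ⟧ᴿ ρ × Holds ρ hs

    Implies : ∀ {n} → Vec Carrier n → List (Relation n) → Set → Set
    Implies ρ [] G = G
    Implies ρ (h ∷ hs) G = ⟦ h ⟧ᴿ ρ → Implies ρ hs G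

    implies : ∀ {n} (ρ : Vec Carrier n) hs {G} → (Holds ρ hs → G) → Implies ρ hs G
    implies ρ [] k = k tt
    implies ρ (h ∷ hs) k p = implies ρ hs (λ ps → k (p , ps))

    nth-nonneg : ∀ {n} (ρ : Vec Carrier n) hs → Holds ρ hs → ∀ i → 0# ≤ ⟦ nth (slacks hs) i ⟧ ρ
    nth-nonneg ρ [] h i = ≤-refl
    nth-nonneg ρ ((_ Syntax.≤ _) ∷ hs) (p , h) zero = -≥0 p
    nth-nonneg ρ ((_ Syntax.≤ _) ∷ hs) (p , h) (suc i) = nth-nonneg ρ hs h i
    nth-nonneg ρ ((_ Syntax.≈ _) ∷ hs) (p , h) zero = -≥0 (≤-reflexive p)
    nth-nonneg ρ ((_ Syntax.≈ _) ∷ hs) (p , h) (suc zero) = -≥0 (≤-reflexive (sym p))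
    nth-nonneg ρ ((_ Syntax.≈ _) ∷ hs) (p , h) (suc (suc i)) = nth-nonneg ρ hs h i

    0≤fromℤ : ∀ k → 0# ≤ fromℤ (+ k)
    0≤fromℤ k = ≤-respʳ (sym (fromℤ-+ k)) (0≤fromℕ k)

    product-nonneg : ∀ {n} (ρ : Vec Carrier n) hs → Holds ρ hs → ∀ k is → 0# ≤ ⟦ product (slacks hs) k is ⟧ ρ
    product-nonneg ρ hs h k [] = 0≤fromℤ k
    product-nonneg ρ hs h k (i ∷ is) = *-nonneg (nth-nonneg ρ hs h i) (product-nonneg ρ hs h k is)

    combination-nonneg : ∀ {n} (ρ : Vec Carrier n) hs → Holds ρ hs → ∀ c → 0# ≤ ⟦ combination (slacks hs) c ⟧ ρ
    combination-nonneg ρ hs h [] = ≤-refl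
    combination-nonneg ρ hs h ((k , is) ∷ c) = +-nonneg (product-nonneg ρ hs h k is) (combination-nonneg ρ hs h c)

    abstract
      certified : ∀ {n} (ρ : Vec Carrier n) (hs : List (Relation n)) (l r : Term n) (d : ℕ) (c : Certificate) →
        norm (Κ (+ suc d) ⊗ (r ⊕ ⊝ l)) ≡ norm (combination (slacks hs) c) → Holds ρ hs → ⟦ l ⟧ ρ ≤ ⟦ r ⟧ ρ
      certified ρ hs l r d c e h = ≥0- (*-cancel-nonneg (1≤⇒0< (≤-respʳ (sym (fromℤ-+ (suc d))) (1≤fromℕ {suc d} (ℕ.s≤s ℕ.z≤n))))
        (≤-respʳ (trans (sym (norm-correct (combination (slacks hs) c) ρ)) (trans (reflexive (≡.cong (λ p → ⟦ p ⟧ₚ ρ) (≡.sym e)))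
            (norm-correct (Κ (+ suc d) ⊗ (r ⊕ ⊝ l)) ρ)))
          (combination-nonneg ρ hs h c)))

    -- A Positivstellensatz certificate: (1 + d) (upper - lower) is the given combination of products of slacks of the
    -- hypotheses, an equation having two slacks.
    certify : ∀ n (f : N-ary n (Term n) (Sequent n)) (d : ℕ) (c : Certificate) →
      let open Sequent (f $ⁿ variables n) in
      norm (Κ (+ suc d) ⊗ (upper ⊕ ⊝ lower)) ≡ norm (combination (slacks hyps) c) →
      ForAll n (λ ρ → Implies ρ hyps (⟦ lower ⟧ ρ ≤ ⟦ upper ⟧ ρ))
    certify n f d c e = for-all n λ ρ → implies ρ hyps (certified ρ hyps lower upper d c e)
      where open Sequent (f $ⁿ variables n)

  module Certificates (R : CompleteOrderedField) where
    open Syntax public using (#_; _+_; _*_; _-_; _≤_; _≈_; _⊢_≼_)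
    open OrderedField R public using (certify; identity)

-- Lovász's form of Kruskal-Katona with a real parameter.

module LovászBound where
  open Families
  open InitialSegments using (Pascal)
  open RealArithmetic
  open import Algebra.Properties.CommutativeSemigroup ℕₚ.+-commutativeSemigroup using (interchange)
  open ℕₚ using (_!≢0)
  open import Data.Nat.Combinatorics using (nC1≡n)

  sumℕ : ∀ {n} → (Fin n → ℕ) → ℕ
  sumℕ {zero} f = 0
  sumℕ {suc n} f = f zero ℕ.+ sumℕ (f ∘ suc)

  sumℕ-+ : ∀ {n} (f g : Fin n → ℕ) → sumℕ (λ v → f v ℕ.+ g v) ≡ sumℕ f ℕ.+ sumℕ g
  sumℕ-+ {zero} f g = ≡.refl
  sumℕ-+ {suc n} f g = ≡.trans (≡.cong (f zero ℕ.+ g zero ℕ.+_) (sumℕ-+ (f ∘ suc) (g ∘ suc))) (interchange (f zero) _ _ _)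

  sumℕ-cong : ∀ {n} {f g : Fin n → ℕ} → (∀ v → f v ≡ g v) → sumℕ f ≡ sumℕ g
  sumℕ-cong {zero} h = ≡.refl
  sumℕ-cong {suc n} h = ≡.cong₂ ℕ._+_ (h zero) (sumℕ-cong (h ∘ suc))

  sumℕ-witness : ∀ {n} (f : Fin n → ℕ) → 1 ℕ.≤ sumℕ f → ∃ λ v → 1 ℕ.≤ f v
  sumℕ-witness {suc n} f h with f zero in eq
  ... | suc _ = zero , ≡.subst (1 ℕ.≤_) (≡.sym eq) (ℕ.s≤s ℕ.z≤n)
  ... | zero = let (v , p) = sumℕ-witness (f ∘ suc) h in suc v , p

  -- Double counting of incident pairs of a vertex and a set, carried out by induction on the ground
  -- set.
  sum-link : ∀ {n} k {F : Family n} → Uniform k F → sumℕ (λ v → card (link v F)) ≡ k ℕ.* card F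
  sum-link {zero} zero u = ≡.refl
  sum-link {zero} (suc k) {F} u = ≡.sym (≡.trans (≡.cong (suc k ℕ.*_) (card-empty empty)) (ℕₚ.*-zeroʳ (suc k)))
    where
    empty : ∀ X → ¬ T (F X)
    empty [] p with u [] p
    ... | ()
  sum-link {suc n} zero {F} u = ≡.trans (sumℕ-cong {g = λ _ → 0} none) (zeros n)
    where
    none : ∀ v → card (link v F) ≡ 0
    none v = card-empty λ X p → ℕₚ.1+n≢0 (≡.trans (≡.sym (size-insert v X (link-∉ v F X p))) (u (insert v X) (∧-fst p)))
    zeros : ∀ n → sumℕ {suc n} (λ _ → 0) ≡ 0
    zeros zero = ≡.refl
    zeros (suc n) = zeros n
  sum-link {suc n} (suc k) {F} u = begin
    card (link zero F) ℕ.+ sumℕ (λ v → card (link (suc v) F))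
      ≡⟨ ≡.cong₂ ℕ._+_ first (≡.trans (sumℕ-cong (λ v → card-suc (link (suc v) F))) (sumℕ-+ (λ v → card (link v F₀)) (λ v → card (link v F₁)))) ⟩
    card F₁ ℕ.+ (sumℕ (λ v → card (link v F₀)) ℕ.+ sumℕ (λ v → card (link v F₁)))
      ≡⟨ ≡.cong (card F₁ ℕ.+_) (≡.cong₂ ℕ._+_ (sum-link (suc k) (λ X → u (false ∷ X))) (sum-link k (λ X p → ℕₚ.suc-injective (u (true ∷ X) p)))) ⟩
    card F₁ ℕ.+ (suc k ℕ.* card F₀ ℕ.+ k ℕ.* card F₁)
      ≡⟨ ≡.trans (≡.sym (ℕₚ.+-assoc (card F₁) _ _)) (≡.trans (≡.cong (ℕ._+ k ℕ.* card F₁) (ℕₚ.+-comm (card F₁) _)) (ℕₚ.+-assoc (suc k ℕ.* card F₀) _ _)) ⟩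
    suc k ℕ.* card F₀ ℕ.+ suc k ℕ.* card F₁ ≡⟨ ℕₚ.*-distribˡ-+ (suc k) (card F₀) (card F₁) ⟨
    suc k ℕ.* (card F₀ ℕ.+ card F₁) ≡⟨ ≡.cong (suc k ℕ.*_) (card-suc F) ⟨
    suc k ℕ.* card F ∎
    where
    open ≡.≡-Reasoning
    F₀ = F ∘ (false ∷_)
    F₁ = F ∘ (true ∷_)
    first : card (link zero F) ≡ card F₁
    first = ≡.trans (card-suc (link zero F)) (≡.trans (≡.cong₂ ℕ._+_
      (card-ext {F = link zero F ∘ (false ∷_)} {G = F₁} (λ X p → ∧-fst p) (λ X p → ∧-intro p tt))
      (card-empty {F = link zero F ∘ (true ∷_)} (λ X p → ∧-snd {F (true ∷ X)} p))) (ℕₚ.+-identityʳ _))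

  absorption : ∀ n k → suc k ℕ.* (suc n C suc k) ≡ suc n ℕ.* (n C k)
  absorption n zero = ≡.trans (ℕₚ.*-identityˡ _) (≡.trans (nC1≡n (suc n)) (≡.sym (ℕₚ.*-identityʳ (suc n))))
  absorption zero (suc k) = ℕₚ.*-zeroʳ (suc (suc k))
  absorption (suc n) (suc k) = begin
    suc (suc k) ℕ.* (suc (suc n) C suc (suc k)) ≡⟨ ≡.cong (suc (suc k) ℕ.*_) (Pascal (suc n) (suc k)) ⟨
    suc (suc k) ℕ.* (a ℕ.+ b) ≡⟨ ℕₚ.*-distribˡ-+ (suc (suc k)) a b ⟩
    (a ℕ.+ suc k ℕ.* a) ℕ.+ suc (suc k) ℕ.* b ≡⟨ ≡.cong₂ (λ x y → (a ℕ.+ x) ℕ.+ y) (absorption n k) (absorption n (suc k)) ⟩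
    (a ℕ.+ suc n ℕ.* (n C k)) ℕ.+ suc n ℕ.* (n C suc k) ≡⟨ ℕₚ.+-assoc a _ _ ⟩
    a ℕ.+ (suc n ℕ.* (n C k) ℕ.+ suc n ℕ.* (n C suc k)) ≡⟨ ≡.cong (a ℕ.+_) (ℕₚ.*-distribˡ-+ (suc n) (n C k) (n C suc k)) ⟨
    a ℕ.+ suc n ℕ.* (n C k ℕ.+ n C suc k) ≡⟨ ≡.cong (λ x → a ℕ.+ suc n ℕ.* x) (Pascal n k) ⟩
    suc (suc n) ℕ.* a ∎
    where
    open ≡.≡-Reasoning
    a = suc n C suc k
    b = suc n C suc (suc k)

  nCk>0 : ∀ q r → 1 ℕ.≤ (q ℕ.+ r) C r
  nCk>0 q zero = ℕₚ.≤-refl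
  nCk>0 q (suc r) rewrite ℕₚ.+-suc q r = ℕₚ.≤-trans (nCk>0 q r) (ℕₚ.≤-trans (ℕₚ.m≤m+n _ _) (ℕₚ.≤-reflexive (Pascal (q ℕ.+ r) r)))

  module LovászCertificates (R : CompleteOrderedField) where
    open Certificates R

    cancel-tail = certify 4 (λ a b c d →
      a + b ≤ c + d ∷ d ≤ b ∷ [] ⊢
      a ≼ c)
      0 ((1 , 0 ∷ []) ∷ (1 , 1 ∷ []) ∷ []) ≡.refl
    cancel-head = certify 4 (λ a b c d →
      a + b ≤ c + d ∷ c ≤ a ∷ [] ⊢
      b ≼ d)
      0 ((1 , 0 ∷ []) ∷ (1 , 1 ∷ []) ∷ []) ≡.refl
    scale = certify 3 (λ a b c →
      # 0 ≤ c ∷ a ≤ b ∷ [] ⊢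
      c * a ≼ c * b)
      0 ((1 , 0 ∷ 1 ∷ []) ∷ []) ≡.refl
    lovasz-high = certify 7 (λ p f r h d K D →
      # 0 ≤ f ∷ f * r * h ≤ D * (p + r) ∷ D ≤ f * d ∷ # 0 ≤ p + r ∷ K + d ≤ h ∷ # 0 ≤ r ∷ [] ⊢
      f * (r * K) ≼ f * (p * d))
      0 ((1 , 0 ∷ 4 ∷ 5 ∷ []) ∷ (1 , 1 ∷ []) ∷ (1 , 2 ∷ 3 ∷ []) ∷ []) ≡.refl
    factorial-step = identity 3 (λ a b c → a * b * c ≈ b * a * c) ≡.refl
    left-comm = identity 3 (λ a b c → a * (b * c) ≈ b * (a * c)) ≡.refl
    neg² = identity 1 (λ x → (# 0 - x) * (# 0 - x) ≈ x * x) ≡.refl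
    bernoulli-step = certify 3 (λ u m w →
      # 0 ≤ u ∷ # 1 - m * (# 1 - u) ≤ w ∷ # 0 ≤ m ∷ # 0 ≤ (# 1 - u) * (# 1 - u) ∷ [] ⊢
      # 1 - (# 1 + m) * (# 1 - u) ≼ w * u)
      0 ((1 , 0 ∷ 1 ∷ []) ∷ (1 , 2 ∷ 3 ∷ []) ∷ []) ≡.refl
    regroup = identity 2 (λ x u → x * x * (u * u) ≈ x * u * (x * u)) ≡.refl
    rising-scale-step = certify 6 (λ W w X u x i →
      w * X ≤ W ∷ # 0 ≤ x * u + i ∷ # 0 ≤ w ∷ # 0 ≤ X ∷ u ≤ # 1 ∷ # 0 ≤ i ∷ [] ⊢
      w * u * (X * (x + i)) ≼ W * (x * u + i))
      0 ((1 , 0 ∷ 1 ∷ []) ∷ (1 , 2 ∷ 3 ∷ 4 ∷ 5 ∷ []) ∷ []) ≡.refl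
    sum-swap = identity 4 (λ a b c d → a + b + (c + d) ≈ a + c + (b + d)) ≡.refl
    bernoulli-zero = identity 1 (λ u → # 1 - # 0 * (# 1 - u) ≈ # 1) ≡.refl

  module Lovász (R : CompleteOrderedField) where
    open CompleteOrderedField R hiding (zero)
    open OrderedField R
    open LovászCertificates R

    ⟨_⟩ : ℕ → Carrier
    ⟨_⟩ = fromℕ

    -- The product (p + 1) ... (p + r), that is, r! C(p + r, r). Parametrising by p = x - r is
    -- convenient because p stays fixed when a family is replaced by a link.
    rising : Carrier → ℕ → Carrier
    rising p zero = 1#
    rising p (suc r) = rising p r * (p + ⟨ suc r ⟩)

    sum : ∀ {n} → (Fin n → Carrier) → Carrier
    sum {zero} f = 0#
    sum {suc n} f = f zero + sum (f ∘ suc)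

    sum-mono : ∀ {n} {f g : Fin n → Carrier} → (∀ v → f v ≤ g v) → sum f ≤ sum g
    sum-mono {zero} h = ≤-refl
    sum-mono {suc n} h = +-mono-≤ (h zero) (sum-mono (h ∘ suc))

    sum-fromℕ : ∀ {n} c (f : Fin n → ℕ) → sum (λ v → c * ⟨ f v ⟩) ≈ c * ⟨ sumℕ f ⟩
    sum-fromℕ {zero} c f = sym (zeroʳ c)
    sum-fromℕ {suc n} c f = trans (+-congˡ (sum-fromℕ c (f ∘ suc))) (trans (sym (distribˡ c _ _)) (*-congˡ (sym (fromℕ-+ (f zero) (sumℕ (f ∘ suc))))))

    sum-+ : ∀ {n} (f g : Fin n → Carrier) → sum (λ v → f v + g v) ≈ sum f + sum g
    sum-+ {zero} f g = sym (+-identityˡ 0#)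
    sum-+ {suc n} f g = trans (+-congˡ (sum-+ (f ∘ suc) (g ∘ suc))) (sum-swap (f zero) (g zero) _ _)

    sum-tight : ∀ {n} (f g : Fin n → Carrier) → (∀ v → f v ≤ g v) → sum g ≤ sum f → ∀ v → g v ≤ f v
    sum-tight f g h k zero = cancel-tail _ _ _ _ k (sum-mono (h ∘ suc))
    sum-tight f g h k (suc v) = sum-tight (f ∘ suc) (g ∘ suc) (h ∘ suc) (cancel-head _ _ _ _ k (h zero)) v

    -- Weighted pigeonhole, without deciding strict inequalities: either a good index turns up, or all terms are tight.
    choose-index : ∀ {n} (w : Fin n → ℕ) (f g : Fin n → Carrier) → (∀ v → w v ≡ 0 → f v ≤ g v) → sum g ≤ sum f → 1 ℕ.≤ sumℕ w →
                   ∃ λ v → 1 ℕ.≤ w v × g v ≤ f v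
    choose-index {n} w f g z h pos with search w f g z
      where
      search : ∀ {n} (w : Fin n → ℕ) (f g : Fin n → Carrier) → (∀ v → w v ≡ 0 → f v ≤ g v) →
               (∃ λ v → 1 ℕ.≤ w v × g v ≤ f v) ⊎ (∀ v → f v ≤ g v)
      search {zero} w f g z = inj₂ λ ()
      search {suc n} w f g z with search (w ∘ suc) (f ∘ suc) (g ∘ suc) (z ∘ suc)
      ... | inj₁ (v , p) = inj₁ (suc v , p)
      ... | inj₂ rest with w zero in eq
      ... | zero = inj₂ λ { zero → z zero eq ; (suc v) → rest v }
      ... | suc _ with total (g zero) (f zero)
      ... | inj₁ ok = inj₁ (zero , ≡.subst (1 ℕ.≤_) (≡.sym eq) (ℕ.s≤s ℕ.z≤n) , ok)
      ... | inj₂ le = inj₂ λ { zero → le ; (suc v) → rest v }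
    ... | inj₁ found = found
    ... | inj₂ all = let (v , p) = sumℕ-witness w pos in v , p , sum-tight f g all h v

    *-mono-≤ˡ : ∀ {a b c} → 0# ≤ c → a ≤ b → c * a ≤ c * b
    *-mono-≤ˡ {a} {b} {c} h k = scale a b c h k

    positive : ∀ {n} → 1 ℕ.≤ n → 0# < ⟨ n ⟩
    positive h = 1≤⇒0< (1≤fromℕ h)

    !-positive : ∀ r → 0# < ⟨ r ! ⟩
    !-positive r = positive (ℕ.>-nonZero⁻¹ _ {{r !≢0}})

    -- Keevash's proof of Lovász's theorem: a vertex of large degree satisfies K(v) + d(v) ≤ |∂G|, one of small degree is
    -- handled by induction, and both give (ρ+1) K(v) ≤ p d(v).  The first alternative says |∂G| ≥ C(p + ρ, ρ).
    lovász : ∀ {n} p ρ (G : Family n) → 0# ≤ p → Uniform (suc ρ) G →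
             rising p ρ ≤ ⟨ ρ ! ⟩ * ⟨ card (∂ G) ⟩ ⊎ ⟨ suc ρ ⟩ * ⟨ card G ⟩ ≤ p * ⟨ card (∂ G) ⟩
    lovász p zero G 0≤p u with card (∂ G) in eq
    ... | suc h = inj₁ (≤-respʳ (sym (trans (*-congʳ (+-identityʳ 1#)) (*-identityˡ _))) (1≤fromℕ {suc h} (ℕ.s≤s ℕ.z≤n)))
    ... | zero = inj₂ (≤-reflexive (trans (*-congˡ (reflexive (≡.cong ⟨_⟩ (card-empty none)))) (trans (zeroʳ _) (sym (zeroʳ p)))))
      where
      none : ∀ X → ¬ T (G X)
      none X q with 1≤size X (u X q)
        where
        1≤size : ∀ {n} (X : Subset n) → ∣ X ∣ ≡ 1 → ∃ λ v → Vec.lookup X v ≡ true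
        1≤size (true ∷ X) e = zero , ≡.refl
        1≤size (false ∷ X) e = let (v , p) = 1≤size X e in suc v , p
      ... | v , e = ℕₚ.<⇒≱ (card-≥1 {F = ∂ G} (erase v X) (∂-erase G v X e q)) (ℕₚ.≤-reflexive eq)
    lovász {n} p (suc ρ) G 0≤p u with total (rising p (suc ρ)) (⟨ suc ρ ! ⟩ * ⟨ card (∂ G) ⟩)
    ... | inj₁ big = inj₁ big
    ... | inj₂ small = inj₂ (*-cancelˡ-≤ (positive {suc ρ} (ℕ.s≤s ℕ.z≤n)) summed)
      where
      h = ⟨ card (∂ G) ⟩
      K d : Fin n → ℕ
      K v = card (link v G)
      d v = card (link v (∂ G))
      sub : ∀ v → card (∂ (link v G)) ℕ.≤ d v
      sub v = card-mono (∂-link v G)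
      per-vertex : ∀ v → ⟨ suc ρ ⟩ * ⟨ K v ⟩ ≤ p * ⟨ d v ⟩
      per-vertex v with lovász p ρ (link v G) 0≤p (link-uniform v u)
      ... | inj₂ ok = ≤-trans ok (*-mono-≤ˡ 0≤p (fromℕ-mono (sub v)))
      -- Together `small` and `high` give (ρ + 1) |∂G| ≤ (p + ρ + 1) d(v); subtracting (ρ + 1) d(v)
      -- leaves room for K(v) on the left.
      ... | inj₁ high = *-cancelˡ-≤ (!-positive ρ) (lovasz-high p ⟨ ρ ! ⟩ ⟨ suc ρ ⟩ h ⟨ d v ⟩ ⟨ K v ⟩ (rising p ρ)
            (0≤fromℕ (ρ !)) (≤-respˡ (trans (*-congʳ (fromℕ-* (suc ρ) (ρ !))) (factorial-step _ _ _)) small)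
            (≤-trans high (*-mono-≤ˡ (0≤fromℕ (ρ !)) (fromℕ-mono (sub v))))
            (+-nonneg 0≤p (0≤fromℕ (suc ρ)))
            (≤-respˡ (fromℕ-+ (K v) (d v)) (fromℕ-mono (card-link+link v {F = G} (λ X q → q))))
            (0≤fromℕ (suc ρ)))
      summed : ⟨ suc ρ ⟩ * (⟨ suc (suc ρ) ⟩ * ⟨ card G ⟩) ≤ ⟨ suc ρ ⟩ * (p * h)
      summed = ≤-respˡ (trans (sum-fromℕ ⟨ suc ρ ⟩ K) (*-congˡ (trans (reflexive (≡.cong ⟨_⟩ (sum-link (suc (suc ρ)) u))) (fromℕ-* (suc (suc ρ)) (card G)))))
        (≤-respʳ (trans (sum-fromℕ p d) (trans (*-congˡ (trans (reflexive (≡.cong ⟨_⟩ (sum-link (suc ρ) (∂-uniform u)))) (fromℕ-* (suc ρ) (card (∂ G))))) (left-comm p ⟨ suc ρ ⟩ h)))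
          (sum-mono per-vertex))

    power : Carrier → ℕ → Carrier
    power u zero = 1#
    power u (suc m) = power u m * u

    0≤square : ∀ x → 0# ≤ x * x
    0≤square x with total 0# x
    ... | inj₁ h = *-nonneg h h
    ... | inj₂ h = ≤-respʳ (neg² x) (*-nonneg (-≥0 h) (-≥0 h))

    bernoulli : ∀ u m → 0# ≤ u → 1# - ⟨ m ⟩ * (1# - u) ≤ power u m
    bernoulli u zero h = ≤-reflexive (bernoulli-zero u)
    bernoulli u (suc m) h = bernoulli-step u ⟨ m ⟩ (power u m) h (bernoulli u m h) (0≤fromℕ m) (0≤square (1# - u))

    power-nonneg : ∀ u m → 0# ≤ u → 0# ≤ power u m
    power-nonneg u zero h = 0≤1
    power-nonneg u (suc m) h = *-nonneg (power-nonneg u m h) h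

    power-* : ∀ u m → power (u * u) m ≈ power u m * power u m
    power-* u zero = sym (*-identityˡ 1#)
    power-* u (suc m) = trans (*-congʳ (power-* u m)) (regroup (power u m) u)

    rising-nonneg : ∀ p r → 0# ≤ p → 0# ≤ rising p r
    rising-nonneg p zero h = 0≤1
    rising-nonneg p (suc r) h = *-nonneg (rising-nonneg p r h) (+-nonneg h (0≤fromℕ (suc r)))

    -- Factor by factor, u (x + i) ≤ x u + i. With Bernoulli's inequality this shows that lowering
    -- the parameter slightly costs only a controlled fraction of the binomial coefficient.
    rising-scale : ∀ x u m → 0# ≤ x → 0# ≤ u → u ≤ 1# → power u m * rising x m ≤ rising (x * u) m
    rising-scale x u zero _ _ _ = ≤-reflexive (*-identityˡ 1#)
    rising-scale x u (suc m) 0≤x 0≤u u≤1 = rising-scale-step (rising (x * u) m) (power u m) (rising x m) u x ⟨ suc m ⟩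
      (rising-scale x u m 0≤x 0≤u u≤1) (+-nonneg (*-nonneg 0≤x 0≤u) (0≤fromℕ (suc m))) (power-nonneg u m 0≤u) (rising-nonneg x m 0≤x)
      u≤1 (0≤fromℕ (suc m))

    rising-binomial : ∀ q r → rising ⟨ q ⟩ r ≈ ⟨ r ! ⟩ * ⟨ (q ℕ.+ r) C r ⟩
    rising-binomial q zero = sym (trans (*-congʳ (+-identityʳ 1#)) (trans (*-identityˡ _) (+-identityʳ 1#)))
    rising-binomial q (suc r) = begin
      rising ⟨ q ⟩ r * (⟨ q ⟩ + ⟨ suc r ⟩) ≈⟨ *-cong (rising-binomial q r) (trans (sym (fromℕ-+ q (suc r))) (reflexive (≡.cong ⟨_⟩ (ℕₚ.+-suc q r)))) ⟩
      ⟨ r ! ⟩ * c * ⟨ suc (q ℕ.+ r) ⟩ ≈⟨ trans (*-assoc _ _ _) (*-congˡ (trans (*-comm _ _) (sym (fromℕ-* (suc (q ℕ.+ r)) ((q ℕ.+ r) C r))))) ⟩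
      ⟨ r ! ⟩ * ⟨ suc (q ℕ.+ r) ℕ.* ((q ℕ.+ r) C r) ⟩ ≈⟨ *-congˡ (trans (reflexive (≡.cong ⟨_⟩ (≡.sym (absorption (q ℕ.+ r) r)))) (fromℕ-* (suc r) (suc (q ℕ.+ r) C suc r))) ⟩
      ⟨ r ! ⟩ * (⟨ suc r ⟩ * ⟨ suc (q ℕ.+ r) C suc r ⟩) ≈⟨ trans (sym (*-assoc _ _ _)) (*-cong (trans (*-comm _ _) (sym (fromℕ-* (suc r) (r !)))) (reflexive (≡.cong (λ m → ⟨ m C suc r ⟩) (≡.sym (ℕₚ.+-suc q r))))) ⟩
      ⟨ suc r ! ⟩ * ⟨ (q ℕ.+ suc r) C suc r ⟩ ∎
      where
      open import Relation.Binary.Reasoning.Setoid setoid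
      c = ⟨ (q ℕ.+ r) C r ⟩

-- A sharpened Lovász bound for families with small shadow.

module LovászGap where
  open Families
  open RealArithmetic
  open LovászBound
  open import Data.Fin.Subset.Properties using (∣⊥∣≡0)
  open import Data.Vec.Properties using (lookup-replicate)

  singletons-within : ∀ {n} q {F : Family n} → Uniform 1 F → q ℕ.≤ card F →
    ∃ λ S → ∣ S ∣ ≡ q × (∀ w → lookup S w ≡ true → T (F (insert w ⊥)))
  singletons-within {zero} zero u h = [] , ≡.refl , λ ()
  singletons-within {zero} (suc q) {F} u h with card-witness F (ℕₚ.≤-trans (ℕ.s≤s ℕ.z≤n) h)
  ... | [] , p with u [] p
  ... | ()
  singletons-within {suc n} zero u h = false ∷ ⊥ , ∣⊥∣≡0 n , λ { (suc w) e → true≢false e (lookup-replicate w false) }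
  singletons-within {suc n} (suc q) {F} u h with T? (F (true ∷ ⊥))
  ... | inj₁ p with singletons-within q {F ∘ (false ∷_)} (λ X → u (false ∷ X)) (ℕₚ.≤-pred (ℕₚ.≤-trans h (ℕₚ.≤-trans (ℕₚ.≤-reflexive (card-suc F))
        (ℕₚ.≤-trans (ℕₚ.+-monoʳ-≤ (card (F ∘ (false ∷_))) (card-uniform₀ (λ X p → ℕₚ.suc-injective (u (true ∷ X) p)))) (ℕₚ.≤-reflexive (ℕₚ.+-comm _ 1))))))
  ... | S , e , all = true ∷ S , ≡.cong suc e , λ { zero _ → p ; (suc w) → all w }
  singletons-within {suc n} (suc q) {F} u h | inj₂ p with singletons-within (suc q) {F ∘ (false ∷_)} (λ X → u (false ∷ X))
      (ℕₚ.≤-trans h (ℕₚ.≤-reflexive (≡.trans (card-suc F) (≡.trans (≡.cong (card (F ∘ (false ∷_)) ℕ.+_)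
        (card-empty {F = F ∘ (true ∷_)} λ X r → not⇒¬T p (≡.subst (λ Y → T (F (true ∷ Y))) (∣⊥∣₀ X (ℕₚ.suc-injective (u (true ∷ X) r))) r))) (ℕₚ.+-identityʳ _)))))
  ... | S , e , all = false ∷ S , e , λ { (suc w) → all w }

  singleton-form : ∀ {n} (X : Subset n) → ∣ X ∣ ≡ 1 → ∃ λ w → lookup X w ≡ true × X ≡ insert w ⊥
  singleton-form (true ∷ X) e = zero , ≡.refl , ≡.cong (true ∷_) (∣⊥∣₀ X (ℕₚ.suc-injective e))
  singleton-form (false ∷ X) e = let (w , p , q) = singleton-form X e in suc w , p , ≡.cong (false ∷_) q

  module GapCertificates (R : CompleteOrderedField) where
    open Certificates R

    gap-power = certify 4 (λ t u j w →
      # 4 * t * u ≈ # 4 * t - # 3 ∷ t ≈ j + # 2 ∷ # 0 ≤ j ∷ # 1 - j * (# 1 - u) ≤ w ∷ # 0 ≤ t ∷ [] ⊢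
      t * # 1 ≼ t * (# 4 * w))
      1 ((12 , []) ∷ (2 , 1 ∷ 4 ∷ []) ∷ (3 , 2 ∷ 3 ∷ []) ∷ (3 , 2 ∷ 4 ∷ []) ∷ (3 , 3 ∷ 6 ∷ []) ∷ (8 , 5 ∷ 6 ∷ []) ∷ []) ≡.refl
    gap-square = certify 2 (λ t u →
      # 4 * t * u ≈ # 4 * t - # 3 ∷ # 2 ≤ t ∷ # 0 ≤ u ∷ [] ⊢
      # 16 * t * t * (# 5 * t * (u * u)) ≼ # 16 * t * t * (# 5 * t - # 6))
      0 ((6 , []) ∷ (50 , 0 ∷ []) ∷ (65 , 0 ∷ 2 ∷ []) ∷ (20 , 0 ∷ 2 ∷ 2 ∷ []) ∷ (20 , 0 ∷ 2 ∷ 2 ∷ 3 ∷ []) ∷ (80 , 0 ∷ 2 ∷ 3 ∷ []) ∷ (80 , 0 ∷ 3 ∷ []) ∷ (51 , 2 ∷ []) ∷ (24 , 2 ∷ 2 ∷ []) ∷ []) ≡.refl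
    gap-left = certify 5 (λ f N h w W →
      f * N * (w * w) ≤ W ∷ W ≤ f * h ∷ # 1 ≤ # 4 * w ∷ # 0 ≤ f ∷ # 0 ≤ N ∷ # 20 * h ≤ N ∷ [] ⊢
      f * (# 5 * N) ≼ f * (# 4 * N))
      0 ((80 , 0 ∷ []) ∷ (80 , 1 ∷ []) ∷ (5 , 2 ∷ 2 ∷ 3 ∷ 4 ∷ []) ∷ (10 , 2 ∷ 3 ∷ 4 ∷ []) ∷ (4 , 3 ∷ 5 ∷ []) ∷ []) ≡.refl
    gap-right = certify 5 (λ j q u g h →
      (j + # 1) * g ≤ q * (u * u) * h ∷ # 5 * (j + # 2) * (u * u) ≤ # 5 * (j + # 2) - # 6 ∷ # 0 ≤ q ∷ # 0 ≤ h ∷ # 0 ≤ j ∷ [] ⊢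
      # 5 * (j + # 1) * (j + # 2) * g ≼ q * (# 5 * j + # 4) * h)
      0 ((10 , 0 ∷ []) ∷ (5 , 0 ∷ 4 ∷ []) ∷ (1 , 1 ∷ 2 ∷ 3 ∷ []) ∷ []) ≡.refl
    five-four = certify 1 (λ N →
      # 5 * N ≤ # 4 * N ∷ # 1 ≤ N ∷ [] ⊢
      # 1 ≼ # 0)
      0 ((1 , 0 ∷ []) ∷ (1 , 1 ∷ []) ∷ []) ≡.refl
    u-upper = certify 2 (λ t u →
      # 4 * t * u ≈ # 4 * t - # 3 ∷ [] ⊢
      t * u ≼ t * # 1)
      3 ((3 , []) ∷ (1 , 0 ∷ []) ∷ []) ≡.refl
    u-lower = certify 2 (λ t u →
      # 4 * t * u ≈ # 4 * t - # 3 ∷ # 2 ≤ t ∷ [] ⊢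
      t * # 0 ≼ t * u)
      3 ((5 , []) ∷ (1 , 1 ∷ []) ∷ (4 , 2 ∷ []) ∷ []) ≡.refl
    two≤ = certify 2 (λ t j →
      t ≈ j + # 2 ∷ # 0 ≤ j ∷ [] ⊢
      # 2 ≼ t)
      0 ((1 , 1 ∷ []) ∷ (1 , 2 ∷ []) ∷ []) ≡.refl
    one≤ = certify 1 (λ t →
      # 2 ≤ t ∷ [] ⊢
      # 1 ≼ t)
      0 ((1 , []) ∷ (1 , 0 ∷ []) ∷ []) ≡.refl
    one≤-square = certify 1 (λ t →
      # 2 ≤ t ∷ [] ⊢
      # 1 ≼ # 16 * t * t)
      0 ((63 , []) ∷ (64 , 0 ∷ []) ∷ (16 , 0 ∷ 0 ∷ []) ∷ []) ≡.refl

  module Gap (R : CompleteOrderedField) where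
    open CompleteOrderedField R hiding (zero)
    open OrderedField R
    open Lovász R
    open LovászCertificates R using (left-comm)
    open GapCertificates R

    -- Lovász's bound with p = q u², u = 1 - 3/(4(j+2)): then (j+2)/(j+1) p < q, while C(p + j, j) is still a constant
    -- fraction of C(q + j, j) by Bernoulli's inequality.
    gap : ∀ {n} q j (G : Family n) → Uniform (suc j) G → fromℕ 20 * ⟨ card (∂ G) ⟩ ≤ ⟨ (q ℕ.+ j) C j ⟩ →
          fromℕ 5 * (⟨ j ⟩ + 1#) * (⟨ j ⟩ + fromℕ 2) * ⟨ card G ⟩ ≤ ⟨ q ⟩ * (fromℕ 5 * ⟨ j ⟩ + fromℕ 4) * ⟨ card (∂ G) ⟩
    gap q j G unif few = finish (lovász (⟨ q ⟩ * (u * u)) j G (*-nonneg (0≤fromℕ q) (0≤square u)) unif)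
      where
      t u : Carrier
      t = ⟨ j ⟩ + fromℕ 2
      u = (fromℕ 4 * t - fromℕ 3) * ((fromℕ 4 * t) ⁻¹)
      2≤t : fromℕ 2 ≤ t
      2≤t = two≤ t ⟨ j ⟩ refl (0≤fromℕ j)
      0<t : 0# < t
      0<t = 1≤⇒0< (one≤ t 2≤t)
      4t≉0 : ¬ (fromℕ 4 * t ≈ 0#)
      4t≉0 e = proj₂ 0<t (sym (*-cancel-≈0 (0<⇒≉0 (positive {4} (ℕ.s≤s ℕ.z≤n))) e))
      def-u : fromℕ 4 * t * u ≈ fromℕ 4 * t - fromℕ 3
      def-u = trans (left-comm (fromℕ 4 * t) _ _) (trans (*-congˡ (⁻¹-inverse _ 4t≉0)) (*-identityʳ _))
      0≤u : 0# ≤ u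
      0≤u = *-cancelˡ-≤ 0<t (u-lower t u def-u 2≤t)
      u≤1 : u ≤ 1#
      u≤1 = *-cancelˡ-≤ 0<t (u-upper t u def-u)
      w = power u j
      -- Bernoulli gives u^j ≥ 1 - 3j / (4 (j + 2)), which is at least 1/4.
      1≤4w : 1# ≤ fromℕ 4 * w
      1≤4w = *-cancelˡ-≤ 0<t (gap-power t u ⟨ j ⟩ w def-u refl (0≤fromℕ j) (bernoulli u j 0≤u) (proj₁ 0<t))
      -- Here u² = 1 - 3/(2t) + 9/(16t²), and t ≥ 2 makes this at most 1 - 6/(5t). Since 5t - 6 = 5j
      -- + 4, this is the factor in the conclusion.
      bound : fromℕ 5 * t * (u * u) ≤ fromℕ 5 * t - fromℕ 6
      bound = *-cancelˡ-≤ (1≤⇒0< (one≤-square t 2≤t)) (gap-square t u def-u 2≤t 0≤u)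
      uu≤1 : u * u ≤ 1#
      uu≤1 = ≤-trans (*-mono-≤ˡ 0≤u u≤1) (≤-respˡ (sym (*-identityʳ u)) u≤1)
      N h : Carrier
      N = ⟨ (q ℕ.+ j) C j ⟩
      h = ⟨ card (∂ G) ⟩
      scaled : ⟨ j ! ⟩ * N * (w * w) ≤ rising (⟨ q ⟩ * (u * u)) j
      scaled = ≤-respˡ (trans (*-cong (power-* u j) (rising-binomial q j)) (*-comm _ _)) (rising-scale ⟨ q ⟩ (u * u) j (0≤fromℕ q) (0≤square u) uu≤1)
      -- The first alternative would make the shadow at least `N` / 16, because w² ≥ 1/16; the
      -- constant 20 in the hypothesis excludes it.
      finish : rising (⟨ q ⟩ * (u * u)) j ≤ ⟨ j ! ⟩ * h ⊎ ⟨ suc j ⟩ * ⟨ card G ⟩ ≤ ⟨ q ⟩ * (u * u) * h → _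
      finish (inj₁ big) = ⊥-elim (1≰0 (five-four N (*-cancelˡ-≤ (!-positive j) (gap-left ⟨ j ! ⟩ N h w _ scaled big 1≤4w (0≤fromℕ (j !)) (0≤fromℕ ((q ℕ.+ j) C j)) few)) (1≤fromℕ (nCk>0 q j))))
      finish (inj₂ ok) = gap-right ⟨ j ⟩ ⟨ q ⟩ u ⟨ card G ⟩ h (≤-respˡ (*-congʳ (+-comm 1# ⟨ j ⟩)) ok) bound (0≤fromℕ q) (0≤fromℕ (card (∂ G))) (0≤fromℕ j)

-- Stability of near-extremal pairs along chains of links.

module CliqueStability where
  open Families
  open InitialSegments
  open RealArithmetic
  open LovászBound
  open LovászGap
  open import Data.Fin.Properties using () renaming (_≟_ to _≟ᶠ_)
  open import Data.Fin.Subset.Properties using (∣⊥∣≡0)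

  module ChainCertificates (R : CompleteOrderedField) where
    open Certificates R

    crude₁ = certify 10 (λ q j e ep N1 N2 b d K bb →
      K + d ≤ b ∷ q * d ≤ (j + # 1) * K + ep * d ∷ b ≤ N2 + # 10 * e * N1 ∷ (j + # 1) * N2 ≈ (q + j + # 1) * N1 ∷ d ≈ N1 + bb ∷ # 0 ≤ bb ∷ ep ≤ e ∷ e ≤ # 1 ∷ # 0 ≤ j ∷ # 0 ≤ q ∷ # 0 ≤ ep ∷ [] ⊢
      (q + j) * bb ≼ (# 10 * e * (j + # 1) + ep) * N1)
      0 ((1 , 0 ∷ []) ∷ (1 , 0 ∷ 10 ∷ []) ∷ (1 , 1 ∷ []) ∷ (1 , 2 ∷ []) ∷ (1 , 2 ∷ 10 ∷ []) ∷ (1 , 3 ∷ []) ∷ (1 , 5 ∷ 12 ∷ []) ∷ (1 , 6 ∷ []) ∷ (1 , 6 ∷ 10 ∷ []) ∷ (1 , 6 ∷ 11 ∷ []) ∷ (1 , 7 ∷ 8 ∷ []) ∷ (1 , 7 ∷ 9 ∷ []) ∷ []) ≡.refl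
    crude₂ = certify 7 (λ q j e ep N0 N1 bb →
      (q + j) * bb ≤ (# 10 * e * (j + # 1) + ep) * N1 ∷ j * N1 ≈ (q + j) * N0 ∷ ep ≤ e ∷ # 0 ≤ ep ∷ # 1 ≤ j ∷ # 0 ≤ N0 ∷ # 0 ≤ q ∷ [] ⊢
      j * ((q + j) * bb) ≼ j * ((q + j) * (# 21 * e * N0)))
      0 ((1 , 0 ∷ []) ∷ (1 , 0 ∷ 5 ∷ []) ∷ (20 , 1 ∷ 3 ∷ []) ∷ (10 , 1 ∷ 3 ∷ 5 ∷ []) ∷ (21 , 1 ∷ 4 ∷ []) ∷ (10 , 1 ∷ 4 ∷ 5 ∷ []) ∷ (11 , 3 ∷ 5 ∷ 5 ∷ 6 ∷ []) ∷ (12 , 3 ∷ 5 ∷ 6 ∷ []) ∷ (11 , 3 ∷ 5 ∷ 6 ∷ 7 ∷ []) ∷ (1 , 3 ∷ 6 ∷ []) ∷ (1 , 3 ∷ 6 ∷ 7 ∷ []) ∷ (11 , 4 ∷ 5 ∷ 5 ∷ 6 ∷ []) ∷ (11 , 4 ∷ 5 ∷ 6 ∷ []) ∷ (11 , 4 ∷ 5 ∷ 6 ∷ 7 ∷ []) ∷ []) ≡.refl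
    refine₁ = certify 8 (λ q j ep N1 d bb K Ms →
      K ≤ Ms ∷ (j + # 1) * Ms ≈ q * N1 ∷ q * d ≤ (j + # 1) * K + ep * d ∷ d ≈ N1 + bb ∷ # 0 ≤ ep ∷ # 0 ≤ d ∷ # 1 ≤ j ∷ # 0 ≤ q ∷ [] ⊢
      q * bb ≼ # 5 * j * ep * d)
      0 ((2 , 0 ∷ []) ∷ (1 , 0 ∷ 8 ∷ []) ∷ (1 , 1 ∷ []) ∷ (1 , 3 ∷ []) ∷ (1 , 5 ∷ 9 ∷ []) ∷ (4 , 6 ∷ 7 ∷ []) ∷ (5 , 6 ∷ 7 ∷ 8 ∷ []) ∷ []) ≡.refl
    refine₂ = certify 9 (λ q j ep N1 d bb K Ms E →
      K ≈ Ms + E ∷ (j + # 1) * Ms ≈ q * N1 ∷ q * d ≤ (j + # 1) * K + ep * d ∷ d ≈ N1 + bb ∷ # 5 * j * (j + # 1) * E ≤ q * (# 5 * j - # 1) * bb ∷ # 0 ≤ j ∷ # 0 ≤ q ∷ [] ⊢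
      q * bb ≼ # 5 * j * ep * d)
      0 ((5 , 0 ∷ 8 ∷ []) ∷ (5 , 0 ∷ 8 ∷ 8 ∷ []) ∷ (5 , 2 ∷ 8 ∷ []) ∷ (5 , 4 ∷ 8 ∷ []) ∷ (5 , 6 ∷ 8 ∷ 9 ∷ []) ∷ (1 , 7 ∷ []) ∷ []) ≡.refl
    refine₃ = certify 8 (λ q j e ep N0 N1 d bb →
      q * bb ≤ # 5 * j * ep * d ∷ d ≈ N1 + bb ∷ bb ≤ # 21 * e * N0 ∷ # 21 * e ≤ # 1 ∷ N0 ≤ N1 ∷ j * N1 ≈ (q + j) * N0 ∷ ep * (q + j) ≤ e * q ∷ # 0 ≤ ep ∷ # 0 ≤ j ∷ # 0 ≤ N0 ∷ [] ⊢
      q * bb ≼ q * (# 10 * e * N0))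
      0 ((1 , 0 ∷ []) ∷ (5 , 1 ∷ 9 ∷ 10 ∷ []) ∷ (5 , 3 ∷ 9 ∷ 10 ∷ []) ∷ (5 , 4 ∷ 9 ∷ 10 ∷ 11 ∷ []) ∷ (5 , 5 ∷ 9 ∷ 10 ∷ []) ∷ (10 , 6 ∷ 9 ∷ []) ∷ (10 , 8 ∷ 11 ∷ []) ∷ []) ≡.refl
    no-overflow = certify 6 (λ q j N0 N1 E bb →
      # 5 * j * (j + # 1) * E ≤ q * (# 5 * j - # 1) * bb ∷ N1 ≤ E ∷ j * N1 ≈ (q + j) * N0 ∷ # 20 * bb ≤ N0 ∷ # 1 ≤ j ∷ # 1 ≤ q ∷ # 1 ≤ N0 ∷ [] ⊢
      # 1 ≼ # 0)
      395 ((20 , 0 ∷ []) ∷ (200 , 1 ∷ []) ∷ (300 , 1 ∷ 5 ∷ []) ∷ (100 , 1 ∷ 5 ∷ 5 ∷ []) ∷ (200 , 3 ∷ []) ∷ (100 , 3 ∷ 5 ∷ []) ∷ (4 , 4 ∷ []) ∷ (5 , 4 ∷ 5 ∷ []) ∷ (5 , 4 ∷ 5 ∷ 6 ∷ []) ∷ (4 , 4 ∷ 6 ∷ []) ∷ (395 , 5 ∷ []) ∷ (100 , 5 ∷ 5 ∷ []) ∷ (100 , 5 ∷ 5 ∷ 7 ∷ []) ∷ (95 , 5 ∷ 6 ∷ []) ∷ (95 , 5 ∷ 6 ∷ 7 ∷ []) ∷ (395 , 5 ∷ 7 ∷ []) ∷ (196 , 6 ∷ []) ∷ (196 , 6 ∷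 7 ∷ []) ∷ (396 , 7 ∷ []) ∷ []) ≡.refl
    ep≤e-scaled = certify 4 (λ q j e ep →
      ep * (q + j) ≤ e * q ∷ # 0 ≤ ep ∷ # 0 ≤ j ∷ [] ⊢
      q * ep ≼ q * e)
      0 ((1 , 0 ∷ []) ∷ (1 , 1 ∷ 2 ∷ []) ∷ []) ≡.refl
    missing-B = certify 7 (λ e N0 M1 N1 m x y →
      m ≤ x + y ∷ x ≤ # 2 * e * N0 ∷ y ≤ # 2 * e * M1 ∷ N1 ≈ N0 + M1 ∷ # 0 ≤ e ∷ [] ⊢
      m ≼ # 2 * e * N1)
      0 ((1 , 0 ∷ []) ∷ (1 , 1 ∷ []) ∷ (1 , 2 ∷ []) ∷ (2 , 4 ∷ 5 ∷ []) ∷ []) ≡.refl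
    outside-B = certify 7 (λ e N1 N2 b i m eo →
      b ≈ i + eo ∷ N2 ≈ i + m ∷ m ≤ # 2 * e * N1 ∷ b ≤ N2 + # 10 * e * N1 ∷ [] ⊢
      eo ≼ # 12 * e * N1)
      0 ((1 , 1 ∷ []) ∷ (1 , 2 ∷ []) ∷ (1 , 4 ∷ []) ∷ (1 , 5 ∷ []) ∷ []) ≡.refl
    outside-few = certify 3 (λ e N1 eo →
      eo ≤ # 12 * e * N1 ∷ # 240 * e ≤ # 1 ∷ # 0 ≤ N1 ∷ [] ⊢
      # 20 * eo ≼ N1)
      0 ((20 , 0 ∷ []) ∷ (1 , 1 ∷ 2 ∷ []) ∷ []) ≡.refl
    outside-A₁ = certify 5 (λ q j eo h E2 →
      # 5 * (j + # 1) * (j + # 2) * E2 ≤ q * (# 5 * j + # 4) * h ∷ h ≤ eo ∷ # 0 ≤ q ∷ # 0 ≤ j ∷ # 0 ≤ eo ∷ [] ⊢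
      # 5 * (j + # 1) * ((j + # 2) * E2) ≼ # 5 * (j + # 1) * (q * eo))
      0 ((1 , 0 ∷ []) ∷ (4 , 1 ∷ 2 ∷ []) ∷ (5 , 1 ∷ 2 ∷ 3 ∷ []) ∷ (1 , 2 ∷ 4 ∷ []) ∷ []) ≡.refl
    outside-A₂ = certify 7 (λ q j e N1 M2 eo E2 →
      (j + # 2) * E2 ≤ q * eo ∷ eo ≤ # 12 * e * N1 ∷ (j + # 1) * M2 ≈ q * N1 ∷ # 0 ≤ e ∷ # 0 ≤ M2 ∷ # 0 ≤ q ∷ [] ⊢
      (j + # 2) * E2 ≼ (j + # 2) * (# 12 * e * M2))
      0 ((1 , 0 ∷ []) ∷ (1 , 1 ∷ 6 ∷ []) ∷ (12 , 3 ∷ 4 ∷ []) ∷ (12 , 4 ∷ 5 ∷ []) ∷ []) ≡.refl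
    missing-A₁ = certify 15 (λ q j e ep N1 N2 M3 a b i eo m Mm iA E2 →
      q * b ≤ (j + # 2) * a + ep * b ∷ b ≈ i + eo ∷ N2 ≈ i + m ∷ a ≈ iA + E2 ∷ M3 ≈ iA + Mm ∷ (j + # 2) * M3 ≈ q * N2 ∷ (j + # 2) * E2 ≤ q * eo ∷ m ≤ # 2 * e * N1 ∷ # 0 ≤ j ∷ # 0 ≤ q ∷ [] ⊢
      (j + # 2) * Mm ≼ # 2 * e * q * N1 + ep * b)
      0 ((1 , 0 ∷ []) ∷ (1 , 2 ∷ 14 ∷ []) ∷ (1 , 3 ∷ 14 ∷ []) ∷ (2 , 5 ∷ []) ∷ (1 , 5 ∷ 13 ∷ []) ∷ (2 , 8 ∷ []) ∷ (1 , 8 ∷ 13 ∷ []) ∷ (1 , 9 ∷ []) ∷ (1 , 11 ∷ []) ∷ (1 , 12 ∷ 14 ∷ []) ∷ []) ≡.refl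
    -- The first term is 2e (j + 1) M2. By b ≤ 2 N2 and the smallness of ep relative to q / |S|, the
    -- term ep b contributes at most 2e M2. The sum is 2e (j + 2) M2, so the constant 2 returns
    -- unchanged.
    missing-A₂ = certify 9 (λ q j e ep N1 N2 M2 b Mm →
      (j + # 2) * Mm ≤ # 2 * e * q * N1 + ep * b ∷ b ≤ N2 + # 10 * e * N1 ∷ # 10 * e ≤ # 1 ∷ N1 ≤ N2 ∷ (j + # 1) * N2 ≈ (q + j + # 1) * N1 ∷ ep * (q + j + # 1) ≤ e * q ∷ (j + # 1) * M2 ≈ q * N1 ∷ # 0 ≤ ep ∷ # 0 ≤ j ∷ # 0 ≤ N1 ∷ # 0 ≤ e ∷ [] ⊢
      (j + # 2) * ((j + # 1) * Mm) ≼ (j + # 2) * ((j + # 1) * (# 2 * e * M2)))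
      0 ((1 , 0 ∷ []) ∷ (1 , 0 ∷ 10 ∷ []) ∷ (1 , 1 ∷ 9 ∷ []) ∷ (1 , 1 ∷ 9 ∷ 10 ∷ []) ∷ (1 , 2 ∷ 9 ∷ 10 ∷ 11 ∷ []) ∷ (1 , 2 ∷ 9 ∷ 11 ∷ []) ∷ (1 , 3 ∷ 9 ∷ []) ∷ (1 , 3 ∷ 9 ∷ 10 ∷ []) ∷ (2 , 4 ∷ 9 ∷ []) ∷ (2 , 6 ∷ 11 ∷ []) ∷ (2 , 8 ∷ 10 ∷ 12 ∷ []) ∷ (4 , 8 ∷ 12 ∷ []) ∷ []) ≡.refl
    scale-≤1 = certify 1 (λ e →
      # 1000 * e ≤ # 1 ∷ [] ⊢
      e ≼ # 1)
      999 ((999 , []) ∷ (1 , 0 ∷ []) ∷ []) ≡.refl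
    scale-10 = certify 1 (λ e →
      # 1000 * e ≤ # 1 ∷ [] ⊢
      # 10 * e ≼ # 1)
      99 ((99 , []) ∷ (1 , 0 ∷ []) ∷ []) ≡.refl
    scale-21 = certify 1 (λ e →
      # 1000 * e ≤ # 1 ∷ [] ⊢
      # 21 * e ≼ # 1)
      999 ((979 , []) ∷ (21 , 0 ∷ []) ∷ []) ≡.refl
    scale-240 = certify 1 (λ e →
      # 1000 * e ≤ # 1 ∷ [] ⊢
      # 240 * e ≼ # 1)
      24 ((19 , []) ∷ (6 , 0 ∷ []) ∷ []) ≡.refl
    scale-420 = certify 3 (λ e bb N0 →
      # 1000 * e ≤ # 1 ∷ bb ≤ # 21 * e * N0 ∷ # 0 ≤ N0 ∷ [] ⊢
      # 20 * bb ≼ N0)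
      49 ((21 , 0 ∷ 2 ∷ []) ∷ (1000 , 1 ∷ []) ∷ (29 , 2 ∷ []) ∷ []) ≡.refl
    upper-of-excess = certify 5 (λ e N1 N0 d bb →
      d ≈ N1 + bb ∷ bb ≤ # 10 * e * N0 ∷ [] ⊢
      d ≼ N1 + # 10 * e * N0)
      0 ((1 , 0 ∷ []) ∷ (1 , 2 ∷ []) ∷ []) ≡.refl
    base-absurd = certify 5 (λ qm q ep e a →
      q ≤ a + ep ∷ a ≤ qm ∷ q ≈ # 1 + qm ∷ ep ≤ e ∷ # 1000 * e ≤ # 1 ∷ [] ⊢
      # 1 ≼ # 0)
      998 ((1000 , 0 ∷ []) ∷ (1000 , 1 ∷ []) ∷ (1000 , 3 ∷ []) ∷ (1000 , 4 ∷ []) ∷ (1 , 5 ∷ []) ∷ []) ≡.refl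
    gap-shift = certify 5 (λ i q E h bb →
      # 5 * (i + # 1) * (i + # 2) * E ≤ q * (# 5 * i + # 4) * h ∷ h ≤ bb ∷ # 0 ≤ q ∷ # 0 ≤ i ∷ [] ⊢
      # 5 * (# 1 + i) * (# 1 + i + # 1) * E ≼ q * (# 5 * (# 1 + i) - # 1) * bb)
      0 ((1 , 0 ∷ []) ∷ (4 , 1 ∷ 2 ∷ []) ∷ (5 , 1 ∷ 2 ∷ 3 ∷ []) ∷ []) ≡.refl
    suc-one = identity 1 (λ j → # 1 + j ≈ j + # 1) ≡.refl
    suc-two = identity 1 (λ j → # 1 + (# 1 + j) ≈ j + # 2) ≡.refl
    drop-N₁ = identity 3 (λ q j N → (q + j + # 1) * N - (j + # 1) * N ≈ q * N) ≡.refl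
    move-M = identity 3 (λ j N M → (j + # 1) * (N + M) - (j + # 1) * N ≈ (j + # 1) * M) ≡.refl
    shift-rel = identity 3 (λ q i N → (q + i + # 1) * N ≈ (q + (# 1 + i)) * N) ≡.refl
    assoc-rel = identity 2 (λ q j → q + (# 1 + j) ≈ q + j + # 1) ≡.refl

  module Binomials (R : CompleteOrderedField) (q′ : ℕ) where
    open CompleteOrderedField R hiding (zero)
    open OrderedField R
    open Lovász R
    open ChainCertificates R

    q : ℕ
    q = suc q′

    Q : Carrier
    Q = ⟨ q ⟩

    0<Q : 0# < Q
    0<Q = positive {q} (ℕ.s≤s ℕ.z≤n)

    -- For |S| = q + r these count the r-subsets of S: all of them, those avoiding a fixed vertex,
    -- and those containing it.
    N M N⁻ : ℕ → Carrier
    N r = ⟨ (q ℕ.+ r) C r ⟩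
    M r = ⟨ (q′ ℕ.+ r) C r ⟩
    N⁻ zero = 0#
    N⁻ (suc r) = N r

    0≤N : ∀ r → 0# ≤ N r
    0≤N r = 0≤fromℕ ((q ℕ.+ r) C r)

    0≤M : ∀ r → 0# ≤ M r
    0≤M r = 0≤fromℕ ((q′ ℕ.+ r) C r)

    N≈N⁻+M : ∀ r → N r ≈ N⁻ r + M r
    N≈N⁻+M zero = sym (+-identityˡ _)
    N≈N⁻+M (suc r) = trans (reflexive (≡.cong ⟨_⟩ (≡.sym (Pascal (q′ ℕ.+ suc r) r))))
      (trans (fromℕ-+ ((q′ ℕ.+ suc r) C r) ((q′ ℕ.+ suc r) C suc r)) (+-congʳ (reflexive (≡.cong (λ m → ⟨ m C r ⟩) (ℕₚ.+-suc q′ r)))))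

    N-suc : ∀ j → (⟨ j ⟩ + 1#) * N (suc j) ≈ (Q + ⟨ j ⟩ + 1#) * N j
    N-suc j = trans (trans (*-congʳ (sym (suc-one ⟨ j ⟩))) (trans (sym (fromℕ-* (suc j) ((q ℕ.+ suc j) C suc j)))
        (reflexive (≡.cong ⟨_⟩ (≡.trans (≡.cong (λ m → suc j ℕ.* (m C suc j)) (ℕₚ.+-suc q j)) (absorption (q ℕ.+ j) j))))))
      (trans (fromℕ-* (suc (q ℕ.+ j)) ((q ℕ.+ j) C j)) (*-congʳ (trans (suc-one ⟨ q ℕ.+ j ⟩) (+-congʳ (fromℕ-+ q j)))))

    M-suc : ∀ j → (⟨ j ⟩ + 1#) * M (suc j) ≈ Q * N j
    M-suc j = trans (sym (move-M ⟨ j ⟩ (N j) (M (suc j)))) (trans (+-congʳ (trans (*-congˡ (sym (N≈N⁻+M (suc j)))) (N-suc j))) (drop-N₁ Q ⟨ j ⟩ (N j)))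

    choose-M : ∀ j → ⟨ (q ℕ.+ j) C suc j ⟩ ≈ M (suc j)
    choose-M j = reflexive (≡.cong (λ m → ⟨ m C suc j ⟩) (≡.sym (ℕₚ.+-suc q′ j)))

  -- The vertex set is read off from a chain of links.  A vertex v is chosen so that the ratio of |link A| to |link B| is at
  -- least the average; as q = |S| - r stays constant along links, the relative deficiency ep does not grow.
  module Chains (R : CompleteOrderedField) where
    open CompleteOrderedField R hiding (zero)
    open OrderedField R
    open Lovász R
    open Gap R
    open ChainCertificates R
    open LovászCertificates R using (left-comm)

    module Chain (q′ : ℕ) (ε : Carrier) (0≤ε : 0# ≤ ε) (ε-small : fromℕ 1000 * ε ≤ 1#) where
      open Binomials R q′ public

      -- For the complete families on q + r vertices `ratio` is an equality with ep = 0. It does not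
      -- bound sizes, as larger cliques satisfy it too, so `upper` is carried along. As q is fixed
      -- and r falls, `ep-small` passes to links with the same ep.
      record Hypotheses {n} (r : ℕ) (ep : Carrier) (A B : Family n) : Set where
        field
          uniformA : Uniform (suc r) A
          uniformB : Uniform r B
          shadowed : ∂ A ⊑ B
          nonempty : 1 ℕ.≤ card B
          ratio    : Q * ⟨ card B ⟩ ≤ ⟨ suc r ⟩ * ⟨ card A ⟩ + ep * ⟨ card B ⟩
          upper    : ⟨ card B ⟩ ≤ N r + fromℕ 10 * ε * N⁻ r
          0≤ep     : 0# ≤ ep
          ep-small : ep * (Q + ⟨ r ⟩) ≤ ε * Q

        ep≤ε : ep ≤ ε
        ep≤ε = *-cancelˡ-≤ 0<Q (ep≤e-scaled Q ⟨ r ⟩ ε ep ep-small 0≤ep (0≤fromℕ r))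

      -- The field `covered` guarantees that the vertex chosen one level higher is not already in
      -- `S`: every vertex of `S` lies in a member of the link, and those members avoid the linking
      -- vertex.
      record Close {n} (r : ℕ) (A B : Family n) : Set where
        field
          S        : Subset n
          size     : ∣ S ∣ ≡ q ℕ.+ r
          covered  : ∀ w → lookup S w ≡ true → ∃ λ X → T (A X) × lookup X w ≡ true
          missingB : ⟨ card (kSubsetsOf r S ∖ᶠ B) ⟩ ≤ fromℕ 2 * ε * N⁻ r
          missingA : ⟨ card (kSubsetsOf (suc r) S ∖ᶠ A) ⟩ ≤ fromℕ 2 * ε * M r

      0≤2ε* : ∀ {x} → 0# ≤ x → 0# ≤ fromℕ 2 * ε * x
      0≤2ε* h = *-nonneg (*-nonneg (0≤fromℕ 2) 0≤ε) h

      base : ∀ {n ep} {A B : Family n} → Hypotheses 0 ep A B → Close 0 A B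
      base {n} {ep} {A} {B} hyp = record
        { S = S ; size = ≡.trans size (≡.sym (ℕₚ.+-identityʳ q))
        ; covered = λ w e → insert w ⊥ , all w e , lookup∘update w ⊥ true
        ; missingB = ≤-respˡ (sym (reflexive (≡.cong ⟨_⟩ (card-empty noneB)))) (0≤2ε* ≤-refl)
        ; missingA = ≤-respˡ (sym (reflexive (≡.cong ⟨_⟩ (card-empty noneA)))) (0≤2ε* (0≤M 0)) }
        where
        open Hypotheses hyp
        b≡1 : card B ≡ 1
        b≡1 = ℕₚ.≤-antisym (card-uniform₀ uniformB) nonempty
        ratio′ : Q ≤ ⟨ card A ⟩ + ep
        ratio′ = ≤-respˡ (trans (*-congˡ ⟨b⟩) (*-identityʳ Q)) (≤-respʳ (+-cong (trans (*-congʳ (+-identityʳ 1#)) (*-identityˡ _)) (trans (*-congˡ ⟨b⟩) (*-identityʳ ep))) ratio)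
          where
          ⟨b⟩ : ⟨ card B ⟩ ≈ 1#
          ⟨b⟩ = trans (reflexive (≡.cong ⟨_⟩ b≡1)) (+-identityʳ 1#)
        -- At level 0 the ratio says q ≤ |A| + ep with ep ≤ ε < 1, so the integer |A| exceeds q - 1.
        enough : q ℕ.≤ card A
        enough = fromℕ-< λ le → 1≰0 (base-absurd ⟨ q′ ⟩ Q ep ε ⟨ card A ⟩ ratio′ le refl ep≤ε ε-small)
        found = singletons-within q uniformA enough
        S = proj₁ found
        size = proj₁ (proj₂ found)
        all = proj₂ (proj₂ found)
        noneB : ∀ X → ¬ T ((kSubsetsOf 0 S ∖ᶠ B) X)
        noneB X p with card-witness B nonempty
        ... | Y , y = not⇒¬T (∧-snd {kSubsetsOf 0 S X} p) (≡.subst (T ∘ B) (≡.trans (∣⊥∣₀ Y (uniformB Y y)) (≡.sym (∣⊥∣₀ X (kSub-size {k = 0} S X (∧-fst p))))) y)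
        noneA : ∀ X → ¬ T ((kSubsetsOf 1 S ∖ᶠ A) X)
        noneA X p with singleton-form X (kSub-size {k = 1} S X (∧-fst p))
        ... | w , x , e = not⇒¬T (∧-snd {kSubsetsOf 1 S X} p) (≡.subst (T ∘ A) (≡.sym e) (all w (⊆ᵇ-elim X S (kSub-⊆ {k = 1} S X (∧-fst p)) w x)))

      fromℕ-split : ∀ {a} b c → a ≡ b ℕ.+ c → ⟨ a ⟩ ≈ ⟨ b ⟩ + ⟨ c ⟩
      fromℕ-split b c e = trans (reflexive (≡.cong ⟨_⟩ e)) (fromℕ-+ b c)

      module Descent {n} (j : ℕ) {ep} {A B : Family n} (hyp : Hypotheses (suc j) ep A B) where
        open Hypotheses hyp public

        a b J : Carrier
        a = ⟨ card A ⟩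
        b = ⟨ card B ⟩
        J = ⟨ j ⟩

        K d : Fin n → ℕ
        K v = card (link v A)
        d v = card (link v B)

        0≤J : 0# ≤ J
        0≤J = 0≤fromℕ j

        no-isolated-link : ∀ v → d v ≡ 0 → K v ≡ 0
        no-isolated-link v e with find (link v A)
        ... | inj₂ none = card-empty none
        ... | inj₁ (X , p) with extend-within ⊥ X (ℕₚ.≤-trans (ℕₚ.≤-reflexive (≡.cong suc (∣⊥∣≡0 n))) (ℕₚ.≤-trans (ℕ.s≤s ℕ.z≤n) (ℕₚ.≤-reflexive (≡.sym (link-uniform v uniformA X p)))))
        ... | w , x , _ = ⊥-elim (ℕₚ.<⇒≱ (card-≥1 {F = link v B} (erase w X) (∂-link⊑ v shadowed (erase w X) (∂-erase (link v A) w X x p))) (ℕₚ.≤-reflexive e))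

        abstract
          chosen : ∃ λ v → 1 ℕ.≤ d v × Q * ⟨ d v ⟩ ≤ ⟨ suc j ⟩ * ⟨ K v ⟩ + ep * ⟨ d v ⟩
          chosen = choose-index d (λ v → ⟨ suc j ⟩ * ⟨ K v ⟩ + ep * ⟨ d v ⟩) (λ v → Q * ⟨ d v ⟩) degenerate averaged positive-sum
            where
            degenerate : ∀ v → d v ≡ 0 → ⟨ suc j ⟩ * ⟨ K v ⟩ + ep * ⟨ d v ⟩ ≤ Q * ⟨ d v ⟩
            degenerate v e rewrite e | no-isolated-link v e = ≤-reflexive (trans (+-cong (zeroʳ _) (zeroʳ ep)) (trans (+-identityˡ 0#) (sym (zeroʳ Q))))
            sumK : ⟨ sumℕ K ⟩ ≈ ⟨ suc (suc j) ⟩ * a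
            sumK = trans (reflexive (≡.cong ⟨_⟩ (sum-link (suc (suc j)) uniformA))) (fromℕ-* (suc (suc j)) (card A))
            sumd : ⟨ sumℕ d ⟩ ≈ ⟨ suc j ⟩ * b
            sumd = trans (reflexive (≡.cong ⟨_⟩ (sum-link (suc j) uniformB))) (fromℕ-* (suc j) (card B))
            averaged : sum (λ v → Q * ⟨ d v ⟩) ≤ sum (λ v → ⟨ suc j ⟩ * ⟨ K v ⟩ + ep * ⟨ d v ⟩)
            averaged = ≤-respˡ (sym (trans (sum-fromℕ Q d) (trans (*-congˡ sumd) (left-comm Q ⟨ suc j ⟩ b))))
              (≤-respʳ (sym (trans (sum-+ (λ v → ⟨ suc j ⟩ * ⟨ K v ⟩) (λ v → ep * ⟨ d v ⟩)) (trans (+-cong (trans (sum-fromℕ ⟨ suc j ⟩ K) (*-congˡ sumK))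
                  (trans (sum-fromℕ ep d) (trans (*-congˡ sumd) (left-comm ep ⟨ suc j ⟩ b)))) (sym (distribˡ ⟨ suc j ⟩ _ _)))))
                (*-mono-≤ˡ (0≤fromℕ (suc j)) ratio))
            positive-sum : 1 ℕ.≤ sumℕ d
            positive-sum = ℕₚ.≤-trans nonempty (ℕₚ.≤-trans (ℕₚ.m≤m+n (card B) (j ℕ.* card B)) (ℕₚ.≤-reflexive (≡.sym (sum-link (suc j) uniformB))))

        v : Fin n
        v = proj₁ chosen

        A′ B′ : Family n
        A′ = link v A
        B′ = link v B

        ratio′ : Q * ⟨ card B′ ⟩ ≤ (J + 1#) * ⟨ card A′ ⟩ + ep * ⟨ card B′ ⟩
        ratio′ = ≤-respʳ (+-congʳ (*-congʳ (suc-one J))) (proj₂ (proj₂ chosen))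

        K+d≤b : ⟨ card A′ ⟩ + ⟨ card B′ ⟩ ≤ b
        K+d≤b = ≤-respˡ (fromℕ-+ (card A′) (card B′)) (fromℕ-mono (card-link+link v shadowed))

        ep-small′ : ep * (Q + J + 1#) ≤ ε * Q
        ep-small′ = ≤-respˡ (*-congˡ (assoc-rel Q J)) ep-small

        ep-small⁻ : ep * (Q + J) ≤ ε * Q
        ep-small⁻ = ≤-trans (*-mono-≤ˡ 0≤ep (+-mono-≤ ≤-refl (fromℕ-mono (ℕₚ.n≤1+n j)))) ep-small

      -- The excess `bb` over the complete family is bounded twice. The count of |B| at v gives 21
      -- ε, enough only to make `bb` small compared with `N i`; this smallness is the hypothesis of
      -- `gap`, from which the sharper constant follows.
      link-upper : ∀ {n} j {ep} {A B : Family n} (hyp : Hypotheses (suc j) ep A B) (let open Descent j hyp) →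
                   ⟨ card B′ ⟩ ≤ N j + fromℕ 10 * ε * N⁻ j
      link-upper zero hyp = ≤-trans (fromℕ-mono (card-uniform₀ (link-uniform v uniformB)))
          (≤-reflexive (sym (trans (+-congˡ (zeroʳ _)) (+-identityʳ _))))
        where open Descent zero hyp
      link-upper {n} (suc i) {ep} {A} {B} hyp with ℕₚ.≤-total (card (Descent.B′ (suc i) hyp)) ((q ℕ.+ suc i) C suc i)
      ... | inj₁ le = ≤-trans (fromℕ-mono le) (≤-respˡ (+-identityʳ _) (+-mono-≤ ≤-refl (*-nonneg (*-nonneg (0≤fromℕ 10) 0≤ε) (0≤N i))))
      ... | inj₂ ge = upper-of-excess ε (N (suc i)) (N i) D bb split
            (*-cancelˡ-≤ 0<Q (refine₃ Q J ε ep (N i) (N (suc i)) D bb rough split crude (scale-21 ε ε-small) N-mono J-rel ep-small⁻ 0≤ep 0≤J (0≤N i)))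
        where
        open Descent (suc i) hyp
        D = ⟨ card B′ ⟩
        s = q ℕ.+ suc i
        excess : ℕ
        excess = card B′ ℕ.∸ s C suc i
        bb = ⟨ excess ⟩
        0≤bb = 0≤fromℕ excess
        split : D ≈ N (suc i) + bb
        split = fromℕ-split (s C suc i) excess (≡.sym (ℕₚ.m+[n∸m]≡n ge))
        1≤J : 1# ≤ J
        1≤J = 1≤fromℕ {suc i} (ℕ.s≤s ℕ.z≤n)
        J-rel : J * N (suc i) ≈ (Q + J) * N i
        J-rel = trans (*-congʳ (suc-one ⟨ i ⟩)) (trans (N-suc i) (shift-rel Q ⟨ i ⟩ (N i)))
        N-mono : N i ≤ N (suc i)
        N-mono = ≤-respʳ (sym (N≈N⁻+M (suc i))) (≤-respˡ (+-identityʳ (N i)) (+-mono-≤ ≤-refl (0≤M (suc i))))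
        -- Adding `ratio′` to K + d ≤ |B| and inserting `upper` gives (q + J) bb ≤ (10 ε (J + 1) +
        -- ep) N(J). Since J N(J) = (q + J) N(i), with (J + 1)/J ≤ 2 and ep ≤ ε, the constant is 20
        -- + 1.
        crude : bb ≤ fromℕ 21 * ε * N i
        crude = *-cancelˡ-≤ (positive {q ℕ.+ suc i} (ℕ.s≤s ℕ.z≤n)) (≤-respˡ (*-congʳ (sym (fromℕ-+ q (suc i)))) (≤-respʳ (*-congʳ (sym (fromℕ-+ q (suc i))))
          (*-cancelˡ-≤ (positive {suc i} (ℕ.s≤s ℕ.z≤n)) (crude₂ Q J ε ep (N i) (N (suc i)) bb
            (crude₁ Q J ε ep (N (suc i)) (N (suc (suc i))) b D ⟨ card A′ ⟩ bb K+d≤b ratio′ upper (N-suc (suc i)) split 0≤bb ep≤ε (scale-≤1 ε ε-small) 0≤J (proj₁ 0<Q) 0≤ep)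
            J-rel ep≤ε 0≤ep 1≤J (0≤N i) (proj₁ 0<Q)))))
        few : fromℕ 20 * bb ≤ N i
        few = scale-420 ε bb (N i) ε-small crude (0≤N i)
        M-rel : (J + 1#) * ⟨ s C suc (suc i) ⟩ ≈ Q * N (suc i)
        M-rel = trans (*-congˡ (choose-M (suc i))) (M-suc (suc i))
        -- The surplus family `L` has shadow at most `bb`, so `gap` yields (J + 1) E ≤ q (1 -
        -- 1/(5J)) bb; the margin 1/(5J) is what counts.
        surplus : ∀ E → E ℕ.≤ s C suc i → s C suc (suc i) ℕ.+ E ℕ.≤ card A′ → fromℕ 5 * J * (J + 1#) * ⟨ E ⟩ ≤ Q * (fromℕ 5 * J - 1#) * bb
        surplus E hi lo = case (kk-surplus s (suc i) E (link-uniform v uniformA) (∂-link⊑ v shadowed) (ℕₚ.m<n+m (suc i) (ℕ.s≤s ℕ.z≤n)) hi lo)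
          where
          case : (∃ λ (L : Family (suc s)) → Uniform (suc i) L × card L ≡ E × card (∂ L) ℕ.+ s C suc i ℕ.≤ card B′) → _
          case (L , uL , cL , bL) = gap-shift ⟨ i ⟩ Q ⟨ E ⟩ ⟨ card (∂ L) ⟩ bb
              (≤-respˡ (*-congˡ (reflexive (≡.cong ⟨_⟩ cL))) (gap q i L uL (≤-trans (*-mono-≤ˡ (0≤fromℕ 20) ∂L≤bb) few))) ∂L≤bb (proj₁ 0<Q) (0≤fromℕ i)
            where
            ∂L≤bb : ⟨ card (∂ L) ⟩ ≤ bb
            ∂L≤bb = fromℕ-mono (ℕₚ.m+n≤o⇒m≤o∸n (card (∂ L)) bL)
        -- After cancelling the complete families `ratio′` reads q bb ≤ (J + 1) E + ep D. The margin
        -- of `surplus` leaves q bb / (5J) ≤ ep D; then D ≤ 2 N(J) turns this into the constant 10.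
        rough : Q * bb ≤ fromℕ 5 * J * ep * D
        rough with ℕₚ.≤-total (card A′) (s C suc (suc i))
        ... | inj₁ le = refine₁ Q J ep (N (suc i)) D bb ⟨ card A′ ⟩ ⟨ s C suc (suc i) ⟩ (fromℕ-mono le) M-rel ratio′ split 0≤ep (0≤fromℕ (card B′)) 1≤J (proj₁ 0<Q)
        ... | inj₂ le with ℕₚ.≤-total (card A′ ℕ.∸ s C suc (suc i)) (s C suc i)
        ... | inj₁ small = refine₂ Q J ep (N (suc i)) D bb ⟨ card A′ ⟩ ⟨ s C suc (suc i) ⟩ ⟨ card A′ ℕ.∸ s C suc (suc i) ⟩
                (fromℕ-split (s C suc (suc i)) (card A′ ℕ.∸ s C suc (suc i)) (≡.sym (ℕₚ.m+[n∸m]≡n le))) M-rel ratio′ split (surplus (card A′ ℕ.∸ s C suc (suc i)) small (ℕₚ.≤-reflexive (ℕₚ.m+[n∸m]≡n le))) 0≤J (proj₁ 0<Q)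
        -- A surplus of C(s, J) or more lies beyond the range of `kk-surplus`, but already a surplus
        -- of exactly C(s, J) contradicts 20 bb ≤ N(i).
        ... | inj₂ large = ⊥-elim (1≰0 (no-overflow Q J (N i) (N (suc i)) ⟨ s C suc i ⟩ bb
                (surplus (s C suc i) ℕₚ.≤-refl (ℕₚ.≤-trans (ℕₚ.+-monoʳ-≤ (s C suc (suc i)) large) (ℕₚ.≤-reflexive (ℕₚ.m+[n∸m]≡n le))))
                ≤-refl J-rel few 1≤J (1≤fromℕ {q} (ℕ.s≤s ℕ.z≤n)) (1≤fromℕ (nCk>0 q i))))

      module Ascent {n} (j : ℕ) {ep} {A B : Family n} (hyp : Hypotheses (suc j) ep A B)
                    (below : Close j (Descent.A′ j hyp) (Descent.B′ j hyp)) where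
        open Descent j hyp
        open Close below renaming (S to S′; size to size′; covered to covered′; missingB to missingB′; missingA to missingA′)

        v∉S′ : lookup S′ v ≡ false
        v∉S′ with lookup S′ v in eq
        ... | false = ≡.refl
        ... | true = let (X , p , x) = covered′ v eq in true≢false x (link-∉ v A X p)

        S : Subset n
        S = insert v S′

        size : ∣ S ∣ ≡ q ℕ.+ suc j
        size = ≡.trans (size-insert v S′ v∉S′) (≡.trans (≡.cong suc size′) (≡.sym (ℕₚ.+-suc q j)))

        lift : ∀ w → (∃ λ X → T (A′ X) × lookup X w ≡ true) → ∃ λ X → T (A X) × lookup X w ≡ true
        lift w (X , p , x) with v ≟ᶠ w
        ... | yes ≡.refl = true≢false x (link-∉ v A X p)
        ... | no ne = insert v X , ∧-fst p , ≡.trans (lookup-insert′ X ne) x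

        nonempty-S′ : ∃ λ w → lookup S′ w ≡ true
        nonempty-S′ = let (w , p , _) = extend-within ⊥ S′ (ℕₚ.≤-trans (ℕₚ.≤-reflexive (≡.cong suc (∣⊥∣≡0 n))) (ℕₚ.≤-trans (ℕ.s≤s ℕ.z≤n) (ℕₚ.≤-reflexive (≡.sym size′)))) in w , p

        covered : ∀ w → lookup S w ≡ true → ∃ λ X → T (A X) × lookup X w ≡ true
        covered w e with v ≟ᶠ w
        ... | no ne = lift w (covered′ w (≡.trans (≡.sym (lookup-insert′ S′ ne)) e))
        ... | yes ≡.refl = let (u , p) = nonempty-S′ ; (X , x , _) = covered′ u p in insert v X , ∧-fst x , lookup∘update v X true

        ⊆-erase-v : ∀ X → lookup X v ≡ false → T (X ⊆ᵇ S) → T (X ⊆ᵇ S′)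
        ⊆-erase-v X x p = ⊆ᵇ-intro X S′ helper
          where
          helper : ∀ u → lookup X u ≡ true → lookup S′ u ≡ true
          helper u e with v ≟ᶠ u
          ... | yes ≡.refl = true≢false e x
          ... | no ne = ≡.trans (≡.sym (lookup-insert′ S′ ne)) (⊆ᵇ-elim X S p u e)

        m eo Mm E₂ : ℕ
        m = card (kSubsetsOf (suc j) S ∖ᶠ B)
        eo = card (B ∖ᶠ kSubsetsOf (suc j) S)
        Mm = card (kSubsetsOf (suc (suc j)) S ∖ᶠ A)
        E₂ = card (A ∖ᶠ kSubsetsOf (suc (suc j)) S)

        -- A missing set containing v comes from one missing in `B′`. One avoiding v is missing in
        -- `A′`, for otherwise adding v would give a member of `A` and the set would lie in its
        -- shadow.
        m-split : m ℕ.≤ card (kSubsetsOf j S′ ∖ᶠ B′) ℕ.+ card (kSubsetsOf (suc j) S′ ∖ᶠ A′)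
        m-split = ℕₚ.≤-trans (ℕₚ.≤-reflexive (card-link-del v F)) (ℕₚ.+-mono-≤ (card-mono inLink) (card-mono inDel))
          where
          F = kSubsetsOf (suc j) S ∖ᶠ B
          inLink : link v F ⊑ (kSubsetsOf j S′ ∖ᶠ B′)
          inLink X p = ∧-intro {kSubsetsOf j S′ X} (kSub-intro S′ X (ℕₚ.suc-injective (≡.trans (≡.sym (size-insert v X x)) (kSub-size S (insert v X) k)))
              (⊆-erase-v X x (⊆ᵇ-insert⁻ v X S x (kSub-⊆ {k = suc j} S (insert v X) k))))
              (¬T⇒not λ b → not⇒¬T (∧-snd {kSubsetsOf (suc j) S (insert v X)} (∧-fst {F (insert v X)} p)) (∧-fst b))
            where
            x = link-∉ v F X p
            k = ∧-fst {kSubsetsOf (suc j) S (insert v X)} (∧-fst {F (insert v X)} p)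
          inDel : del v F ⊑ (kSubsetsOf (suc j) S′ ∖ᶠ A′)
          inDel X p = ∧-intro {kSubsetsOf (suc j) S′ X} (kSub-intro S′ X (kSub-size S X k) (⊆-erase-v X x (kSub-⊆ {k = suc j} S X k)))
              (¬T⇒not λ a → not⇒¬T (∧-snd {kSubsetsOf (suc j) S X} (∧-fst {F X} p)) (shadowed X (∧-fst {∂ A X} (link⊑del-∂ v A X a))))
            where
            x = del-∉ v F X p
            k = ∧-fst {kSubsetsOf (suc j) S X} (∧-fst {F X} p)

        card-S : ∀ k → card (kSubsetsOf k S) ≡ (q ℕ.+ suc j) C k
        card-S k = ≡.trans (card-kSubsets k S) (≡.cong (_C k) size)

        m≤ : ⟨ m ⟩ ≤ fromℕ 2 * ε * N j
        m≤ = missing-B ε (N⁻ j) (M j) (N j) ⟨ m ⟩ ⟨ x ⟩ ⟨ y ⟩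
            (≤-respʳ (fromℕ-+ x y) (fromℕ-mono m-split)) missingB′ missingA′ (N≈N⁻+M j) 0≤ε
          where
          x = card (kSubsetsOf j S′ ∖ᶠ B′)
          y = card (kSubsetsOf (suc j) S′ ∖ᶠ A′)

        iB iA : ℕ
        iB = card (B ∩ᶠ kSubsetsOf (suc j) S)
        iA = card (A ∩ᶠ kSubsetsOf (suc (suc j)) S)

        inside-split : ∀ {n} (F G : Family n) → card G ≡ card (F ∩ᶠ G) ℕ.+ card (G ∖ᶠ F)
        inside-split F G = ≡.trans (card-split G F) (≡.cong (ℕ._+ card (G ∖ᶠ F)) (card-ext {F = G ∩ᶠ F} {G = F ∩ᶠ G}
          (λ X p → ∧-intro (∧-snd {G X} p) (∧-fst p)) (λ X p → ∧-intro (∧-snd {F X} p) (∧-fst p))))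

        b-split : b ≈ ⟨ iB ⟩ + ⟨ eo ⟩
        b-split = fromℕ-split iB eo (card-split B (kSubsetsOf (suc j) S))

        N₂-split : N (suc j) ≈ ⟨ iB ⟩ + ⟨ m ⟩
        N₂-split = fromℕ-split iB m (≡.trans (≡.sym (card-S (suc j))) (inside-split B (kSubsetsOf (suc j) S)))

        eo≤ : ⟨ eo ⟩ ≤ fromℕ 12 * ε * N j
        eo≤ = outside-B ε (N j) (N (suc j)) b ⟨ iB ⟩ ⟨ m ⟩ ⟨ eo ⟩ b-split N₂-split m≤ upper

        -- The exterior families have uniformity j + 1 after linking, yet the factor must be j + 2,
        -- the one in `ratio`. This is the factor regained by `gap`, whose smallness hypothesis is
        -- provided by `eo≤`.
        E₂-eo : (J + fromℕ 2) * ⟨ E₂ ⟩ ≤ Q * ⟨ eo ⟩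
        E₂-eo = *-cancelˡ-≤ (*-pos (positive {5} (ℕ.s≤s ℕ.z≤n)) 0<J+1) (outside-A₁ Q J ⟨ eo ⟩ ⟨ card (∂ P.G) ⟩ ⟨ E₂ ⟩
            (≤-respˡ (*-congˡ (reflexive (≡.cong ⟨_⟩ P.cardG))) (gap q j P.G P.uniform (≤-trans (*-mono-≤ˡ (0≤fromℕ 20) ∂≤) (outside-few ε (N j) ⟨ eo ⟩ eo≤ (scale-240 ε ε-small) (0≤N j)))))
            ∂≤ (proj₁ 0<Q) 0≤J (0≤fromℕ eo))
          where
          module P = ShadowPair (outside-pair S uniformA uniformB shadowed)
          ∂≤ : ⟨ card (∂ P.G) ⟩ ≤ ⟨ eo ⟩
          ∂≤ = fromℕ-mono (ℕₚ.≤-trans (card-mono P.shadowed) P.cardH)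
          0<J+1 : 0# < J + 1#
          0<J+1 = 1≤⇒0< (≤-respˡ (+-identityˡ 1#) (+-mono-≤ 0≤J ≤-refl))
          *-pos : ∀ {x y} → 0# < x → 0# < y → 0# < x * y
          *-pos (h , x≉0) (k , y≉0) = *-nonneg h k , λ e → y≉0 (sym (*-cancel-≈0 (λ z → x≉0 (sym z)) (sym e)))

        0<J+2 : 0# < J + fromℕ 2
        0<J+2 = 1≤⇒0< (≤-respˡ (+-identityˡ 1#) (+-mono-≤ 0≤J (1≤fromℕ {2} (ℕ.s≤s ℕ.z≤n))))

        0<J+1 : 0# < J + 1#
        0<J+1 = 1≤⇒0< (≤-respˡ (+-identityˡ 1#) (+-mono-≤ 0≤J ≤-refl))

        E₂≤ : ⟨ E₂ ⟩ ≤ fromℕ 12 * ε * M (suc j)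
        E₂≤ = *-cancelˡ-≤ 0<J+2 (outside-A₂ Q J ε (N j) (M (suc j)) ⟨ eo ⟩ ⟨ E₂ ⟩ E₂-eo eo≤ (M-suc j) 0≤ε (0≤M (suc j)) (proj₁ 0<Q))

        -- In `ratio` the sets of `A` outside `S` are paid for by those of `B` outside `S` through
        -- `E₂-eo`. What remains bounds the sets missing from `A` by those missing from `B` and the
        -- deficiency.
        Mm≤ : ⟨ Mm ⟩ ≤ fromℕ 2 * ε * M (suc j)
        Mm≤ = *-cancelˡ-≤ 0<J+1 (*-cancelˡ-≤ 0<J+2 (missing-A₂ Q J ε ep (N j) (N (suc j)) (M (suc j)) b ⟨ Mm ⟩
            (missing-A₁ Q J ε ep (N j) (N (suc j)) ⟨ (q ℕ.+ suc j) C suc (suc j) ⟩ a b ⟨ iB ⟩ ⟨ eo ⟩ ⟨ m ⟩ ⟨ Mm ⟩ ⟨ iA ⟩ ⟨ E₂ ⟩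
              (≤-respʳ (+-congʳ (*-congʳ (suc-two J))) ratio) b-split N₂-split (fromℕ-split iA E₂ (card-split A (kSubsetsOf (suc (suc j)) S)))
              (fromℕ-split iA Mm (≡.trans (≡.sym (card-S (suc (suc j)))) (inside-split A (kSubsetsOf (suc (suc j)) S))))
              (trans (*-congʳ (trans (sym (suc-two J)) (suc-one ⟨ suc j ⟩))) (trans (*-congˡ (choose-M (suc j))) (M-suc (suc j)))) E₂-eo m≤ 0≤J (proj₁ 0<Q))
            upper (scale-10 ε ε-small) N-mono (N-suc j) ep-small′ (M-suc j) 0≤ep 0≤J (0≤N j) 0≤ε))
          where
          N-mono : N j ≤ N (suc j)
          N-mono = ≤-respʳ (sym (N≈N⁻+M (suc j))) (≤-respˡ (+-identityʳ (N j)) (+-mono-≤ ≤-refl (0≤M (suc j))))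

        close : Close (suc j) A B
        close = record { S = S ; size = size ; covered = covered ; missingB = m≤ ; missingA = Mm≤ }

      descend : ∀ {n} j {ep} {A B : Family n} (hyp : Hypotheses (suc j) ep A B) → Hypotheses j ep (Descent.A′ j hyp) (Descent.B′ j hyp)
      descend j hyp = record
        { uniformA = link-uniform v uniformA ; uniformB = link-uniform v uniformB ; shadowed = ∂-link⊑ v shadowed
        ; nonempty = proj₁ (proj₂ chosen) ; ratio = proj₂ (proj₂ chosen) ; upper = link-upper j hyp ; 0≤ep = 0≤ep ; ep-small = ep-small⁻ }
        where open Descent j hyp

      stability : ∀ {n} r {ep} {A B : Family n} → Hypotheses r ep A B → Close r A B
      stability zero hyp = base hyp
      stability (suc j) hyp = Ascent.close j hyp (stability j (descend j hyp))

      -- The exterior of `A` is not part of `Close`, since the induction never passes it upwards; it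
      -- is read off at the top level alone.
      stability⁺ : ∀ {n} j {ep} {A B : Family n} → Hypotheses (suc j) ep A B →
        ∃ λ (c : Close (suc j) A B) → ⟨ card (A ∖ᶠ kSubsetsOf (suc (suc j)) (Close.S c)) ⟩ ≤ fromℕ 12 * ε * M (suc j)
      stability⁺ j hyp = Ascent.close j hyp c , Ascent.E₂≤ j hyp c
        where c = stability j (descend j hyp)

-- Certificates for locating x near an integer.

module LocationArithmetic where
  open RealArithmetic

  module LocationCertificates (R : CompleteOrderedField) where
    open Certificates R

    deficiency = certify 12 (λ s x p Q r b B C w c E g →
      x * (p * b) ≤ (x + c) * w ∷ C + B ≤ b ∷ s * r * E + (# 1 - g) * Q * E ≤ s * (p * B) ∷ w ≈ Q * C + (r + # 1) * E ∷ p ≈ Q + g ∷ # 0 ≤ s ∷ # 0 ≤ x ∷ # 0 ≤ p ∷ # 0 ≤ C ∷ [] ⊢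
      x * (s * (g * C - E) + (# 1 - g) * Q * E) ≼ s * c * w)
      0 ((1 , 0 ∷ 7 ∷ []) ∷ (1 , 1 ∷ 7 ∷ 8 ∷ 9 ∷ []) ∷ (1 , 2 ∷ 8 ∷ []) ∷ (1 , 3 ∷ 7 ∷ 8 ∷ []) ∷ (1 , 6 ∷ 7 ∷ 8 ∷ 10 ∷ []) ∷ []) ≡.refl
    wide₁ = certify 8 (λ x Q r C w c E g →
      x * ((Q + r) * (g * C - E) + (# 1 - g) * Q * E) ≤ (Q + r) * c * w ∷ w ≈ Q * C + (r + # 1) * E ∷ Q + r ≤ x ∷ E ≤ g * C ∷ g ≤ # 1 ∷ # 0 ≤ g ∷ r + # 1 ≤ # 10 * Q ∷ # 0 ≤ Q ∷ # 0 ≤ c ∷ # 0 ≤ C ∷ # 0 ≤ E ∷ # 0 ≤ x ∷ # 0 ≤ r ∷ # 0 ≤ w ∷ [] ⊢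
      x * Q * C * (g * (# 1 - g)) ≼ x * Q * C * (# 11 * c))
      0 ((1 , 0 ∷ []) ∷ (1 , 1 ∷ 9 ∷ 12 ∷ []) ∷ (1 , 3 ∷ 9 ∷ 14 ∷ []) ∷ (1 , 4 ∷ 6 ∷ 8 ∷ 12 ∷ []) ∷ (10 , 4 ∷ 8 ∷ 9 ∷ 12 ∷ []) ∷ (1 , 4 ∷ 12 ∷ 13 ∷ []) ∷ (10 , 5 ∷ 8 ∷ 9 ∷ 10 ∷ 12 ∷ []) ∷ (1 , 7 ∷ 9 ∷ 11 ∷ 12 ∷ []) ∷ []) ≡.refl
    -- For g ≤ 1/2 the first hypothesis gives g ≤ 22 c, and r + 1 ≤ 10 Q gives Q + r ≤ 11 Q; hence
    -- the constant 250, just above 22 · 11.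
    wide₂ = certify 4 (λ Q r c g →
      g * (# 1 - g) ≤ # 11 * c ∷ # 2 * g ≤ # 1 ∷ # 0 ≤ g ∷ r + # 1 ≤ # 10 * Q ∷ # 0 ≤ Q ∷ # 0 ≤ r ∷ # 0 ≤ c ∷ [] ⊢
      (Q + r) * g ≼ # 250 * c * Q)
      21 ((6 , 0 ∷ []) ∷ (50 , 0 ∷ 3 ∷ []) ∷ (50 , 0 ∷ 5 ∷ []) ∷ (3 , 1 ∷ 2 ∷ []) ∷ (25 , 1 ∷ 2 ∷ 3 ∷ []) ∷ (25 , 1 ∷ 2 ∷ 5 ∷ []) ∷ (22 , 2 ∷ 3 ∷ []) ∷ (8 , 2 ∷ 4 ∷ []) ∷ (484 , 6 ∷ []) ∷ []) ≡.refl
    wide₃ = certify 4 (λ Q r c g →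
      g * (# 1 - g) ≤ # 11 * c ∷ # 1 ≤ # 2 * g ∷ g ≤ # 1 ∷ r + # 1 ≤ # 10 * Q ∷ # 0 ≤ Q ∷ # 0 ≤ r ∷ # 0 ≤ c ∷ [] ⊢
      (Q + r) * (# 1 - g) ≼ # 250 * c * Q)
      21 ((6 , 0 ∷ []) ∷ (50 , 0 ∷ 3 ∷ []) ∷ (50 , 0 ∷ 5 ∷ []) ∷ (3 , 1 ∷ 2 ∷ []) ∷ (25 , 1 ∷ 2 ∷ 3 ∷ []) ∷ (25 , 1 ∷ 2 ∷ 5 ∷ []) ∷ (22 , 2 ∷ 3 ∷ []) ∷ (8 , 2 ∷ 4 ∷ []) ∷ (484 , 6 ∷ []) ∷ []) ≡.refl
    narrow₁ = certify 8 (λ x Q r C w c E g →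
      x * ((Q + r) * (g * C - E) + (# 1 - g) * Q * E) ≤ (Q + r) * c * w ∷ g ≤ # 1 ∷ # 0 ≤ Q ∷ # 0 ≤ E ∷ # 0 ≤ x ∷ [] ⊢
      (Q + r) * (x * (g * C - E)) ≼ (Q + r) * (c * w))
      0 ((1 , 0 ∷ []) ∷ (1 , 1 ∷ 2 ∷ 3 ∷ 4 ∷ []) ∷ []) ≡.refl
    narrow₂ = certify 6 (λ Q r C E g d →
      d * (g * (# 1 - g) * C) ≤ # 2 * ((r + # 1) * (g * C - E)) ∷ # 10 * Q ≤ r + # 1 ∷ # 0 ≤ g ∷ g ≤ # 1 ∷ # 0 ≤ C ∷ d ≈ r + # 1 - Q ∷ [] ⊢
      (r + # 1) * (# 9 * (g * (# 1 - g) * C)) ≼ (r + # 1) * (# 20 * (g * C - E)))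
      0 ((10 , 0 ∷ []) ∷ (1 , 1 ∷ 2 ∷ 3 ∷ 4 ∷ []) ∷ (10 , 2 ∷ 3 ∷ 4 ∷ 6 ∷ []) ∷ []) ≡.refl
    narrow₃ = certify 8 (λ x Q r C w c E g →
      x * (g * C - E) ≤ c * w ∷ w ≈ Q * C + (r + # 1) * E ∷ E ≤ g * C ∷ # 9 * (g * (# 1 - g) * C) ≤ # 20 * (g * C - E) ∷ Q + r ≤ x ∷ # 1 ≤ Q ∷ # 0 ≤ g ∷ g ≤ # 1 ∷ # 0 ≤ c ∷ # 0 ≤ C ∷ # 0 ≤ x ∷ # 0 ≤ r ∷ [] ⊢
      C * (# 9 * (Q + r) * (g * (# 1 - g))) ≼ C * (# 20 * c * (Q + (Q + r) * g)))
      0 ((20 , 0 ∷ []) ∷ (20 , 1 ∷ 9 ∷ []) ∷ (20 , 3 ∷ 9 ∷ []) ∷ (20 , 3 ∷ 9 ∷ 12 ∷ []) ∷ (1 , 4 ∷ 11 ∷ []) ∷ (9 , 5 ∷ 7 ∷ 8 ∷ 10 ∷ []) ∷ (20 , 6 ∷ 7 ∷ 9 ∷ 10 ∷ []) ∷ []) ≡.refl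
    narrow₄ = certify 4 (λ Q r c g →
      # 9 * (Q + r) * (g * (# 1 - g)) ≤ # 20 * c * (Q + (Q + r) * g) ∷ # 2 * g ≤ # 1 ∷ # 40 * c ≤ # 1 ∷ # 0 ≤ g ∷ # 0 ≤ Q ∷ # 0 ≤ r ∷ # 0 ≤ c ∷ [] ⊢
      (Q + r) * g ≼ # 250 * c * Q)
      7 ((2 , 0 ∷ []) ∷ (9 , 1 ∷ 3 ∷ 4 ∷ []) ∷ (9 , 1 ∷ 3 ∷ 5 ∷ []) ∷ (1 , 2 ∷ 3 ∷ 4 ∷ []) ∷ (1 , 2 ∷ 3 ∷ 5 ∷ []) ∷ (1960 , 4 ∷ 6 ∷ []) ∷ []) ≡.refl
    narrow₅ = certify 4 (λ Q r c g →
      # 9 * (Q + r) * (g * (# 1 - g)) ≤ # 20 * c * (Q + (Q + r) * g) ∷ # 1 ≤ # 2 * g ∷ g ≤ # 1 ∷ # 0 ≤ Q ∷ # 0 ≤ r ∷ # 0 ≤ c ∷ [] ⊢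
      (Q + r) * (# 9 * (# 1 - g)) ≼ (Q + r) * (# 80 * c))
      0 ((2 , 0 ∷ []) ∷ (9 , 1 ∷ 2 ∷ 3 ∷ []) ∷ (9 , 1 ∷ 2 ∷ 4 ∷ []) ∷ (40 , 2 ∷ 3 ∷ 5 ∷ []) ∷ (40 , 2 ∷ 4 ∷ 5 ∷ []) ∷ (40 , 4 ∷ 5 ∷ []) ∷ []) ≡.refl
    narrow₆ = certify 8 (λ x Q r C w c E g →
      x * (g * C - E) ≤ c * w ∷ w ≈ Q * C + (r + # 1) * E ∷ E ≤ C ∷ Q + r ≤ x ∷ # 1 ≤ Q ∷ # 0 ≤ c ∷ # 0 ≤ C ∷ # 0 ≤ r ∷ [] ⊢
      x * (g * C - E) ≼ x * (# 2 * c * C))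
      0 ((1 , 0 ∷ []) ∷ (1 , 1 ∷ 6 ∷ []) ∷ (1 , 3 ∷ 6 ∷ []) ∷ (1 , 3 ∷ 6 ∷ 8 ∷ []) ∷ (2 , 4 ∷ 6 ∷ 7 ∷ []) ∷ (1 , 5 ∷ 6 ∷ 7 ∷ []) ∷ (1 , 6 ∷ 7 ∷ 8 ∷ []) ∷ []) ≡.refl
    narrow₇ = certify 5 (λ C c E g F →
      F ≈ C - E ∷ g * C - E ≤ # 2 * c * C ∷ # 9 * (# 1 - g) ≤ # 80 * c ∷ # 0 ≤ C ∷ # 0 ≤ c ∷ [] ⊢
      F ≼ # 11 * c * C)
      8 ((9 , 0 ∷ []) ∷ (9 , 2 ∷ []) ∷ (1 , 3 ∷ 4 ∷ []) ∷ (1 , 4 ∷ 5 ∷ []) ∷ []) ≡.refl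
    narrow₈ = certify 5 (λ C c E g F →
      F ≈ C - E ∷ # 9 * (g * (# 1 - g) * C) ≤ # 20 * (g * C - E) ∷ # 9 * (# 1 - g) ≤ # 80 * c ∷ # 1000 * c ≤ # 1 ∷ g ≤ # 1 ∷ # 0 ≤ C ∷ [] ⊢
      # 7 * ((# 1 - g) * C) ≼ # 5 * F)
      99 ((500 , 1 ∷ []) ∷ (25 , 2 ∷ []) ∷ (25 , 3 ∷ 5 ∷ 6 ∷ []) ∷ (2 , 4 ∷ 5 ∷ 6 ∷ []) ∷ (23 , 5 ∷ 6 ∷ []) ∷ []) ≡.refl
    comp₁ = certify 10 (λ Q r C F G N b w p t →
      (Q + # 1) * N ≈ (Q + r + # 1) * C ∷ N ≤ G + b ∷ w ≈ (Q + r + # 1) * C - (r + # 1) * F ∷ # 10 * Q * (Q + # 1) * G ≤ r * (# 10 * Q - # 9) * F ∷ p ≈ Q + # 1 - t ∷ # 0 ≤ Q ∷ # 0 ≤ b ∷ [] ⊢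
      (# 10 * Q + # 9 * r) * F ≼ # 10 * Q * (p * b - w + t * b))
      0 ((10 , 1 ∷ 8 ∷ []) ∷ (10 , 2 ∷ 8 ∷ []) ∷ (10 , 2 ∷ 8 ∷ 8 ∷ []) ∷ (10 , 3 ∷ 8 ∷ []) ∷ (1 , 5 ∷ []) ∷ (10 , 7 ∷ 8 ∷ 9 ∷ []) ∷ []) ≡.refl
    comp₂ = certify 8 (λ x Q r C b w p c →
      x * (p * b) ≤ (x + c) * w ∷ w ≤ (Q + r + # 1) * C ∷ Q + r ≤ x ∷ # 1 ≤ Q ∷ # 0 ≤ r ∷ # 0 ≤ c ∷ # 0 ≤ C ∷ [] ⊢
      x * (p * b - w) ≼ x * (# 2 * c * C))
      0 ((1 , 0 ∷ []) ∷ (1 , 1 ∷ 5 ∷ []) ∷ (2 , 2 ∷ 5 ∷ 6 ∷ []) ∷ (1 , 3 ∷ 5 ∷ 6 ∷ []) ∷ (1 , 4 ∷ 5 ∷ 6 ∷ []) ∷ []) ≡.refl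
    -- It matters that 9/10 · 7/5 exceeds 1: as q is at most (r + 1)/10, the left side (q + 9r/10) ·
    -- (7/5) t C outweighs the main part (q + r + 1) t C of q t b. A positive multiple of (q + r) t
    -- C remains and is bounded by a multiple of c q C.
    comp₃ = certify 9 (λ Q r C F b w p t c →
      (# 10 * Q + # 9 * r) * F ≤ # 10 * Q * (p * b - w + t * b) ∷ p * b - w ≤ # 2 * c * C ∷ w ≤ (Q + r + # 1) * C ∷ # 7 * (t * C) ≤ # 5 * F ∷ Q ≤ p ∷ # 0 ≤ Q ∷ # 0 ≤ t ∷ # 0 ≤ b ∷ # 10 * Q ≤ r + # 1 ∷ # 1 ≤ Q ∷ # 1000 * c ≤ # 1 ∷ # 0 ≤ C ∷ [] ⊢
      C * ((Q + r) * t) ≼ C * (# 250 * c * Q))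
      3 ((50 , 0 ∷ []) ∷ (500 , 1 ∷ 5 ∷ []) ∷ (500 , 1 ∷ 6 ∷ []) ∷ (500 , 2 ∷ 6 ∷ []) ∷ (910 , 3 ∷ []) ∷ (90 , 3 ∷ 8 ∷ []) ∷ (1000 , 3 ∷ 9 ∷ []) ∷ (500 , 4 ∷ 6 ∷ 7 ∷ []) ∷ (126 , 6 ∷ 8 ∷ 11 ∷ []) ∷ (1456 , 6 ∷ 9 ∷ 11 ∷ []) ∷ (1 , 6 ∷ 10 ∷ 11 ∷ []) ∷ (829 , 6 ∷ 11 ∷ []) ∷ []) ≡.refl
    surplus-le = certify 5 (λ Q r C F w →
      w ≈ (Q + r + # 1) * C - (r + # 1) * F ∷ # 0 ≤ F ∷ # 0 ≤ r ∷ [] ⊢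
      w ≼ (Q + r + # 1) * C)
      0 ((1 , 0 ∷ []) ∷ (1 , 2 ∷ []) ∷ (1 , 2 ∷ 3 ∷ []) ∷ []) ≡.refl
    left-ratio = certify 8 (λ x Q r g b w c ep →
      x * ((Q + g) * b) ≤ (x + c) * w ∷ Q + r ≤ x ∷ ep * (Q + r) ≈ # 1000 * c * Q ∷ # 0 ≤ ep ∷ # 0 ≤ b ∷ # 0 ≤ x ∷ # 0 ≤ g ∷ # 0 ≤ c ∷ # 0 ≤ Q ∷ [] ⊢
      (x + c) * (Q * b) ≼ (x + c) * (w + ep * b))
      0 ((1 , 0 ∷ []) ∷ (1 , 1 ∷ 4 ∷ 5 ∷ []) ∷ (1 , 3 ∷ 5 ∷ []) ∷ (1 , 4 ∷ 5 ∷ 8 ∷ []) ∷ (1 , 5 ∷ 6 ∷ 7 ∷ []) ∷ (999 , 5 ∷ 8 ∷ 9 ∷ []) ∷ []) ≡.refl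
    left-upper₁ = certify 10 (λ x Q r g b w c p C E →
      x * (p * b) ≤ (x + c) * w ∷ w ≈ Q * C + (r + # 1) * E ∷ E ≤ g * C ∷ p ≈ Q + g ∷ # 0 ≤ x ∷ # 0 ≤ c ∷ # 0 ≤ C ∷ # 0 ≤ r ∷ [] ⊢
      x * (p * b) ≼ (x + c) * ((p + r * g) * C))
      0 ((1 , 0 ∷ []) ∷ (1 , 1 ∷ 6 ∷ []) ∷ (1 , 1 ∷ 7 ∷ []) ∷ (1 , 3 ∷ 6 ∷ []) ∷ (1 , 3 ∷ 6 ∷ 9 ∷ []) ∷ (1 , 3 ∷ 7 ∷ []) ∷ (1 , 3 ∷ 7 ∷ 9 ∷ []) ∷ (1 , 5 ∷ 6 ∷ 8 ∷ []) ∷ (1 , 5 ∷ 7 ∷ 8 ∷ []) ∷ []) ≡.refl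
    left-upper₂ = certify 7 (λ x s Q r g c p →
      s * g ≤ # 250 * c * Q ∷ Q ≤ p ∷ s ≤ x ∷ # 1 ≤ r ∷ # 250 * c ≤ # 1 ∷ # 0 ≤ Q ∷ # 0 ≤ c ∷ # 1 ≤ x ∷ # 0 ≤ p ∷ [] ⊢
      s * (x * r * g + c * p + c * r * g) ≼ # 300 * c * x * p * r)
      0 ((1 , 0 ∷ []) ∷ (1 , 0 ∷ 3 ∷ []) ∷ (1 , 0 ∷ 3 ∷ 6 ∷ []) ∷ (1 , 0 ∷ 3 ∷ 7 ∷ []) ∷ (1 , 0 ∷ 6 ∷ []) ∷ (1 , 0 ∷ 7 ∷ []) ∷ (251 , 1 ∷ 3 ∷ 6 ∷ []) ∷ (250 , 1 ∷ 3 ∷ 6 ∷ 7 ∷ []) ∷ (251 , 1 ∷ 6 ∷ []) ∷ (250 , 1 ∷ 6 ∷ 7 ∷ []) ∷ (1 , 2 ∷ 6 ∷ 8 ∷ []) ∷ (1 , 3 ∷ 4 ∷ 5 ∷ 6 ∷ []) ∷ (50 , 3 ∷ 6 ∷ 7 ∷ 8 ∷ []) ∷ (49 , 3 ∷ 6 ∷ 8 ∷ []) ∷ (1 , 4 ∷ 5 ∷ 6 ∷ []) ∷ (49 , 6 ∷ 7 ∷ 8 ∷ []) ∷ (48 , 6 ∷ 8 ∷ []) ∷ []) ≡.refl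
    left-upper₃ = certify 10 (λ x s r g b c p C C0 e →
      x * (p * b) ≤ (x + c) * ((p + r * g) * C) ∷ s * (x * r * g + c * p + c * r * g) ≤ # 300 * c * x * p * r ∷ s * C0 ≈ r * C ∷ e ≈ # 1000 * c ∷ # 0 ≤ s ∷ # 0 ≤ x ∷ # 0 ≤ p ∷ # 0 ≤ C ∷ # 0 ≤ c ∷ # 0 ≤ r ∷ # 0 ≤ C0 ∷ [] ⊢
      s * (x * p * b) ≼ s * (x * p * (C + # 10 * e * C0)))
      0 ((1 , 0 ∷ 6 ∷ []) ∷ (1 , 1 ∷ 9 ∷ []) ∷ (10000 , 3 ∷ 7 ∷ 8 ∷ 10 ∷ []) ∷ (10 , 5 ∷ 6 ∷ 7 ∷ 8 ∷ 12 ∷ []) ∷ (9700 , 7 ∷ 8 ∷ 9 ∷ 10 ∷ 11 ∷ []) ∷ []) ≡.refl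
    right-ratio = certify 8 (λ x Q t b w c ep s →
      x * ((Q + # 1 - t) * b) ≤ (x + c) * w ∷ ep * (s + # 1) ≈ # 1000 * c * (Q + # 1) ∷ s * t ≤ # 250 * c * Q ∷ s ≤ x ∷ # 0 ≤ x ∷ # 0 ≤ t ∷ # 1 ≤ s ∷ # 0 ≤ Q ∷ # 0 ≤ c ∷ # 0 ≤ b ∷ [] ⊢
      (x + c) * ((s + # 1) * ((Q + # 1) * b)) ≼ (x + c) * ((s + # 1) * (w + ep * b)))
      0 ((2 , 0 ∷ []) ∷ (1 , 0 ∷ 7 ∷ []) ∷ (1 , 2 ∷ 5 ∷ 10 ∷ []) ∷ (1 , 2 ∷ 9 ∷ 10 ∷ []) ∷ (2 , 3 ∷ 5 ∷ 10 ∷ []) ∷ (2 , 4 ∷ 8 ∷ 9 ∷ 10 ∷ []) ∷ (2 , 4 ∷ 9 ∷ 10 ∷ []) ∷ (1 , 5 ∷ 6 ∷ 7 ∷ 10 ∷ []) ∷ (498 , 5 ∷ 8 ∷ 9 ∷ 10 ∷ []) ∷ (998 , 5 ∷ 9 ∷ 10 ∷ []) ∷ (1 , 7 ∷ 8 ∷ 9 ∷ 10 ∷ []) ∷ (1 , 7 ∷ 9 ∷ 10 ∷ []) ∷ (1000 , 8 ∷ 9 ∷ 9 ∷ 10 ∷ []) ∷ (1000 , 9 ∷ 9 ∷ 10 ∷ []) ∷ []) ≡.refl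
    right-upper₁ = certify 8 (λ Q r C F N w t p →
      w ≈ (Q + r + # 1) * C - (r + # 1) * F ∷ t * C ≤ F ∷ (Q + # 1) * N ≈ (Q + r + # 1) * C ∷ p ≈ Q + # 1 - t ∷ N ≤ (r + # 1) * C ∷ # 0 ≤ t ∷ # 0 ≤ r ∷ # 0 ≤ N ∷ [] ⊢
      w ≼ p * N)
      0 ((1 , 0 ∷ []) ∷ (1 , 2 ∷ []) ∷ (1 , 2 ∷ 9 ∷ []) ∷ (1 , 4 ∷ []) ∷ (1 , 6 ∷ 10 ∷ []) ∷ (1 , 7 ∷ 8 ∷ []) ∷ []) ≡.refl
    right-upper₀ = certify 4 (λ Q r C N →
      (Q + # 1) * N ≈ (Q + r + # 1) * C ∷ # 0 ≤ C ∷ # 0 ≤ Q ∷ # 0 ≤ r ∷ [] ⊢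
      (Q + # 1) * N ≼ (Q + # 1) * ((r + # 1) * C))
      0 ((1 , 0 ∷ []) ∷ (1 , 2 ∷ 3 ∷ 4 ∷ []) ∷ []) ≡.refl
    right-upper₂ = certify 6 (λ x b w c p N →
      x * (p * b) ≤ (x + c) * w ∷ w ≤ p * N ∷ # 0 ≤ x ∷ # 0 ≤ c ∷ [] ⊢
      p * (x * b) ≼ p * ((x + c) * N))
      0 ((1 , 0 ∷ []) ∷ (1 , 1 ∷ 2 ∷ []) ∷ (1 , 1 ∷ 3 ∷ []) ∷ []) ≡.refl
    right-upper₃ = certify 8 (λ x Q r b c N N0 e →
      x * b ≤ (x + c) * N ∷ r * N ≈ (Q + # 1 + r) * N0 ∷ Q + r ≤ x ∷ # 1 ≤ x ∷ e ≈ # 1000 * c ∷ # 0 ≤ c ∷ # 1 ≤ r ∷ # 0 ≤ N0 ∷ # 0 ≤ N ∷ # 0 ≤ x ∷ [] ⊢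
      x * b ≼ x * (N + # 10 * e * N0))
      0 ((1 , 0 ∷ []) ∷ (1 , 1 ∷ 7 ∷ []) ∷ (1 , 3 ∷ 7 ∷ 9 ∷ []) ∷ (1 , 4 ∷ 7 ∷ 9 ∷ []) ∷ (10 , 6 ∷ 9 ∷ 11 ∷ []) ∷ (1 , 7 ∷ 8 ∷ 10 ∷ []) ∷ (9998 , 7 ∷ 9 ∷ 11 ∷ []) ∷ []) ≡.refl
    chord₀ = certify 7 (λ f a A0 A1 C E g →
      f * a ≤ (# 1 - (# 1 - g)) * (f * A1) + (# 1 - g) * (f * A0) ∷ a ≈ A0 + E ∷ A1 ≈ C + A0 ∷ # 0 ≤ f ∷ # 0 ≤ g ∷ [] ⊢
      f * E ≼ f * (g * C))
      0 ((1 , 0 ∷ []) ∷ (1 , 2 ∷ 5 ∷ []) ∷ (1 , 3 ∷ 5 ∷ 6 ∷ []) ∷ []) ≡.refl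
    narrow₀ = certify 10 (λ d f a A0 A1 C E g Q r →
      d * ((# 1 - (# 1 - g)) * (# 1 - g) * (f * A1)) ≤ # 2 * (Q + (# 1 + r)) * ((# 1 - (# 1 - g)) * (f * A1) + (# 1 - g) * (f * A0) - f * a) ∷ a ≈ A0 + E ∷ A1 ≈ C + A0 ∷ (r + # 1) * A1 ≈ (Q + r + # 1) * C ∷ # 0 ≤ f ∷ # 0 ≤ g ∷ g ≤ # 1 ∷ # 0 ≤ d ∷ # 0 ≤ Q ∷ # 0 ≤ r ∷ [] ⊢
      f * (Q + (# 1 + r)) * (d * (g * (# 1 - g) * C)) ≼ f * (Q + (# 1 + r)) * (# 2 * ((r + # 1) * (g * C - E))))
      0 ((1 , 0 ∷ []) ∷ (1 , 0 ∷ 12 ∷ []) ∷ (2 , 2 ∷ 7 ∷ []) ∷ (2 , 2 ∷ 7 ∷ 11 ∷ []) ∷ (2 , 2 ∷ 7 ∷ 11 ∷ 12 ∷ []) ∷ (4 , 2 ∷ 7 ∷ 12 ∷ []) ∷ (2 , 2 ∷ 7 ∷ 12 ∷ 12 ∷ []) ∷ (2 , 3 ∷ 7 ∷ 8 ∷ []) ∷ (2 , 3 ∷ 7 ∷ 8 ∷ 11 ∷ []) ∷ (2 , 3 ∷ 7 ∷ 8 ∷ 11 ∷ 12 ∷ []) ∷ (4 , 3 ∷ 7 ∷ 8 ∷ 12 ∷ []) ∷ (2 , 3 ∷ 7 ∷ 8 ∷ 12 ∷ 12 ∷ []) ∷ (1 , 6 ∷ 7 ∷ 8 ∷ 9 ∷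 10 ∷ []) ∷ []) ≡.refl
    der₁ = certify 12 (λ f r1 Z1 Z2 P0 Pa Q1 Y A0 E a g →
      Z1 ≤ (# 1 - (# 1 - g)) * P0 + (# 1 - g) * Z2 ∷ Pa - Z1 ≈ r1 * Q1 ∷ P0 - Z2 ≈ r1 * Y ∷ Pa ≈ r1 * f * a ∷ P0 ≈ r1 * f * A0 ∷ a ≈ A0 + E ∷ g ≤ # 1 ∷ # 0 ≤ r1 ∷ # 0 ≤ f ∷ [] ⊢
      r1 * (f * E) ≼ r1 * (Q1 - (# 1 - g) * Y))
      0 ((1 , 0 ∷ []) ∷ (1 , 1 ∷ []) ∷ (1 , 4 ∷ 11 ∷ []) ∷ (1 , 6 ∷ []) ∷ (1 , 7 ∷ []) ∷ (1 , 10 ∷ 12 ∷ 13 ∷ []) ∷ []) ≡.refl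
    der₂ = certify 8 (λ f s Q X Q1 Y E g →
      f * E ≤ Q1 - (# 1 - g) * Y ∷ s * Y ≈ Q * X ∷ Q1 ≤ X ∷ g ≤ # 1 ∷ # 0 ≤ Q ∷ # 0 ≤ s ∷ [] ⊢
      s * (f * E) ≼ (s - (# 1 - g) * Q) * Q1)
      0 ((1 , 0 ∷ 6 ∷ []) ∷ (1 , 2 ∷ 4 ∷ []) ∷ (1 , 3 ∷ 4 ∷ 5 ∷ []) ∷ []) ≡.refl
    lov₁ = certify 12 (λ s r f E p Z v W b u g Q →
      s * (r * f * E) ≤ (s - (# 1 - g) * Q) * (p * Z) ∷ v * Z ≤ W ∷ W ≤ f * b ∷ # 1 - r * (# 1 - u) ≤ v * u ∷ s * r * (# 1 - u) ≈ (# 1 - g) * Q ∷ # 0 ≤ p ∷ # 0 ≤ Z ∷ # 0 ≤ s ∷ # 0 ≤ u ∷ [] ⊢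
      s * f * (r * E) ≼ s * f * (p * u * b))
      0 ((1 , 0 ∷ []) ∷ (1 , 1 ∷ 6 ∷ 8 ∷ 9 ∷ []) ∷ (1 , 2 ∷ 6 ∷ 8 ∷ 9 ∷ []) ∷ (1 , 3 ∷ 6 ∷ 7 ∷ 8 ∷ []) ∷ (1 , 4 ∷ 6 ∷ 7 ∷ []) ∷ []) ≡.refl
    lov₂ = certify 8 (λ s r E p b u g Q →
      r * E ≤ p * u * b ∷ s * r * (# 1 - u) ≈ (# 1 - g) * Q ∷ # 0 ≤ s ∷ u ≤ # 1 ∷ # 0 ≤ p ∷ # 0 ≤ b ∷ # 0 ≤ E ∷ [] ⊢
      s * r * E + (# 1 - g) * Q * E ≼ s * (p * b))
      0 ((1 , 0 ∷ 3 ∷ []) ∷ (1 , 0 ∷ 3 ∷ 4 ∷ []) ∷ (1 , 2 ∷ 7 ∷ []) ∷ (1 , 3 ∷ 4 ∷ 4 ∷ 5 ∷ 6 ∷ []) ∷ []) ≡.refl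
    omega-lower = certify 5 (λ s r u g Q →
      s * r * (# 1 - u) ≈ (# 1 - g) * Q ∷ # 0 ≤ g ∷ # 0 ≤ Q ∷ Q ≤ s ∷ # 1 ≤ r ∷ # 0 ≤ s ∷ [] ⊢
      s * r * # 0 ≼ s * r * u)
      0 ((1 , 0 ∷ []) ∷ (1 , 2 ∷ 3 ∷ []) ∷ (1 , 4 ∷ []) ∷ (1 , 5 ∷ 6 ∷ []) ∷ []) ≡.refl
    omega-upper = certify 5 (λ s r u g Q →
      s * r * (# 1 - u) ≈ (# 1 - g) * Q ∷ g ≤ # 1 ∷ # 0 ≤ Q ∷ [] ⊢
      s * r * u ≼ s * r * # 1)
      0 ((1 , 1 ∷ []) ∷ (1 , 2 ∷ 3 ∷ []) ∷ []) ≡.refl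
    omega-def = identity 3 (λ k m i → k * (# 1 - (# 1 - m * i)) ≈ m * (k * i)) ≡.refl
    cu-lower = certify 2 (λ Q u →
      # 10 * Q * u ≈ # 10 * Q - # 9 ∷ # 1 ≤ Q ∷ [] ⊢
      # 10 * Q * # 0 ≼ # 10 * Q * u)
      0 ((1 , []) ∷ (1 , 1 ∷ []) ∷ (10 , 2 ∷ []) ∷ []) ≡.refl
    cu-upper = certify 2 (λ Q u →
      # 10 * Q * u ≈ # 10 * Q - # 9 ∷ [] ⊢
      # 10 * Q * u ≼ # 10 * Q * # 1)
      0 ((9 , []) ∷ (1 , 0 ∷ []) ∷ []) ≡.refl
    cu-power = certify 3 (λ Q u v →
      # 10 * Q * u ≈ # 10 * Q - # 9 ∷ # 1 - Q * (# 1 - u) ≤ v ∷ [] ⊢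
      # 1 ≼ # 10 * v)
      0 ((1 , 1 ∷ []) ∷ (10 , 2 ∷ []) ∷ []) ≡.refl
    cu-left = certify 7 (λ v f C W h F c →
      v * (f * C) ≤ W ∷ W ≤ f * h ∷ h ≤ F ∷ # 1 ≤ # 10 * v ∷ F ≤ # 11 * c * C ∷ # 0 ≤ f ∷ # 0 ≤ C ∷ [] ⊢
      f * C ≼ f * (# 110 * c * C))
      0 ((10 , 0 ∷ []) ∷ (10 , 1 ∷ []) ∷ (10 , 2 ∷ 5 ∷ []) ∷ (1 , 3 ∷ 5 ∷ 6 ∷ []) ∷ (10 , 4 ∷ 5 ∷ []) ∷ []) ≡.refl
    cu-absurd = certify 2 (λ C c →
      C ≤ # 110 * c * C ∷ # 1000 * c ≤ # 1 ∷ # 1 ≤ C ∷ [] ⊢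
      # 1 ≼ # 0)
      88 ((100 , 0 ∷ []) ∷ (11 , 1 ∷ []) ∷ (11 , 1 ∷ 2 ∷ []) ∷ (89 , 2 ∷ []) ∷ []) ≡.refl
    cu-right = certify 6 (λ Q G r u h F →
      (# 1 + Q) * G ≤ r * u * h ∷ h ≤ F ∷ # 10 * Q * u ≈ # 10 * Q - # 9 ∷ # 0 ≤ r ∷ # 0 ≤ u ∷ # 0 ≤ Q ∷ # 0 ≤ F ∷ [] ⊢
      # 10 * Q * (Q + # 1) * G ≼ r * (# 10 * Q - # 9) * F)
      0 ((10 , 0 ∷ 6 ∷ []) ∷ (10 , 1 ∷ 4 ∷ 5 ∷ 6 ∷ []) ∷ (1 , 2 ∷ 4 ∷ 7 ∷ []) ∷ []) ≡.refl
    cu-def = identity 3 (λ k m i → k * (m * i) ≈ m * (k * i)) ≡.refl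
    c-1000 = certify 1 (λ c →
      # 1000 * (# 1000 * c) ≤ # 1 ∷ # 0 ≤ c ∷ [] ⊢
      # 1000 * c ≼ # 1)
      999 ((999 , []) ∷ (1 , 0 ∷ []) ∷ []) ≡.refl
    c-250 = certify 1 (λ c →
      # 1000 * (# 1000 * c) ≤ # 1 ∷ # 0 ≤ c ∷ [] ⊢
      # 250 * c ≼ # 1)
      3999 ((3999 , []) ∷ (1 , 0 ∷ []) ∷ []) ≡.refl
    c-40 = certify 1 (λ c →
      # 1000 * (# 1000 * c) ≤ # 1 ∷ # 0 ≤ c ∷ [] ⊢
      # 40 * c ≼ # 1)
      24999 ((24999 , []) ∷ (1 , 0 ∷ []) ∷ []) ≡.refl
    y-chord = identity 2 (λ q y → # 1 + q - (# 1 - (y - q)) ≈ y) ≡.refl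
    y-chord₋₁ = identity 2 (λ q y → q - (# 1 - (y - q)) ≈ y - # 1) ≡.refl
    q-pred = identity 1 (λ q → # 1 + q - # 1 ≈ q) ≡.refl
    y-succ = identity 2 (λ x r → x - (# 1 + r) + # 1 ≈ x - r) ≡.refl
    p-shift = identity 3 (λ x r q → x - r ≈ # 1 + q + (x - (# 1 + r) - q)) ≡.refl
    p-right = identity 3 (λ x r q → x - r ≈ # 1 + q + # 1 - (# 1 - (x - (# 1 + r) - q))) ≡.refl
    x-shift = identity 3 (λ x r q → x - (# 1 + q + r) ≈ x - (# 1 + r) - q) ≡.refl
    s-regroup = identity 2 (λ q r → q + (# 1 + r) ≈ # 1 + q + r) ≡.refl
    w-split = identity 3 (λ r A E → (# 1 + r) * (A + E) ≈ (r + # 1) * A + (r + # 1) * E) ≡.refl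
    one-comm = identity 1 (λ q → # 1 + q ≈ q + # 1) ≡.refl
    g-≤1 = certify 2 (λ y q →
      y ≤ # 1 + q ∷ [] ⊢
      y - q ≼ # 1)
      0 ((1 , 0 ∷ []) ∷ []) ≡.refl
    EC = certify 3 (λ C E g →
      E ≤ g * C ∷ g ≤ # 1 ∷ # 0 ≤ C ∷ [] ⊢
      E ≼ C)
      0 ((1 , 0 ∷ []) ∷ (1 , 1 ∷ 2 ∷ []) ∷ []) ≡.refl
    F-split = certify 6 (λ F C E A0 A1 a →
      F + a ≈ A1 ∷ A1 ≈ C + A0 ∷ a ≈ A0 + E ∷ [] ⊢
      F ≼ C - E)
      0 ((1 , 0 ∷ []) ∷ (1 , 2 ∷ []) ∷ (1 , 5 ∷ []) ∷ []) ≡.refl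
    F-split′ = certify 6 (λ F C E A0 A1 a →
      F + a ≈ A1 ∷ A1 ≈ C + A0 ∷ a ≈ A0 + E ∷ [] ⊢
      C - E ≼ F)
      0 ((1 , 1 ∷ []) ∷ (1 , 3 ∷ []) ∷ (1 , 4 ∷ []) ∷ []) ≡.refl
    w-comp = certify 6 (λ Q r C E F w →
      w ≈ Q * C + (r + # 1) * E ∷ F ≈ C - E ∷ # 0 ≤ r ∷ [] ⊢
      w ≼ (Q + r + # 1) * C - (r + # 1) * F)
      0 ((1 , 0 ∷ []) ∷ (1 , 2 ∷ []) ∷ (1 , 2 ∷ 4 ∷ []) ∷ []) ≡.refl
    w-comp′ = certify 6 (λ Q r C E F w →
      w ≈ Q * C + (r + # 1) * E ∷ F ≈ C - E ∷ # 0 ≤ r ∷ [] ⊢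
      (Q + r + # 1) * C - (r + # 1) * F ≼ w)
      0 ((1 , 1 ∷ []) ∷ (1 , 3 ∷ []) ∷ (1 , 3 ∷ 4 ∷ []) ∷ []) ≡.refl
    gC≥F = certify 4 (λ C E g F →
      F ≈ C - E ∷ E ≤ g * C ∷ [] ⊢
      (# 1 - g) * C ≼ F)
      0 ((1 , 1 ∷ []) ∷ (1 , 2 ∷ []) ∷ []) ≡.refl
    ten-q = certify 2 (λ q r →
      # 10 * q ≤ r + # 1 ∷ # 0 ≤ q ∷ [] ⊢
      q ≼ # 1 + r)
      0 ((1 , 0 ∷ []) ∷ (9 , 1 ∷ []) ∷ []) ≡.refl
    r≥1Q = certify 2 (λ r Q →
      # 1 ≤ Q ∷ # 0 ≤ r ∷ [] ⊢
      # 1 ≼ Q + r)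
      0 ((1 , 0 ∷ []) ∷ (1 , 1 ∷ []) ∷ []) ≡.refl
    ratio-index = identity 2 (λ q r → # 1 + q + r + # 1 ≈ q + # 1 + (# 1 + r)) ≡.refl
    s-right = identity 2 (λ q r → # 1 + q + r ≈ q + r + # 1) ≡.refl
    one-sub = identity 1 (λ g → g ≈ # 1 - (# 1 - g)) ≡.refl
    cancel-Q = identity 2 (λ q d → q + d - q ≈ d) ≡.refl

-- Rising factorials: monotonicity, convexity and its quantitative form.

module RisingFactorials where
  open RealArithmetic
  open LovászBound

  module RisingCertificates (R : CompleteOrderedField) where
    open Certificates R

    shift-factor = identity 2 (λ y i → y + (# 1 + i) ≈ y + # 1 + i) ≡.refl
    shift-assoc = identity 3 (λ a b c → a * b * c ≈ a * (b * c)) ≡.refl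
    shift-base = identity 1 (λ y → # 1 * (y + (# 1 + # 0)) ≈ (y + # 1) * # 1) ≡.refl
    peel = identity 2 (λ x m → x - (# 1 + m) + # 1 ≈ x - m) ≡.refl
    pred-succ = identity 1 (λ y → y - # 1 + # 1 ≈ y) ≡.refl
    pascal-diff = identity 3 (λ X y i → X * (y + i) - y * X ≈ i * X) ≡.refl
    one-le-mul = certify 2 (λ a b →
      # 1 ≤ a ∷ # 1 ≤ b ∷ [] ⊢
      # 1 ≼ a * b)
      0 ((1 , 0 ∷ []) ∷ (1 , 0 ∷ 1 ∷ []) ∷ (1 , 1 ∷ []) ∷ []) ≡.refl
    chord-step = certify 6 (λ X Y Z u t i →
      Z ≤ (# 1 - t) * X + t * Y ∷ t ≤ # 1 ∷ # 0 ≤ t ∷ Y ≤ X ∷ # 0 ≤ u ∷ # 1 ≤ i ∷ [] ⊢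
      Z * (u - t + i) ≼ (# 1 - t) * (X * (u + i)) + t * (Y * (u - # 1 + i)))
      0 ((1 , 0 ∷ 1 ∷ []) ∷ (1 , 0 ∷ 4 ∷ []) ∷ (1 , 0 ∷ 5 ∷ []) ∷ (1 , 1 ∷ 2 ∷ 3 ∷ []) ∷ []) ≡.refl
    chord-base = identity 1 (λ t → # 1 ≈ (# 1 - t) * # 1 + t * # 1) ≡.refl
    gap-step = certify 7 (λ X Y Z q t m d →
      d * ((# 1 - t) * t * X) ≤ # 2 * (q + m) * ((# 1 - t) * X + t * Y - Z) ∷ Z ≤ (# 1 - t) * X + t * Y ∷ # 2 * Y ≤ X ∷ # 0 ≤ q ∷ # 0 ≤ m ∷ t ≤ # 1 ∷ # 0 ≤ t ∷ [] ⊢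
      (# 1 + d) * ((# 1 - t) * t * (X * (q + (# 1 + m)))) ≼ # 2 * (q + (# 1 + m)) * ((# 1 - t) * (X * (q + (# 1 + m))) + t * (Y * (q - # 1 + (# 1 + m))) - Z * (q - t + (# 1 + m))))
      0 ((1 , 0 ∷ []) ∷ (1 , 0 ∷ 3 ∷ []) ∷ (1 , 0 ∷ 4 ∷ []) ∷ (2 , 1 ∷ 3 ∷ 5 ∷ []) ∷ (2 , 1 ∷ 4 ∷ 5 ∷ []) ∷ (2 , 1 ∷ 5 ∷ []) ∷ (1 , 2 ∷ 3 ∷ 5 ∷ 6 ∷ []) ∷ (1 , 2 ∷ 4 ∷ 5 ∷ 6 ∷ []) ∷ (1 , 2 ∷ 5 ∷ 6 ∷ []) ∷ []) ≡.refl
    gap-half = certify 4 (λ X Y q m →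
      Y * (q + m) ≈ q * X ∷ q ≤ m ∷ # 0 ≤ X ∷ [] ⊢
      (q + m) * (# 2 * Y) ≼ (q + m) * X)
      0 ((2 , 0 ∷ []) ∷ (1 , 2 ∷ 3 ∷ []) ∷ []) ≡.refl
    gap-zero = certify 6 (λ X Y Z q t m →
      Z ≤ (# 1 - t) * X + t * Y ∷ # 0 ≤ q ∷ # 0 ≤ m ∷ [] ⊢
      # 0 * ((# 1 - t) * t * X) ≼ # 2 * (q + m) * ((# 1 - t) * X + t * Y - Z))
      0 ((2 , 0 ∷ 1 ∷ []) ∷ (2 , 0 ∷ 2 ∷ []) ∷ []) ≡.refl
    regroup-pred = identity 3 (λ Y q m → Y * (q - # 1 + (# 1 + m)) ≈ Y * (q + m)) ≡.refl
    factor-mono = certify 5 (λ X Y y z i →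
      # 0 ≤ X ∷ X ≤ Y ∷ # 0 ≤ y + # 1 ∷ y ≤ z ∷ # 1 ≤ i ∷ [] ⊢
      X * (y + i) ≼ Y * (z + i))
      0 ((1 , 0 ∷ 3 ∷ []) ∷ (1 , 1 ∷ 2 ∷ []) ∷ (1 , 1 ∷ 3 ∷ []) ∷ (1 , 1 ∷ 4 ∷ []) ∷ []) ≡.refl
    factor-nonneg = certify 2 (λ y i →
      # 0 ≤ y + # 1 ∷ # 1 ≤ i ∷ [] ⊢
      # 0 ≼ y + i)
      0 ((1 , 0 ∷ []) ∷ (1 , 1 ∷ []) ∷ []) ≡.refl
    factor-≥1 = certify 2 (λ y i →
      # 0 ≤ y ∷ # 1 ≤ i ∷ [] ⊢
      # 1 ≼ y + i)
      0 ((1 , 0 ∷ []) ∷ (1 , 1 ∷ []) ∷ []) ≡.refl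
    cancel-pred = identity 1 (λ u → # 1 ≈ u - (u - # 1)) ≡.refl

  module Rising (R : CompleteOrderedField) where
    open CompleteOrderedField R hiding (zero)
    open OrderedField R
    open Lovász R
    open RisingCertificates R

    rising-cong : ∀ {y z} m → y ≈ z → rising y m ≈ rising z m
    rising-cong zero e = refl
    rising-cong (suc m) e = *-cong (rising-cong m e) (+-congʳ e)

    rising-shift : ∀ y m → rising y (suc m) ≈ (y + 1#) * rising (y + 1#) m
    rising-shift y zero = shift-base y
    rising-shift y (suc m) = trans (*-cong (rising-shift y m) (shift-factor y ⟨ suc m ⟩)) (shift-assoc (y + 1#) (rising (y + 1#) m) _)

    falling-rising : ∀ m x → falling x m ≈ rising (x - ⟨ m ⟩) m
    falling-rising zero x = refl
    falling-rising (suc m) x = trans (*-congʳ (falling-rising m x)) (trans (*-comm _ _) (sym (trans (rising-shift (x - ⟨ suc m ⟩) m)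
      (*-cong (peel x ⟨ m ⟩) (rising-cong m (peel x ⟨ m ⟩))))))

    rising-pred : ∀ y m → rising (y - 1#) (suc m) ≈ y * rising y m
    rising-pred y m = trans (rising-shift (y - 1#) m) (*-cong (pred-succ y) (rising-cong m (pred-succ y)))

    rising-pascal : ∀ y m → rising y (suc m) - rising (y - 1#) (suc m) ≈ ⟨ suc m ⟩ * rising y m
    rising-pascal y m = trans (+-congˡ (-‿cong (rising-pred y m))) (pascal-diff (rising y m) y ⟨ suc m ⟩)

    1≤suc : ∀ m → 1# ≤ ⟨ suc m ⟩
    1≤suc m = 1≤fromℕ {suc m} (ℕ.s≤s ℕ.z≤n)

    rising-nonneg₋₁ : ∀ y m → 0# ≤ y + 1# → 0# ≤ rising y m
    rising-nonneg₋₁ y zero h = 0≤1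
    rising-nonneg₋₁ y (suc m) h = *-nonneg (rising-nonneg₋₁ y m h) (factor-nonneg y ⟨ suc m ⟩ h (1≤suc m))

    rising-mono : ∀ {y z} m → 0# ≤ y + 1# → y ≤ z → rising y m ≤ rising z m
    rising-mono zero h k = ≤-refl
    rising-mono {y} {z} (suc m) h k = factor-mono (rising y m) (rising z m) y z ⟨ suc m ⟩ (rising-nonneg₋₁ y m h) (rising-mono m h k) h k (1≤suc m)

    1≤rising : ∀ y m → 0# ≤ y → 1# ≤ rising y m
    1≤rising y zero h = ≤-refl
    1≤rising y (suc m) h = one-le-mul _ _ (1≤rising y m h) (factor-≥1 y ⟨ suc m ⟩ h (1≤suc m))

    pred-≤ : ∀ u → u - 1# ≤ u
    pred-≤ u = ≥0- (≤-respʳ (cancel-pred u) 0≤1)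

    -- y ↦ Π (y + i) is convex, so on [u - 1, u] it lies below its chord.
    chord : ∀ u t m → 0# ≤ u → 0# ≤ t → t ≤ 1# → rising (u - t) m ≤ (1# - t) * rising u m + t * rising (u - 1#) m
    chord u t zero 0≤u 0≤t t≤1 = ≤-reflexive (chord-base t)
    chord u t (suc m) 0≤u 0≤t t≤1 = chord-step (rising u m) (rising (u - 1#) m) (rising (u - t) m) u t ⟨ suc m ⟩
      (chord u t m 0≤u 0≤t t≤1) t≤1 0≤t (rising-mono m (≤-respʳ (sym (pred-succ u)) 0≤u) (pred-≤ u)) 0≤u (1≤suc m)

    -- Each new factor increases the distance below the chord by t (1 - t)(X - Y), where X and Y are
    -- the products at Q and Q - 1. Once there are at least Q factors, Y ≤ X / 2, so each of the d
    -- further factors contributes a definite share.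
    chord-gap : ∀ q d t → 0# ≤ t → t ≤ 1# → let Q = ⟨ suc q ⟩ ; m = suc q ℕ.+ d in
      ⟨ d ⟩ * ((1# - t) * t * rising Q m) ≤ fromℕ 2 * (Q + ⟨ m ⟩) * ((1# - t) * rising Q m + t * rising (Q - 1#) m - rising (Q - t) m)
    chord-gap q zero t 0≤t t≤1 = gap-zero _ _ _ _ t _ (chord ⟨ suc q ⟩ t (suc q ℕ.+ 0) (0≤fromℕ (suc q)) 0≤t t≤1) (0≤fromℕ (suc q)) (0≤fromℕ (suc q ℕ.+ 0))
    chord-gap q (suc d) t 0≤t t≤1 = ≡.subst (λ k → ⟨ suc d ⟩ * ((1# - t) * t * rising Q k) ≤ fromℕ 2 * (Q + ⟨ k ⟩) * ((1# - t) * rising Q k + t * rising (Q - 1#) k - rising (Q - t) k))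
        (≡.sym (ℕₚ.+-suc (suc q) d))
        (gap-step (rising Q m) (rising (Q - 1#) m) (rising (Q - t) m) Q t ⟨ m ⟩ ⟨ d ⟩ (chord-gap q d t 0≤t t≤1)
          (chord Q t m (0≤fromℕ (suc q)) 0≤t t≤1)
          (*-cancelˡ-≤ 0<Q+m (gap-half (rising Q m) (rising (Q - 1#) m) Q ⟨ m ⟩
            (trans (sym (regroup-pred (rising (Q - 1#) m) Q ⟨ m ⟩)) (rising-pred Q m)) (fromℕ-mono (ℕₚ.m≤m+n (suc q) d)) (rising-nonneg Q m (0≤fromℕ (suc q)))))
          (0≤fromℕ (suc q)) (0≤fromℕ m) t≤1 0≤t)
      where
      Q = ⟨ suc q ⟩
      m = suc q ℕ.+ d
      0<Q+m : 0# < Q + ⟨ m ⟩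
      0<Q+m = 1≤⇒0< (≤-respʳ (fromℕ-+ (suc q) m) (1≤fromℕ {suc q ℕ.+ m} (ℕ.s≤s ℕ.z≤n)))

-- A nearly minimal shadow forces x to be close to an integer.

module ShadowLocation where
  open Families
  open InitialSegments
  open RealArithmetic
  open LovászBound
  open CliqueStability
  open LocationArithmetic
  open RisingFactorials
  open import Data.Nat.Combinatorics using (nCk≡nC[n∸k])
  open import Data.Sum using ([_,_]′)

  -- Let |A| = C(x, k) = C(s, k) + E with s = q + r ≤ x = s + g ≤ s + 1 (k = r + 1).  By convexity E ≤ g C(s, r), while the shadow
  -- hypothesis bounds g C(s, r) - E and (1 - g) E from above, so that g (1 - g), and then g or 1 - g, is O(c q / s).  When q is
  -- small compared with r this needs the quantitative convexity chord-gap and, near s + 1, Lovász's theorem for the complement.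
  module Locations (R : CompleteOrderedField) where
    open CompleteOrderedField R hiding (zero)
    open OrderedField R
    open Lovász R
    open Rising R
    open Chains R
    open LocationCertificates R
    open LovászCertificates R using (cancel-tail)
    open RisingCertificates R using (one-le-mul)
    open ChainCertificates R using (suc-one; suc-two)

    module Location (q′ r′ : ℕ) {n : ℕ} (A : Family n) (uniform : Uniform (suc (suc r′)) A) (x c : Carrier)
      (0≤c : 0# ≤ c) (c-small : fromℕ 1000 * (fromℕ 1000 * c) ≤ 1#) (r+1≤x : ⟨ suc (suc r′) ⟩ ≤ x)
      (card-A : rising (x - ⟨ suc (suc r′) ⟩) (suc (suc r′)) ≈ ⟨ suc (suc r′) ! ⟩ * ⟨ card A ⟩)
      (shadow-A : x * ((x - ⟨ suc r′ ⟩) * ⟨ card (∂ A) ⟩) ≤ (x + c) * (⟨ suc (suc r′) ⟩ * ⟨ card A ⟩))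
      (lo : (suc q′ ℕ.+ suc r′) C suc (suc r′) ℕ.≤ card A)
      (hi : card A ℕ.< suc (suc q′ ℕ.+ suc r′) C suc (suc r′)) where
      open Binomials R q′

      r s : ℕ
      r = suc r′
      s = q ℕ.+ r

      ρ S y g p a b w f Cₛ A₀ A₁ : Carrier
      ρ = ⟨ r ⟩
      S = Q + ρ
      y = x - ⟨ suc r ⟩
      g = y - ⟨ q′ ⟩
      p = x - ρ
      a = ⟨ card A ⟩
      b = ⟨ card (∂ A) ⟩
      w = ⟨ suc r ⟩ * a
      f = ⟨ r ! ⟩
      Cₛ = N r
      A₀ = ⟨ s C suc r ⟩
      A₁ = ⟨ suc s C suc r ⟩

      Eℕ : ℕ
      Eℕ = card A ℕ.∸ s C suc r

      E : Carrier
      E = ⟨ Eℕ ⟩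

      0≤Q : 0# ≤ Q
      0≤Q = 0≤fromℕ q
      0≤ρ : 0# ≤ ρ
      0≤ρ = 0≤fromℕ r
      0≤C : 0# ≤ Cₛ
      0≤C = 0≤N r
      0≤E : 0# ≤ E
      0≤E = 0≤fromℕ Eℕ
      0≤b : 0# ≤ b
      0≤b = 0≤fromℕ (card (∂ A))
      1≤Q : 1# ≤ Q
      1≤Q = 1≤fromℕ {q} (ℕ.s≤s ℕ.z≤n)
      1≤ρ : 1# ≤ ρ
      1≤ρ = 1≤fromℕ {r} (ℕ.s≤s ℕ.z≤n)
      1≤C : 1# ≤ Cₛ
      1≤C = 1≤fromℕ (nCk>0 q r)
      0<F! : 0# < ⟨ suc r ! ⟩
      0<F! = !-positive (suc r)

      0≤y : 0# ≤ y
      0≤y = -≥0 r+1≤x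

      a-split : a ≈ A₀ + E
      a-split = trans (reflexive (≡.cong ⟨_⟩ (≡.sym (ℕₚ.m+[n∸m]≡n lo)))) (fromℕ-+ (s C suc r) Eℕ)

      A₁-split : A₁ ≈ Cₛ + A₀
      A₁-split = trans (reflexive (≡.cong ⟨_⟩ (≡.sym (Pascal s r)))) (fromℕ-+ (s C r) (s C suc r))

      rising-Q : rising Q (suc r) ≈ ⟨ suc r ! ⟩ * A₁
      rising-Q = trans (rising-binomial q (suc r)) (*-congˡ (reflexive (≡.cong (λ m → ⟨ m C suc r ⟩) (ℕₚ.+-suc q r))))

      rising-q′ : rising ⟨ q′ ⟩ (suc r) ≈ ⟨ suc r ! ⟩ * A₀
      rising-q′ = trans (rising-binomial q′ (suc r)) (*-congˡ (reflexive (≡.cong (λ m → ⟨ m C suc r ⟩) (ℕₚ.+-suc q′ r))))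

      rising-cancel : ∀ {u z} → 0# ≤ u → u ≤ z → rising z (suc r) ≤ rising u (suc r) → z ≤ u
      rising-cancel {u} {z} 0≤u u≤z h = drop-suc (*-cancelˡ-≤ (1≤⇒0< (1≤rising u r 0≤u)) (≤-trans
          (≤-respˡ (*-comm _ _) (≤-respʳ (*-comm _ _) (*-mono-≤ˡ (+-nonneg (≤-trans 0≤u u≤z) (0≤fromℕ (suc r))) (rising-mono r (+-nonneg 0≤u 0≤1) u≤z)))) h))
        where
        drop-suc : z + ⟨ suc r ⟩ ≤ u + ⟨ suc r ⟩ → z ≤ u
        drop-suc k = cancel-tail z ⟨ suc r ⟩ u ⟨ suc r ⟩ k ≤-refl

      q′≤y : ⟨ q′ ⟩ ≤ y
      q′≤y = [ (λ h → h) , (λ h → rising-cancel 0≤y h (≤-respˡ (sym rising-q′) (≤-respʳ (sym card-A) (*-mono-≤ˡ (0≤fromℕ (suc r !)) (fromℕ-mono lo))))) ]′ (total ⟨ q′ ⟩ y)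

      y≤Q : y ≤ Q
      y≤Q = [ (λ h → h) , (λ h → ⊥-elim (ℕₚ.<⇒≱ hi (fromℕ-reflect (*-cancelˡ-≤ 0<F!
          (≤-respˡ rising-Q (≤-respʳ card-A (rising-mono (suc r) (+-nonneg 0≤Q 0≤1) h))))))) ]′ (total y Q)

      0≤g : 0# ≤ g
      0≤g = -≥0 q′≤y
      g≤1 : g ≤ 1#
      g≤1 = g-≤1 y ⟨ q′ ⟩ y≤Q
      0≤t : 0# ≤ 1# - g
      0≤t = -≥0 g≤1
      t≤1 : 1# - g ≤ 1#
      t≤1 = ≥0- (≤-respʳ (one-sub g) 0≤g)

      p≈ : p ≈ Q + g
      p≈ = p-shift x ρ ⟨ q′ ⟩

      S≤x : S ≤ x
      S≤x = ≥0- (≤-respʳ (sym (x-shift x ρ ⟨ q′ ⟩)) 0≤g)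

      0≤S : 0# ≤ S
      0≤S = +-nonneg 0≤Q 0≤ρ
      1≤S : 1# ≤ S
      1≤S = r≥1Q ρ Q 1≤Q 0≤ρ
      1≤x : 1# ≤ x
      1≤x = ≤-trans 1≤S S≤x
      0≤x : 0# ≤ x
      0≤x = ≤-trans 0≤1 1≤x
      0<x : 0# < x
      0<x = 1≤⇒0< 1≤x
      0<S : 0# < S
      0<S = 1≤⇒0< 1≤S
      Q≤p : Q ≤ p
      Q≤p = ≤-respˡ (+-identityʳ Q) (≤-respʳ (sym p≈) (+-mono-≤ ≤-refl 0≤g))
      0≤p : 0# ≤ p
      0≤p = ≤-trans 0≤Q Q≤p
      0<p : 0# < p
      0<p = 1≤⇒0< (≤-trans 1≤Q Q≤p)
      Q≤S : Q ≤ S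
      Q≤S = ≤-respˡ (+-identityʳ Q) (+-mono-≤ ≤-refl 0≤ρ)

      chord-A : ⟨ suc r ! ⟩ * a ≤ (1# - (1# - g)) * (⟨ suc r ! ⟩ * A₁) + (1# - g) * (⟨ suc r ! ⟩ * A₀)
      chord-A = ≤-respˡ (trans (rising-cong (suc r) (y-chord ⟨ q′ ⟩ y)) card-A) (≤-respʳ (+-cong (*-congˡ rising-Q) (*-congˡ (trans (rising-cong (suc r) (q-pred ⟨ q′ ⟩)) rising-q′)))
        (chord Q (1# - g) (suc r) 0≤Q 0≤t t≤1))

      E≤gC : E ≤ g * Cₛ
      E≤gC = *-cancelˡ-≤ 0<F! (chord₀ ⟨ suc r ! ⟩ a A₀ A₁ Cₛ E g chord-A a-split A₁-split (0≤fromℕ (suc r !)) 0≤g)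

      E≤C : E ≤ Cₛ
      E≤C = EC Cₛ E g E≤gC g≤1 0≤C

      w≈ : w ≈ Q * Cₛ + (ρ + 1#) * E
      w≈ = trans (*-congˡ a-split) (trans (w-split ρ A₀ E) (+-congʳ (trans (*-congˡ (choose-M r)) (M-suc r))))

      A₁-rel : (ρ + 1#) * A₁ ≈ (Q + ρ + 1#) * Cₛ
      A₁-rel = trans (*-congˡ (reflexive (≡.cong (λ m → ⟨ m C suc r ⟩) (≡.sym (ℕₚ.+-suc q r))))) (N-suc r)

      0≤w : 0# ≤ w
      0≤w = *-nonneg (0≤fromℕ (suc r)) (0≤fromℕ (card A))

      -- The factor u = 1 - (1 - g) q / (s r) moves p to a point at which Lovász's theorem still applies to E r-sets.
      u : Carrier
      u = 1# - (1# - g) * Q * ((S * ρ) ⁻¹)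

      u-rel : S * ρ * (1# - u) ≈ (1# - g) * Q
      u-rel = trans (omega-def (S * ρ) ((1# - g) * Q) ((S * ρ) ⁻¹)) (trans (*-congˡ (⁻¹-inverse (S * ρ) (λ e → proj₂ 0<S (sym (*-cancel-≈0 (0<⇒≉0 (1≤⇒0< 1≤ρ)) (trans (*-comm ρ S) e))))))
        (*-identityʳ _))

      0<Sρ : 0# < S * ρ
      0<Sρ = 1≤⇒0< (one-le-mul S ρ 1≤S 1≤ρ)

      0≤u : 0# ≤ u
      0≤u = *-cancelˡ-≤ 0<Sρ (omega-lower S ρ u g Q u-rel 0≤g 0≤Q Q≤S 1≤ρ 0≤S)

      u≤1 : u ≤ 1#
      u≤1 = *-cancelˡ-≤ 0<Sρ (omega-upper S ρ u g Q u-rel g≤1 0≤Q)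

      Q₁ Z : Carrier
      Q₁ = rising y r
      Z = rising p r′

      Q₁≈ : Q₁ ≈ p * Z
      Q₁≈ = trans (rising-shift y r′) (*-cong (y-succ x ρ) (rising-cong r′ (y-succ x ρ)))

      -- Pascal's rule at the real point x turns the chord bound for C(x - 1, r + 1) into E ≤ C(x -
      -- 1, r) - (1 - g) C(s - 1, r). The last binomial coefficient is q / s times C(s, r), and C(s,
      -- r) is at least C(x - 1, r).
      few-E : S * (f * E) ≤ (S - (1# - g) * Q) * Q₁
      few-E = der₂ f S Q (rising Q r) Q₁ (rising ⟨ q′ ⟩ r) E g
          (*-cancelˡ-≤ (positive {suc r} (ℕ.s≤s ℕ.z≤n)) (der₁ f ⟨ suc r ⟩ (rising (y - 1#) (suc r)) (rising (⟨ q′ ⟩ - 1#) (suc r)) (rising ⟨ q′ ⟩ (suc r)) (rising y (suc r))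
            Q₁ (rising ⟨ q′ ⟩ r) A₀ E a g
            (≤-respˡ (rising-cong (suc r) (y-chord₋₁ ⟨ q′ ⟩ y)) (chord ⟨ q′ ⟩ (1# - g) (suc r) (0≤fromℕ q′) 0≤t t≤1))
            (rising-pascal y r) (rising-pascal ⟨ q′ ⟩ r) (trans card-A (*-congʳ (fromℕ-* (suc r) (r !)))) (trans rising-q′ (*-congʳ (fromℕ-* (suc r) (r !))))
            a-split g≤1 (0≤fromℕ (suc r)) (0≤fromℕ (r !))))
          (trans (trans (*-comm _ _) (*-congˡ (sym (s-regroup ⟨ q′ ⟩ ρ)))) (trans (rising-shift ⟨ q′ ⟩ r) (*-cong (sym (one-comm ⟨ q′ ⟩)) (rising-cong r (sym (one-comm ⟨ q′ ⟩))))))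
          (rising-mono r (+-nonneg 0≤y 0≤1) y≤Q) g≤1 0≤Q 0≤S

      surplus-pair : ∃ λ (L : Family (suc s)) → Uniform r L × card L ≡ Eℕ × card (∂ L) ℕ.+ s C r ℕ.≤ card (∂ A)
      surplus-pair = kk-surplus s r Eℕ uniform (λ _ h → h) (ℕₚ.m<n+m r (ℕ.s≤s ℕ.z≤n)) (fromℕ-reflect E≤C) (ℕₚ.≤-reflexive (ℕₚ.m+[n∸m]≡n lo))

      L : Family (suc s)
      L = proj₁ surplus-pair

      B′ : Carrier
      B′ = ⟨ card (∂ L) ⟩

      C+B′≤b : Cₛ + B′ ≤ b
      C+B′≤b = ≤-respˡ (trans (fromℕ-+ (card (∂ L)) (s C r)) (+-comm _ _)) (fromℕ-mono (proj₂ (proj₂ (proj₂ surplus-pair))))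

      -- By the choice of `u`, Bernoulli's term r (1 - u) is exactly (1 - g) q / s, the proportion
      -- by which `few-E` keeps E below C(x - 1, r). So even the first alternative of `lovász`
      -- yields the same inequality.
      lovász-L : ρ * E ≤ p * u * B′
      lovász-L = [ high , (λ ok → ≤-respˡ (*-congˡ (reflexive (≡.cong ⟨_⟩ (proj₁ (proj₂ (proj₂ surplus-pair)))))) ok) ]′
          (lovász (p * u) r′ L (*-nonneg 0≤p 0≤u) (proj₁ (proj₂ surplus-pair)))
        where
        f′ = ⟨ r′ ! ⟩
        0<Sf : 0# < S * f′
        0<Sf = *-nonneg 0≤S (0≤fromℕ (r′ !)) , λ e → proj₂ (!-positive r′) (sym (*-cancel-≈0 (0<⇒≉0 0<S) (sym e)))
        high : rising (p * u) r′ ≤ f′ * B′ → ρ * E ≤ p * u * B′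
        high h = *-cancelˡ-≤ 0<Sf (lov₁ S ρ f′ E p Z (power u r′) (rising (p * u) r′) B′ u g Q
          (≤-respˡ (*-congˡ (*-congʳ (fromℕ-* r (r′ !)))) (≤-respʳ (*-congˡ Q₁≈) few-E))
          (rising-scale p u r′ 0≤p 0≤u u≤1) h (bernoulli u r 0≤u) u-rel 0≤p (rising-nonneg p r′ 0≤p) 0≤S 0≤u)

      -- Here p C - w = g C - (r + 1) E, while `lovász-L` gives p B′ ≥ r E + (1 - g) q E / s. Adding
      -- the two bounds p |∂A| - w from below, and the shadow hypothesis bounds it above by c w / x.
      -- Both summands on the left are nonnegative, so each is small.
      deficit : x * (S * (g * Cₛ - E) + (1# - g) * Q * E) ≤ S * c * w
      deficit = deficiency S x p Q ρ b B′ Cₛ w c E g shadow-A C+B′≤b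
        (lov₂ S ρ E p B′ u g Q lovász-L u-rel 0≤S u≤1 0≤p (0≤fromℕ (card (∂ L))) 0≤E)
        w≈ p≈ 0≤S 0≤x 0≤p 0≤C

      1000c≤1 : fromℕ 1000 * c ≤ 1#
      1000c≤1 = c-1000 c c-small 0≤c

      Near : Set
      Near = (S * g ≤ fromℕ 250 * c * Q) ⊎ (S * (1# - g) ≤ fromℕ 250 * c * Q)

      0<C : 0# < Cₛ
      0<C = 1≤⇒0< 1≤C

      wide : ρ + 1# ≤ fromℕ 10 * Q → Near
      wide h = [ (λ k → inj₁ (wide₂ Q ρ c g balance k 0≤g h 0≤Q 0≤ρ 0≤c)) , (λ k → inj₂ (wide₃ Q ρ c g balance k g≤1 h 0≤Q 0≤ρ 0≤c)) ]′ (total (fromℕ 2 * g) 1#)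
        where
        balance : g * (1# - g) ≤ fromℕ 11 * c
        balance = *-cancelˡ-≤ (1≤⇒0< (one-le-mul (x * Q) Cₛ (one-le-mul x Q 1≤x 1≤Q) 1≤C))
          (wide₁ x Q ρ Cₛ w c E g deficit w≈ S≤x E≤gC g≤1 0≤g h 0≤Q 0≤c 0≤C 0≤E 0≤x 0≤ρ 0≤w)

      N′ : Carrier
      N′ = ⟨ (suc q ℕ.+ r) C r ⟩

      symmetric : (r ℕ.+ q) C q ≡ s C r
      symmetric = ≡.trans (nCk≡nC[n∸k] (ℕₚ.m≤n+m q r)) (≡.cong₂ _C_ (ℕₚ.+-comm r q) (ℕₚ.m+n∸n≡m r q))

      N′-rel : (Q + 1#) * N′ ≈ (Q + ρ + 1#) * Cₛ
      N′-rel = trans (trans (*-congʳ (sym (one-comm Q))) (trans (sym (fromℕ-* (suc q) ((suc q ℕ.+ r) C r))) (reflexive (≡.cong ⟨_⟩ swap)))) (trans (fromℕ-* (suc s) (s C r)) (*-congʳ (trans (suc-one ⟨ s ⟩) (+-congʳ (fromℕ-+ q r)))))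
        where
        complement-index : (suc q ℕ.+ r) C r ≡ suc (r ℕ.+ q) C suc q
        complement-index = ≡.trans (nCk≡nC[n∸k] (ℕₚ.m≤n+m r (suc q))) (≡.cong₂ _C_ (≡.cong suc (ℕₚ.+-comm q r)) (ℕₚ.m+n∸n≡m (suc q) r))
        swap : suc q ℕ.* ((suc q ℕ.+ r) C r) ≡ suc s ℕ.* (s C r)
        swap = ≡.trans (≡.cong (suc q ℕ.*_) complement-index) (≡.trans (absorption (r ℕ.+ q) q) (≡.cong₂ (λ m k → suc m ℕ.* k) (ℕₚ.+-comm r q) symmetric))

      module Narrow (10q≤ : fromℕ 10 * Q ≤ ρ + 1#) where
        xh≤cw : x * (g * Cₛ - E) ≤ c * w
        xh≤cw = *-cancelˡ-≤ 0<S (narrow₁ x Q ρ Cₛ w c E g deficit g≤1 0≤Q 0≤E 0≤x)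

        d : ℕ
        d = suc r ℕ.∸ q

        q≤suc-r : q ℕ.≤ suc r
        q≤suc-r = fromℕ-reflect (ten-q Q ρ 10q≤ 0≤Q)

        ⟨d⟩ : ⟨ d ⟩ ≈ ρ + 1# - Q
        ⟨d⟩ = sym (trans (+-congʳ (trans (sym (one-comm ρ)) (trans (reflexive (≡.cong ⟨_⟩ (≡.sym (ℕₚ.m+[n∸m]≡n q≤suc-r)))) (fromℕ-+ q d)))) (cancel-Q Q ⟨ d ⟩))

        gap-A : ⟨ d ⟩ * ((1# - (1# - g)) * (1# - g) * (⟨ suc r ! ⟩ * A₁)) ≤
                fromℕ 2 * (Q + (1# + ρ)) * ((1# - (1# - g)) * (⟨ suc r ! ⟩ * A₁) + (1# - g) * (⟨ suc r ! ⟩ * A₀) - ⟨ suc r ! ⟩ * a)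
        gap-A = ≤-respˡ (*-congˡ (*-congˡ rising-Q)) (≤-respʳ (*-congˡ (+-cong (+-cong (*-congˡ rising-Q) (*-congˡ (trans (rising-cong (suc r) (q-pred ⟨ q′ ⟩)) rising-q′)))
            (-‿cong (trans (rising-cong (suc r) (y-chord ⟨ q′ ⟩ y)) card-A))))
          (≡.subst (λ m → ⟨ d ⟩ * ((1# - (1# - g)) * (1# - g) * rising Q m) ≤ fromℕ 2 * (Q + ⟨ m ⟩) * ((1# - (1# - g)) * rising Q m + (1# - g) * rising (Q - 1#) m - rising (Q - (1# - g)) m))
            (ℕₚ.m+[n∸m]≡n q≤suc-r) (chord-gap q′ d (1# - g) 0≤t t≤1)))

        balance₀ : ⟨ d ⟩ * (g * (1# - g) * Cₛ) ≤ fromℕ 2 * ((ρ + 1#) * (g * Cₛ - E))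
        balance₀ = *-cancelˡ-≤ (*-nonneg (proj₁ 0<F!) 0≤Q+ , λ e → proj₂ (1≤⇒0< 1≤Q+) (sym (*-cancel-≈0 (0<⇒≉0 0<F!) (sym e))))
          (narrow₀ ⟨ d ⟩ ⟨ suc r ! ⟩ a A₀ A₁ Cₛ E g Q ρ gap-A a-split A₁-split A₁-rel (0≤fromℕ (suc r !)) 0≤g g≤1 (0≤fromℕ d) 0≤Q 0≤ρ)
          where
          1≤Q+ : 1# ≤ Q + (1# + ρ)
          1≤Q+ = ≤-respˡ (+-identityˡ 1#) (+-mono-≤ 0≤Q (≤-respˡ (+-identityʳ 1#) (+-mono-≤ ≤-refl 0≤ρ)))
          0≤Q+ : 0# ≤ Q + (1# + ρ)
          0≤Q+ = ≤-trans 0≤1 1≤Q+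

        1≤ρ+1 : 1# ≤ ρ + 1#
        1≤ρ+1 = ≤-respˡ (+-identityˡ 1#) (+-mono-≤ 0≤ρ ≤-refl)

        -- Here d = r + 1 - q is at least 9/10 of r + 1, because 10 q ≤ r + 1.
        balance₁ : fromℕ 9 * (g * (1# - g) * Cₛ) ≤ fromℕ 20 * (g * Cₛ - E)
        balance₁ = *-cancelˡ-≤ (1≤⇒0< 1≤ρ+1) (narrow₂ Q ρ Cₛ E g ⟨ d ⟩ balance₀ 10q≤ 0≤g g≤1 0≤C ⟨d⟩)

        balance : fromℕ 9 * S * (g * (1# - g)) ≤ fromℕ 20 * c * (Q + S * g)
        balance = *-cancelˡ-≤ 0<C (narrow₃ x Q ρ Cₛ w c E g xh≤cw w≈ E≤gC balance₁ S≤x 1≤Q 0≤g g≤1 0≤c 0≤C 0≤x 0≤ρ)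

        -- In this half `balance` yields only 1 - g = O(c), without the factor q / s. To gain that
        -- factor Lovász's theorem is applied to complements, whose uniformity q + 1 is small and
        -- for which the few missing sets play the part of the shadow.
        module Above (1≤2g : 1# ≤ fromℕ 2 * g) where
          9t≤80c : fromℕ 9 * (1# - g) ≤ fromℕ 80 * c
          9t≤80c = *-cancelˡ-≤ 0<S (narrow₅ Q ρ c g balance 1≤2g g≤1 0≤Q 0≤ρ 0≤c)

          h≤2cC : g * Cₛ - E ≤ fromℕ 2 * c * Cₛ
          h≤2cC = *-cancelˡ-≤ 0<x (narrow₆ x Q ρ Cₛ w c E g xh≤cw w≈ E≤C S≤x 1≤Q 0≤c 0≤C 0≤ρ)

          complement : ∃ λ (G : Family (suc q ℕ.+ r)) → ∃ λ (H : Family (suc q ℕ.+ r)) →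
            Uniform (suc q) G × ∂ G ⊑ H × card H ℕ.+ card A ≡ (suc q ℕ.+ r) C suc r × (suc q ℕ.+ r) C r ℕ.≤ card G ℕ.+ card (∂ A)
          complement = complement-pair q r uniform (λ _ h → h) (ℕₚ.<⇒≤ hi)

          G : Family (suc q ℕ.+ r)
          G = proj₁ complement

          H : Family (suc q ℕ.+ r)
          H = proj₁ (proj₂ complement)

          props : Uniform (suc q) G × ∂ G ⊑ H × card H ℕ.+ card A ≡ (suc q ℕ.+ r) C suc r × (suc q ℕ.+ r) C r ℕ.≤ card G ℕ.+ card (∂ A)
          props = proj₂ (proj₂ complement)

          F h G# : Carrier
          F = ⟨ card H ⟩
          h = ⟨ card (∂ G) ⟩
          G# = ⟨ card G ⟩

          F+a : F + a ≈ A₁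
          F+a = trans (sym (fromℕ-+ (card H) (card A))) (reflexive (≡.cong ⟨_⟩ (proj₁ (proj₂ (proj₂ props)))))

          F≈ : F ≈ Cₛ - E
          F≈ = antisym (F-split F Cₛ E A₀ A₁ a F+a A₁-split a-split) (F-split′ F Cₛ E A₀ A₁ a F+a A₁-split a-split)

          h≤F : h ≤ F
          h≤F = fromℕ-mono (card-mono (proj₁ (proj₂ props)))

          0≤F : 0# ≤ F
          0≤F = 0≤fromℕ (card H)

          F≤11cC : F ≤ fromℕ 11 * c * Cₛ
          F≤11cC = narrow₇ Cₛ c E g F F≈ h≤2cC 9t≤80c 0≤C 0≤c

          -- F = (1 - g) C + (g C - E), and by `balance₁` the second term is at least 9/20 g (1 - g)
          -- C with g close to 1. Convexity alone would give the factor 1, too weak against the loss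
          -- 9/10 in `complement-lovász`.
          7tC≤5F : fromℕ 7 * ((1# - g) * Cₛ) ≤ fromℕ 5 * F
          7tC≤5F = narrow₈ Cₛ c E g F F≈ balance₁ 9t≤80c 1000c≤1 g≤1 0≤C

          0<10Q : 0# < fromℕ 10 * Q
          0<10Q = 1≤⇒0< (one-le-mul (fromℕ 10) Q (1≤fromℕ {10} (ℕ.s≤s ℕ.z≤n)) 1≤Q)

          u′ : Carrier
          u′ = (fromℕ 10 * Q - fromℕ 9) * ((fromℕ 10 * Q) ⁻¹)

          u′-rel : fromℕ 10 * Q * u′ ≈ fromℕ 10 * Q - fromℕ 9
          u′-rel = trans (cu-def (fromℕ 10 * Q) (fromℕ 10 * Q - fromℕ 9) ((fromℕ 10 * Q) ⁻¹)) (trans (*-congˡ (⁻¹-inverse _ (0<⇒≉0 0<10Q))) (*-identityʳ _))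

          0≤u′ : 0# ≤ u′
          0≤u′ = *-cancelˡ-≤ 0<10Q (cu-lower Q u′ u′-rel 1≤Q)

          u′≤1 : u′ ≤ 1#
          u′≤1 = *-cancelˡ-≤ 0<10Q (cu-upper Q u′ u′-rel)

          -- With u′ = 1 - 9/(10 q), Bernoulli gives u′^q ≥ 1/10. The first alternative would then
          -- make the shadow of `G` at least C / 10, but it lies in `H`, whose size is at most 11 c
          -- C.
          complement-lovász : fromℕ 10 * Q * (Q + 1#) * G# ≤ ρ * (fromℕ 10 * Q - fromℕ 9) * F
          complement-lovász = [ (λ big → ⊥-elim (1≰0 (cu-absurd Cₛ c (*-cancelˡ-≤ (!-positive q) (cu-left (power u′ q) ⟨ q ! ⟩ Cₛ (rising (ρ * u′) q) h F c
                (≤-respˡ (*-congˡ (trans (rising-binomial r q) (*-congˡ (reflexive (≡.cong ⟨_⟩ symmetric))))) (rising-scale ρ u′ q 0≤ρ 0≤u′ u′≤1))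
                big h≤F (cu-power Q u′ (power u′ q) u′-rel (bernoulli u′ q 0≤u′)) F≤11cC (0≤fromℕ (q !)) 0≤C)) 1000c≤1 1≤C)))
              , (λ ok → cu-right Q G# ρ u′ h F ok h≤F u′-rel 0≤ρ 0≤u′ 0≤Q 0≤F) ]′
            (lovász (ρ * u′) q G (*-nonneg 0≤ρ 0≤u′) (proj₁ props))

          w-rel : w ≈ (Q + ρ + 1#) * Cₛ - (ρ + 1#) * F
          w-rel = antisym (w-comp Q ρ Cₛ E F w w≈ F≈ 0≤ρ) (w-comp′ Q ρ Cₛ E F w w≈ F≈ 0≤ρ)

          near : Near
          near = inj₂ (*-cancelˡ-≤ 0<C (comp₃ Q ρ Cₛ F b w p (1# - g) c
            (comp₁ Q ρ Cₛ F G# N′ b w p (1# - g) N′-rel (≤-respʳ (fromℕ-+ (card G) (card (∂ A))) (fromℕ-mono (proj₂ (proj₂ (proj₂ props))))) w-rel complement-lovász (p-right x ρ ⟨ q′ ⟩) 0≤Q 0≤b)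
            (*-cancelˡ-≤ 0<x (comp₂ x Q ρ Cₛ b w p c shadow-A (surplus-le Q ρ Cₛ F w w-rel 0≤F 0≤ρ) S≤x 1≤Q 0≤ρ 0≤c 0≤C))
            (surplus-le Q ρ Cₛ F w w-rel 0≤F 0≤ρ) 7tC≤5F Q≤p 0≤Q 0≤t 0≤b 10q≤ 1≤Q 1000c≤1 0≤C))

        near : Near
        near = [ (λ k → inj₁ (narrow₄ Q ρ c g balance k (c-40 c c-small 0≤c) 0≤g 0≤Q 0≤ρ 0≤c)) , Above.near ]′ (total (fromℕ 2 * g) 1#)

      near : Near
      near = [ wide , Narrow.near ]′ (total (ρ + 1#) (fromℕ 10 * Q))

      ε : Carrier
      ε = fromℕ 1000 * c

      0≤ε : 0# ≤ ε
      0≤ε = *-nonneg (0≤fromℕ 1000) 0≤c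

      module Chainᴸ = Chain q′ ε 0≤ε c-small
      module Chainᴿ = Chain q ε 0≤ε c-small

      1≤b : 1 ℕ.≤ card (∂ A)
      1≤b = fromℕ-reflect (≤-respˡ (sym (+-identityʳ 1#)) (≤-trans (≤-trans 1≤C (≤-respˡ (+-identityʳ Cₛ) (+-mono-≤ ≤-refl (0≤fromℕ (card (∂ L)))))) C+B′≤b))

      0<x+c : 0# < x + c
      0<x+c = 1≤⇒0< (≤-trans 1≤x (≤-respˡ (+-identityʳ x) (+-mono-≤ ≤-refl 0≤c)))

      inverse-nonneg : ∀ {z} → 0# < z → 0# ≤ z ⁻¹
      inverse-nonneg {z} h = *-cancel-nonneg h (≤-respʳ (sym (⁻¹-inverse z (0<⇒≉0 h))) 0≤1)

      divided : ∀ k {z} → 0# < z → k * (z ⁻¹) * z ≈ k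
      divided k {z} h = trans (*-assoc k (z ⁻¹) z) (trans (*-congˡ (trans (*-comm (z ⁻¹) z) (⁻¹-inverse z (0<⇒≉0 h)))) (*-identityʳ k))

      -- `ep` is taken as large as `ep-small` permits. On this side the ratio follows from p ≥ q,
      -- and the closeness `h` serves the upper bound. In `right` the roles are exchanged: x ≤ s + 1
      -- takes care of the upper bound, and `h` is spent on the ratio.
      left : S * g ≤ fromℕ 250 * c * Q → ∃ λ ep → Chainᴸ.Hypotheses r ep A (∂ A)
      left h = ep , record
        { uniformA = uniform ; uniformB = ∂-uniform uniform ; shadowed = λ _ z → z ; nonempty = 1≤b
        ; ratio = *-cancelˡ-≤ 0<x+c (left-ratio x Q ρ g b w c ep (≤-respˡ (*-congˡ (*-congʳ p≈)) shadow-A) S≤x ep-rel 0≤ep 0≤b 0≤x 0≤g 0≤c 0≤Q)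
        ; upper = *-cancelˡ-≤ (*-pos 0<x 0<p) (*-cancelˡ-≤ 0<S (left-upper₃ x S ρ g b c p Cₛ (N r′) ε
              (left-upper₁ x Q ρ g b w c p Cₛ E shadow-A w≈ E≤gC p≈ 0≤x 0≤c 0≤C 0≤ρ)
              (left-upper₂ x S Q ρ g c p h Q≤p S≤x 1≤ρ (c-250 c c-small 0≤c) 0≤Q 0≤c 1≤x 0≤p)
              C-rel refl 0≤S 0≤x 0≤p 0≤C 0≤c 0≤ρ (0≤N r′)))
        ; 0≤ep = 0≤ep ; ep-small = ≤-reflexive ep-rel }
        where
        ep : Carrier
        ep = fromℕ 1000 * c * Q * (S ⁻¹)
        ep-rel : ep * S ≈ fromℕ 1000 * c * Q
        ep-rel = divided (fromℕ 1000 * c * Q) 0<S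
        0≤ep : 0# ≤ ep
        0≤ep = *-nonneg (*-nonneg 0≤ε 0≤Q) (inverse-nonneg 0<S)
        *-pos : ∀ {x y} → 0# < x → 0# < y → 0# < x * y
        *-pos (h , x≉0) (k , y≉0) = *-nonneg h k , λ e → y≉0 (sym (*-cancel-≈0 (λ z → x≉0 (sym z)) (sym e)))
        C-rel : S * N r′ ≈ ρ * Cₛ
        C-rel = trans (*-congʳ (trans (+-congˡ (one-comm ⟨ r′ ⟩)) (sym (+-assoc Q ⟨ r′ ⟩ 1#)))) (trans (sym (N-suc r′)) (*-congʳ (sym (one-comm ⟨ r′ ⟩))))

      right : S * (1# - g) ≤ fromℕ 250 * c * Q → ∃ λ ep → Chainᴿ.Hypotheses r ep A (∂ A)
      right h = ep , record
        { uniformA = uniform ; uniformB = ∂-uniform uniform ; shadowed = λ _ z → z ; nonempty = 1≤b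
        ; ratio = ≤-respˡ (*-congʳ (sym (one-comm Q))) (*-cancelˡ-≤ 0<S+1 (*-cancelˡ-≤ 0<x+c
            (right-ratio x Q (1# - g) b w c ep S (≤-respˡ (*-congˡ (*-congʳ (p-right x ρ ⟨ q′ ⟩))) shadow-A) ep-rel h S≤x 0≤x 0≤t 1≤S 0≤Q 0≤c 0≤b)))
        ; upper = *-cancelˡ-≤ 0<x (right-upper₃ x Q ρ b c N′ N₀ ε
            (*-cancelˡ-≤ 0<p (right-upper₂ x b w c p N′ shadow-A
              (right-upper₁ Q ρ Cₛ (Cₛ - E) N′ w (1# - g) p w-rel (gC≥F Cₛ E g (Cₛ - E) refl E≤gC) N′-rel (p-right x ρ ⟨ q′ ⟩)
                (*-cancelˡ-≤ 0<Q+1 (right-upper₀ Q ρ Cₛ N′ N′-rel 0≤C 0≤Q 0≤ρ)) 0≤t 0≤ρ 0≤N′) 0≤x 0≤c))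
            N₀-rel S≤x 1≤x refl 0≤c 1≤ρ (0≤fromℕ ((suc q ℕ.+ r′) C r′)) 0≤N′ 0≤x)
        ; 0≤ep = 0≤ep ; ep-small = ≤-reflexive (trans (*-congˡ (s-right Q ρ)) (trans ep-rel (*-congˡ (sym (one-comm Q))))) }
        where
        0<S+1 : 0# < S + 1#
        0<S+1 = 1≤⇒0< (≤-trans 1≤S (≤-respˡ (+-identityʳ S) (+-mono-≤ ≤-refl 0≤1)))
        0<Q+1 : 0# < Q + 1#
        0<Q+1 = 1≤⇒0< (≤-trans 1≤Q (≤-respˡ (+-identityʳ Q) (+-mono-≤ ≤-refl 0≤1)))
        ep N₀ : Carrier
        ep = fromℕ 1000 * c * (Q + 1#) * ((S + 1#) ⁻¹)
        N₀ = ⟨ (suc q ℕ.+ r′) C r′ ⟩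
        0≤N′ : 0# ≤ N′
        0≤N′ = 0≤fromℕ ((suc q ℕ.+ r) C r)
        ep-rel : ep * (S + 1#) ≈ fromℕ 1000 * c * (Q + 1#)
        ep-rel = divided (fromℕ 1000 * c * (Q + 1#)) 0<S+1
        0≤ep : 0# ≤ ep
        0≤ep = *-nonneg (*-nonneg 0≤ε (proj₁ 0<Q+1)) (inverse-nonneg 0<S+1)
        w-rel : w ≈ (Q + ρ + 1#) * Cₛ - (ρ + 1#) * (Cₛ - E)
        w-rel = antisym (w-comp Q ρ Cₛ E (Cₛ - E) w w≈ refl 0≤ρ) (w-comp′ Q ρ Cₛ E (Cₛ - E) w w≈ refl 0≤ρ)
        N₀-rel : ρ * N′ ≈ (Q + 1# + ρ) * N₀
        N₀-rel = trans (*-congʳ (one-comm ⟨ r′ ⟩)) (trans (Binomials.N-suc R q r′) (*-congʳ (ratio-index Q ⟨ r′ ⟩)))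

      record Approximation : Set where
        field
          {index}  : ℕ
          vertices : Subset n
          size     : ∣ vertices ∣ ≡ suc (index ℕ.+ r)
          missing  : ⟨ card (kSubsetsOf (suc r) vertices ∖ᶠ A) ⟩ ≤ fromℕ 2 * ε * ⟨ (index ℕ.+ r) C r ⟩
          exterior : ⟨ card (A ∖ᶠ kSubsetsOf (suc r) vertices) ⟩ ≤ fromℕ 12 * ε * ⟨ (index ℕ.+ r) C r ⟩

      approximationᴸ : (∃ λ ep → Chainᴸ.Hypotheses r ep A (∂ A)) → Approximation
      approximationᴸ (ep , h) = let (close , outside) = Chainᴸ.stability⁺ r′ h in record
        { index = q′ ; vertices = Chainᴸ.Close.S close ; size = Chainᴸ.Close.size close ; missing = Chainᴸ.Close.missingA close ; exterior = outside }

      approximationᴿ : (∃ λ ep → Chainᴿ.Hypotheses r ep A (∂ A)) → Approximation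
      approximationᴿ (ep , h) = let (close , outside) = Chainᴿ.stability⁺ r′ h in record
        { index = q ; vertices = Chainᴿ.Close.S close ; size = Chainᴿ.Close.size close ; missing = Chainᴿ.Close.missingA close ; exterior = outside }

      abstract
        approximation : Approximation
        approximation = [ approximationᴸ ∘ left , approximationᴿ ∘ right ]′ near

-- Bracketing |A|, the case k = 1, and assembly of both conclusions.

module Conclusions where
  open Families
  open KruskalKatona using (kruskal-katona′)
  open InitialSegments
  open RealArithmetic
  open LovászBound
  open LovászGap
  open RisingFactorials
  open ShadowLocation
  open import Data.Nat.Combinatorics using (nCn≡1)
  open import Data.Fin.Properties using () renaming (_≟_ to _≟ᶠ_)
  open import Data.Vec.Base as Vec using (tabulate)
  open import Data.Vec.Properties using (lookup∘tabulate; lookup-replicate)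
  open import Data.Sum using ([_,_]′)

  bracket : (h : ℕ → ℕ) (a : ℕ) → h 0 ℕ.≤ a → (∀ m → m ℕ.< h m) → ∃ λ m → h m ℕ.≤ a × a ℕ.< h (suc m)
  bracket h a h₀ grow = search a (grow a)
    where
    search : ∀ m → a ℕ.< h m → ∃ λ m → h m ℕ.≤ a × a ℕ.< h (suc m)
    search zero lt = ⊥-elim (ℕₚ.<⇒≱ lt h₀)
    search (suc m) lt with ℕₚ.≤-<-connex (h m) a
    ... | inj₁ le = m , le , lt
    ... | inj₂ gt = search m gt

  binomial-grows : ∀ r m → m ℕ.< (suc m ℕ.+ r) C suc r
  binomial-grows r zero rewrite nCn≡1 (suc r) = ℕₚ.≤-refl
  binomial-grows r (suc m) = ℕₚ.≤-trans (ℕₚ.+-mono-≤ {1} {_} {suc m} (1≤ r) (binomial-grows r m)) (ℕₚ.≤-reflexive (Pascal (suc m ℕ.+ r) r))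
    where
    1≤ : ∀ r → 1 ℕ.≤ (suc m ℕ.+ r) C r
    1≤ r = nCk>0 (suc m) r

  module KSets {n} {A : Family n} (r′ : ℕ) (uniform : Uniform (suc (suc r′)) A) (S : Subset n) where
    private
      k : ℕ
      k = suc (suc r′)
      K K⁻ : Family n
      K = kSubsetsOf k S
      K⁻ = kSubsetsOf (suc r′) S

    -- As S misses few of its k-subsets, E₁ ≥ 1, as ShadowOfJ requires.
    shadow-lower-bound : ∀ s′ t → t ≡ suc s′ → card (K ∖ᶠ A) ℕ.< s′ C suc r′ → ∣ S ∣ ≡ t → (E₁ E₂ : ℕ) →
      E₁ ℕ.≤ (t ℕ.∸ 1) C suc r′ → E₂ ℕ.≤ (t ℕ.∸ 1) C suc r′ →
      card (A ∩ᶠ K) ≡ (t ℕ.∸ 1) C k ℕ.+ E₁ → card (A ∖ᶠ K) ≡ E₂ →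
      card (shadow k (Jfam (t ℕ.+ 1) k t E₁ E₂)) ℕ.≤ card (shadow k A)
    shadow-lower-bound s′ _ ≡.refl few size E₁ E₂ hi₁ hi₂ inside ≡.refl = begin
      card (shadow k (Jfam (suc s′ ℕ.+ 1) k (suc s′) E₁ E₂))
        ≤⟨ ShadowOfJ.card-shadow-J s′ r′ E₁ E₂ 1≤E₁ hi₁ hi₂ (suc s′ ℕ.+ 1) (ℕₚ.+-comm (suc s′) 1) (λ X p → uniform X (∧-fst p)) inner inside
             (outside-pair S uniform (∂-uniform uniform) (λ _ h → h)) ⟩
      card (∂ A ∩ᶠ K⁻) ℕ.+ card (∂ A ∖ᶠ K⁻) ≡⟨ card-split (∂ A) K⁻ ⟨
      card (∂ A) ≡⟨ card-cong (shadow≡∂ uniform) ⟨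
      card (shadow k A) ∎
      where
      open ℕₚ.≤-Reasoning
      inner : ∂ (A ∩ᶠ K) ⊑ (∂ A ∩ᶠ K⁻)
      inner X p with ∂-elim (A ∩ᶠ K) X p
      ... | v , x , q = ∧-intro (∂-intro A v X x (∧-fst q)) (kSub-intro S X (∂-uniform {F = A ∩ᶠ K} (λ Y h → uniform Y (∧-fst h)) X p)
              (⊆ᵇ-insert⁻ v X S x (kSub-⊆ {k = k} S (insert v X) (∧-snd {A (insert v X)} q))))
      1≤E₁ : 1 ℕ.≤ E₁
      1≤E₁ = ℕₚ.n≢0⇒n>0 λ e → ℕₚ.<-irrefl (missing e) few
        where
        missing : E₁ ≡ 0 → card (K ∖ᶠ A) ≡ s′ C suc r′
        missing ≡.refl = ℕₚ.+-cancelˡ-≡ (s′ C k) _ _ (≡.sym (≡.trans (ℕₚ.+-comm (s′ C k) _) (≡.trans (Pascal s′ (suc r′))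
          (≡.trans (≡.cong (_C k) (≡.sym size)) (≡.trans (≡.sym (card-kSubsets k S)) (≡.trans (card-split K A)
            (≡.cong (ℕ._+ card (K ∖ᶠ A)) (≡.trans (card-ext {F = K ∩ᶠ A} {G = A ∩ᶠ K} (λ X p → ∧-intro (∧-snd {K X} p) (∧-fst p)) (λ X p → ∧-intro (∧-snd {A X} p) (∧-fst p)))
              (≡.trans inside (ℕₚ.+-identityʳ _))))))))))

  -- For k = 1 there are no links to descend along, but the union of `A` represents it exactly, and
  -- a shadow can contain only the empty set.
  module Singletons {n} {A : Family n} (uniform : Uniform 1 A) where
    support : Subset n
    support = tabulate (λ w → A (insert w ⊥))

    lookup-singleton : ∀ {n} (w u : Fin n) → lookup (insert w ⊥) u ≡ true → u ≡ w
    lookup-singleton w u e with w ≟ᶠ u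
    ... | yes ≡.refl = ≡.refl
    ... | no ne = true≢false e (≡.trans (lookup-insert′ ⊥ ne) (lookup-replicate u false))

    exact : ∀ X → ¬ T ((A △ᶠ kSubsetsOf 1 support) X)
    exact X p = [ (λ q → not⇒¬T (∧-snd {A X} q) (in-support X (∧-fst q)))
                , (λ q → not⇒¬T (∧-snd {kSubsetsOf 1 support X} q) (in-A X (∧-fst q))) ]′ (∨-cases p)
      where
      in-support : ∀ X → T (A X) → T (kSubsetsOf 1 support X)
      in-support X a with singleton-form X (uniform X a)
      ... | w , _ , ≡.refl = kSub-intro support X (uniform X a) (⊆ᵇ-intro X support λ u e →
              ≡.subst (λ u → lookup support u ≡ true) (≡.sym (lookup-singleton w u e)) (≡.trans (lookup∘tabulate (λ w → A (insert w ⊥)) w) (T⇒true a)))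
      in-A : ∀ X → T (kSubsetsOf 1 support X) → T (A X)
      in-A X h with singleton-form X (kSub-size {k = 1} support X h)
      ... | w , e , ≡.refl = true⇒T (≡.trans (≡.sym (lookup∘tabulate (λ w → A (insert w ⊥)) w)) (⊆ᵇ-elim X support (kSub-⊆ {k = 1} support X h) w e))

    shadow-lower-bound : ∀ N (J : Family N) → 1 ℕ.≤ card A → card (shadow 1 J) ℕ.≤ card (shadow 1 A)
    shadow-lower-bound N J pos = ℕₚ.≤-trans (card-uniform₀ {F = shadow 1 J} λ X p → hasSize-elim X (∧-fst p))
      (ℕₚ.≤-trans (one (card-witness A pos)) (ℕₚ.≤-reflexive (≡.sym (card-cong (shadow≡∂ uniform)))))
      where
      one : (∃ λ X → T (A X)) → 1 ℕ.≤ card (∂ A)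
      one (X , a) = let (w , e , _) = singleton-form X (uniform X a) in card-≥1 (erase w X) (∂-erase A w X e a)

  module AssemblyCertificates (R : CompleteOrderedField) where
    open Certificates R

    reassoc = identity 5 (λ x p c i B → x * (p * ((# 1 + c * i) * B)) ≈ (x + c * (x * i)) * (p * B)) ≡.refl
    total-distance = certify 6 (λ e c M δ m o →
      m ≤ # 2 * e * M ∷ o ≤ # 12 * e * M ∷ e ≈ # 1000 * c ∷ # 20000 * c ≤ δ ∷ # 0 ≤ M ∷ # 0 ≤ c ∷ [] ⊢
      o + m ≼ δ * M)
      0 ((1 , 0 ∷ []) ∷ (1 , 1 ∷ []) ∷ (14 , 2 ∷ 5 ∷ []) ∷ (1 , 4 ∷ 5 ∷ []) ∷ (6000 , 5 ∷ 6 ∷ []) ∷ []) ≡.refl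
    missing-few = certify 2 (λ e M →
      M ≤ # 2 * e * M ∷ # 1000 * e ≤ # 1 ∷ # 1 ≤ M ∷ [] ⊢
      # 1 ≼ # 0)
      498 ((500 , 0 ∷ []) ∷ (1 , 1 ∷ []) ∷ (1 , 1 ∷ 2 ∷ []) ∷ (499 , 2 ∷ []) ∷ []) ≡.refl
    pred-cancel = identity 2 (λ q r → # 1 + (q + r) - # 1 - r ≈ q) ≡.refl
    falling-suc = identity 3 (λ F f p → f * (p * F) ≈ p * (f * F)) ≡.refl
    mul-swap = identity 3 (λ a b c → a * (b * c) ≈ b * (a * c)) ≡.refl

  module Assembly (R : CompleteOrderedField) where
    open CompleteOrderedField R hiding (zero)
    open OrderedField R
    open Lovász R
    open Rising R
    open Locations R
    open AssemblyCertificates R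

    -- M bounds 1/c from below; it stays a variable so that its numeral is never unfolded.
    module _ (M : ℕ) (million : 1000 ℕ.* 1000 ℕ.≤ M) (enough : 20000 ℕ.≤ M) where
      0<M : 0# < ⟨ M ⟩
      0<M = positive (ℕₚ.≤-trans (ℕ.s≤s ℕ.z≤n) enough)

      ≈-cancel : ∀ {c u v} → 0# < c → c * u ≈ c * v → u ≈ v
      ≈-cancel h e = antisym (*-cancelˡ-≤ h (≤-reflexive e)) (*-cancelˡ-≤ h (≤-reflexive (sym e)))

      cancel-quotient : ∀ {z} k → 0# < z → z * (k / z) ≈ k
      cancel-quotient {z} k h = trans (mul-swap z k (z ⁻¹)) (trans (*-congˡ (⁻¹-inverse z (0<⇒≉0 h))) (*-identityʳ k))

      binomial-value : ∀ q r → binomR (⟨ suc (q ℕ.+ r) ⟩ - 1#) r ≈ ⟨ (q ℕ.+ r) C r ⟩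
      binomial-value q r = ≈-cancel (!-positive r) (trans (cancel-quotient _ (!-positive r)) (trans (falling-rising r _)
        (trans (rising-cong r (trans (+-congʳ (+-congʳ (+-congˡ (fromℕ-+ q r)))) (pred-cancel ⟨ q ⟩ ⟨ r ⟩))) (rising-binomial q r))))

      module _ {n} (δ : Carrier) (0<δ : 0# < δ) (δ<1 : δ < 1#) (A : Family n) (x : Carrier) where
        c : Carrier
        c = δ / ⟨ M ⟩

        c-rel : ⟨ M ⟩ * c ≈ δ
        c-rel = cancel-quotient δ 0<M

        0≤c : 0# ≤ c
        0≤c = *-cancel-nonneg 0<M (≤-respʳ (sym c-rel) (proj₁ 0<δ))

        scaled-c : ∀ m → m ℕ.≤ M → ⟨ m ⟩ * c ≤ δ
        scaled-c m h = ≤-respʳ c-rel (≤-respˡ (*-comm c ⟨ m ⟩) (≤-respʳ (*-comm c ⟨ M ⟩) (*-mono-≤ˡ 0≤c (fromℕ-mono h))))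

        c-small : fromℕ 1000 * (fromℕ 1000 * c) ≤ 1#
        c-small = ≤-trans (≤-respˡ (trans (*-congʳ (fromℕ-* 1000 1000)) (*-assoc (fromℕ 1000) (fromℕ 1000) c)) (scaled-c (1000 ℕ.* 1000) million)) (proj₁ δ<1)

        module _ (r : ℕ) (k≤x : ⟨ suc r ⟩ ≤ x) (card-A : ⟨ card A ⟩ ≈ binomR x (suc r)) where
          falling-A : falling x (suc r) ≈ ⟨ suc r ! ⟩ * ⟨ card A ⟩
          falling-A = sym (trans (*-congˡ card-A) (cancel-quotient (falling x (suc r)) (!-positive (suc r))))

          rising-A : rising (x - ⟨ suc r ⟩) (suc r) ≈ ⟨ suc r ! ⟩ * ⟨ card A ⟩
          rising-A = trans (sym (falling-rising (suc r) x)) falling-A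

          nonempty : 1 ℕ.≤ card A
          nonempty = ℕₚ.n≢0⇒n>0 λ e → 1≰0 (≤-trans (1≤rising (x - ⟨ suc r ⟩) (suc r) (-≥0 k≤x))
            (≤-reflexive (trans rising-A (trans (*-congˡ (reflexive (≡.cong ⟨_⟩ e))) (zeroʳ _)))))

        Conclusion : ℕ → Set
        Conclusion k = ∃ λ S →
          (⟨ card (A △ᶠ kSubsetsOf k S) ⟩ ≤ δ * binomR (⟨ ∣ S ∣ ⟩ - 1#) (k ℕ.∸ 1)) ×
          ((E₁ E₂ : ℕ) → E₁ ℕ.≤ (∣ S ∣ ℕ.∸ 1) C (k ℕ.∸ 1) → E₂ ℕ.≤ (∣ S ∣ ℕ.∸ 1) C (k ℕ.∸ 1) →
            card (A ∩ᶠ kSubsetsOf k S) ≡ (∣ S ∣ ℕ.∸ 1) C k ℕ.+ E₁ → card (A ∖ᶠ kSubsetsOf k S) ≡ E₂ →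
            card (shadow k (Jfam (∣ S ∣ ℕ.+ 1) k ∣ S ∣ E₁ E₂)) ℕ.≤ card (shadow k A))

        singletons : Uniform 1 A → ⟨ 1 ⟩ ≤ x → ⟨ card A ⟩ ≈ binomR x 1 → Conclusion 1
        singletons uniform 1≤x card-A = support
          , ≤-respˡ (sym (reflexive (≡.cong ⟨_⟩ (card-empty exact)))) (*-nonneg (proj₁ 0<δ) binom₀)
          , λ E₁ E₂ _ _ _ _ → shadow-lower-bound (∣ support ∣ ℕ.+ 1) (Jfam (∣ support ∣ ℕ.+ 1) 1 ∣ support ∣ E₁ E₂) (nonempty 0 1≤x card-A)
          where
          open Singletons uniform
          binom₀ : 0# ≤ binomR (⟨ ∣ support ∣ ⟩ - 1#) 0
          binom₀ = *-cancel-nonneg (!-positive 0) (≤-respʳ (sym (cancel-quotient 1# (!-positive 0))) 0≤1)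

        module _ (r′ : ℕ) (uniform : Uniform (suc (suc r′)) A) where
          private
            r k : ℕ
            r = suc r′
            k = suc r
            ε : Carrier
            ε = fromℕ 1000 * c

          conclude : (q′ : ℕ) (S : Subset n) → ∣ S ∣ ≡ suc (q′ ℕ.+ r) →
            ⟨ card (kSubsetsOf k S ∖ᶠ A) ⟩ ≤ fromℕ 2 * ε * ⟨ (q′ ℕ.+ r) C r ⟩ →
            ⟨ card (A ∖ᶠ kSubsetsOf k S) ⟩ ≤ fromℕ 12 * ε * ⟨ (q′ ℕ.+ r) C r ⟩ → Conclusion k
          conclude q′ S size missing exterior = S
            , ≤-respʳ (*-congˡ (sym value)) (≤-trans (≤-respʳ (fromℕ-+ o m) (fromℕ-mono (card-cover (A ∖ᶠ K) (K ∖ᶠ A) (A △ᶠ K) λ X p → ∨-cases p)))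
                -- Exterior and missing sets together amount to (12 + 2) ε = 14000 c times the
                -- binomial coefficient.
                (total-distance ε c N δ ⟨ m ⟩ ⟨ o ⟩ missing exterior refl (scaled-c 20000 enough) (0≤fromℕ ((q′ ℕ.+ r) C r)) 0≤c))
            , KSets.shadow-lower-bound r′ uniform S (q′ ℕ.+ r) ∣ S ∣ size few-missing ≡.refl
            where
            K : Family n
            K = kSubsetsOf k S
            m o : ℕ
            m = card (K ∖ᶠ A)
            o = card (A ∖ᶠ K)
            N : Carrier
            N = ⟨ (q′ ℕ.+ r) C r ⟩
            value : binomR (⟨ ∣ S ∣ ⟩ - 1#) r ≈ N
            value = trans (reflexive (≡.cong (λ t → binomR (⟨ t ⟩ - 1#) r) size)) (binomial-value q′ r)
            -- At most 2 ε N sets are missing, with ε ≤ 1/1000 and N ≥ 1; this strict inequality is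
            -- what excludes E₁ = 0.
            few-missing : m ℕ.< (q′ ℕ.+ r) C r
            few-missing = fromℕ-< λ le → 1≰0 (missing-few ε N (≤-trans le missing) c-small (1≤fromℕ (nCk>0 q′ r)))

          large : ⟨ k ⟩ ≤ x → ⟨ card A ⟩ ≈ binomR x k → ⟨ card (shadow k A) ⟩ ≤ (1# + c / x) * binomR x r → Conclusion k
          large k≤x card-A shadow-A = locate (bracket (λ m → (suc m ℕ.+ r) C k) (card A) first (binomial-grows r))
            where
            first : (1 ℕ.+ r) C k ℕ.≤ card A
            first = ℕₚ.≤-trans (ℕₚ.≤-reflexive (nCn≡1 k)) (nonempty r k≤x card-A)
            1≤x : 1# ≤ x
            1≤x = ≤-trans (1≤fromℕ {k} (ℕ.s≤s ℕ.z≤n)) k≤x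
            0<x : 0# < x
            0<x = 1≤⇒0< 1≤x
            p : Carrier
            p = x - ⟨ r ⟩
            0≤p : 0# ≤ p
            0≤p = -≥0 (≤-trans (fromℕ-mono (ℕₚ.n≤1+n r)) k≤x)
            pB : p * binomR x r ≈ ⟨ k ⟩ * ⟨ card A ⟩
            pB = ≈-cancel (!-positive r) (trans (falling-suc (binomR x r) ⟨ r ! ⟩ p) (trans (*-congˡ (cancel-quotient (falling x r) (!-positive r)))
              (trans (*-comm p (falling x r)) (trans (falling-A r k≤x card-A) (trans (*-congʳ (fromℕ-* k (r !))) (trans (*-assoc ⟨ k ⟩ ⟨ r ! ⟩ _) (mul-swap ⟨ k ⟩ ⟨ r ! ⟩ _)))))))
            -- The shadow hypothesis is freed of divisions by multiplying with x and x - r, using (x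
            -- - r) C(x, r) = (r + 1) C(x, r + 1).
            shadow-A′ : x * (p * ⟨ card (∂ A) ⟩) ≤ (x + c) * (⟨ k ⟩ * ⟨ card A ⟩)
            shadow-A′ = ≤-respʳ (trans (reassoc x p c (x ⁻¹) (binomR x r)) (*-cong (+-congˡ (trans (*-congˡ (⁻¹-inverse x (0<⇒≉0 0<x))) (*-identityʳ c))) pB))
              (*-mono-≤ˡ (proj₁ 0<x) (*-mono-≤ˡ 0≤p (≤-respˡ (reflexive (≡.cong ⟨_⟩ (card-cong (shadow≡∂ uniform)))) shadow-A)))
            locate : (∃ λ m → (suc m ℕ.+ r) C k ℕ.≤ card A × card A ℕ.< (suc (suc m) ℕ.+ r) C k) → Conclusion k
            locate (q′ , lo , hi) = conclude index vertices size missing exterior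
              where open Location.Approximation (Location.approximation q′ r′ A uniform x c 0≤c c-small k≤x (rising-A r k≤x card-A) shadow-A′ lo hi)

theorem1p2 : (R : CompleteOrderedField) →
    let open CompleteOrderedField R in
    (n k : ℕ) → 1 ≤ℕ n → 1 ≤ℕ k →
    (δ₀ : Carrier) → 0# < δ₀ → δ₀ < 1# →
    (A : Family n) → (∀ X → T (A X) → ∣ X ∣ ≡ k) →
    (x : Carrier) → fromℕ k ≤ x → fromℕ (card A) ≈ binomR x k →
    fromℕ (card (shadow k A))
    ≤ (1# + (δ₀ / fromℕ (10 ^ 9)) / x) * binomR x (k ∸ 1) →
    ∃ λ S →
    (fromℕ (card (A △ᶠ kSubsetsOf k S))
    ≤ δ₀ * binomR (fromℕ ∣ S ∣ - 1#) (k ∸ 1))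
    × ((E₁ E₂ : ℕ) →
    E₁ ≤ℕ (∣ S ∣ ∸ 1) C (k ∸ 1) → E₂ ≤ℕ (∣ S ∣ ∸ 1) C (k ∸ 1) →
    card (A ∩ᶠ kSubsetsOf k S) ≡ ((∣ S ∣ ∸ 1) C k) +ℕ E₁ →
    card (A ∖ᶠ kSubsetsOf k S) ≡ E₂ →
    card (shadow k (Jfam (∣ S ∣ +ℕ 1) k ∣ S ∣ E₁ E₂))
    ≤ℕ card (shadow k A))
theorem1p2 R n 1 _ _ δ₀ 0<δ₀ δ₀<1 A uniform x k≤x card-A _ =
  Conclusions.Assembly.singletons R (10 ^ 9) (ℕₚ.≤ᵇ⇒≤ _ _ tt) (ℕₚ.≤ᵇ⇒≤ _ _ tt) δ₀ 0<δ₀ δ₀<1 A x uniform k≤x card-A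
theorem1p2 R n (suc (suc r)) _ _ δ₀ 0<δ₀ δ₀<1 A uniform x k≤x card-A shadow-A =
  Conclusions.Assembly.large R (10 ^ 9) (ℕₚ.≤ᵇ⇒≤ _ _ tt) (ℕₚ.≤ᵇ⇒≤ _ _ tt) δ₀ 0<δ₀ δ₀<1 A x r uniform k≤x card-A shadow-A
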